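{- Assume $\mathsf{TC}^0\subsetneq\mathsf{NC}^1$. Then a modern Hopfield model with $n$ steps of chain of thought, embedding size $\log n$ and constant precision can solve the word problem $\mathcal{L}_{S_5}$. However, a modern Hopfield model with constant depth, polynomial embedding size $\mathrm{poly}(n)$ and $\log n$ precision, but without chain of thought, cannot solve it.
   Context: Word problem: for a group $G$ and $n$ elements $f_1,\dots,f_n$ of $G$, $\mathcal{L}_G$ is the problem of determining whether $f_1\circ f_2\circ\cdots\circ f_n$ equals the identity of $G$. $S_5$ is the permutation group over 5 elements. Circuit classes. $\mathsf{TC}^0$: languages computed by circuit families of polynomial size and constant depth with unbounded fan-in $\mathsf{AND}$, $\mathsf{OR}$, $\mathsf{NOT}$ and $\mathsf{MAJORITY}$ gates. $\mathsf{NC}^1$: languages computed by circuit families of polynomial size and depth $O(\log n)$ with bounded fan-in $\mathsf{AND}$, $\mathsf{OR}$ and $\mathsf{NOT}$ gates. Precision. Precision $p$ means computing with $p$-bit floating-point numbers: pairs $\langle s,e\rangle$ of integers with $s\in(-2^p,-2^{p-1}]\cup\{0\}\cup[2^{p-1},2^p)$ and $e\in[-2^p,2^p)$, of value $s\cdot2^e$, with results rounded to this set. Modern Hopfield model. Let $\mathcal V$ be the vocabulary, $n_{\max}$ the maximum input length and $d$ the embedding size. The model is GPT-like, with a token embedding $\theta_{\mathsf{TE}}:\mathcal V\to\mathbb R^d$, a position encoding $\theta_{\mathsf{PE}}:\{1,\dots,n_{\max}\}\to\mathbb R^d$, an output layer $h\mapsto\mathrm{softmax}(\theta_{\mathsf{OUTPUT}}h)$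 with $\theta_{\mathsf{OUTPUT}}\in\mathbb R^{|\mathcal V|\times d}$, and $L$ identically structured decoder layers ($L$ is the depth). Each decoder layer consists of a single Hopfield layer and a two-layer ReLU feed-forward network, with trainable parameters; together they form an $L$-layer modern Hopfield network $\mathsf{MHN}$. The Hopfield layer maps state patterns $R\in\mathbb R^{n\times d}$ and stored patterns $Y\in\mathbb R^{n\times d}$ to $Z=\mathrm{softmax}(\beta\cdot RW_QW_K^\top Y^\top)Y\tilde W_V$ (row-wise softmax), where $W_Q,W_K\in\mathbb R^{d\times d}$, $\beta>0$, and $\tilde W_V\in\mathbb R^{d\times d}$ is $W_KW_V$ or a stand-alone parameter matrix. The feed-forward network maps each row $x$ (as a column vector) to $W_2\,\mathsf{ReLU}(W_1x+b_1)+b_2$ with $W_1,W_2\in\mathbb R^{d\times d}$, $b_1,b_2\in\mathbb R^d$. $\theta$ denotes all parameters. On input $(x_1,\dots,x_n)\in\mathcal V^n$, $n\le n_{\max}$: $h_i^{(0)}=\theta_{\mathsf{TE}}(x_i)+\theta_{\mathsf{PE}}(i)$; $(h_1^{(1)},\dots,h_n^{(1)})=\mathsf{MHN}(h_1^{(0)},\dots,h_n^{(0)})$; $p_\theta(\cdot\mid x_1,\dots,x_i)=\mathrm{softmax}(\theta_{\mathsf{OUTPUT}}h_i^{(1)})$; and $\mathsf{MHM}_\theta(x_1,\dots,x_n)=\arg\max_{y\in\mathcal V}p_\theta(y\mid x_1,\dots,x_n)$. Chain of thought. $\mathsf{MHM}^1_\theta=\mathsf{MHM}_\theta$ and, recursively,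 $\mathsf{MHM}^i_\theta(x_1,\dots,x_n)=\mathsf{MHM}^{i-1}_\theta(x_1,\dots,x_n,\mathsf{MHM}_\theta(x_1,\dots,x_n))$, provided $i+n\le n_{\max}-1$; so $\mathsf{MHM}^i_\theta$ is the $i$-th token generated autoregressively. A model with $n$ steps of chain of thought outputs $\mathsf{MHM}^n_\theta$; one without chain of thought outputs $\mathsf{MHM}_\theta$. -}

module Defs where

open import Algebra.Bundles using (Group)
open import Data.Bool.Base using (Bool; true; not)
open import Data.Bool.ListAction using (and; or)
open import Data.Empty using (⊥)
open import Data.Fin.Base as Fin using (Fin; fromℕ; inject≤)
open import Data.Fin.Permutation as Perm using (Permutation′; _∘ₚ_; _⟨$⟩ʳ_)
open import Data.Integer.Base as ℤ using (ℤ; +_; -[1+_])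
open import Data.List.Base as List using (List; []; _∷_)
open import Data.List.Extrema using () renaming (argmax to argmaxOn)
open import Data.Nat.Base
open import Data.Nat.Logarithm using (⌊log₂_⌋)
open import Data.Nat.Properties using (m^n≢0; +-suc; <⇒≤; m≤n+m; ≤-trans)
open import Data.Product.Base using (_×_; _,_; ∃; ∃₂; Σ-syntax; ∃-syntax)
open import Data.Rational.Base as ℚ using (ℚ; 0ℚ; 1ℚ)
import Data.Rational.Properties as ℚ
open import Data.Sum.Base using (_⊎_)
open import Data.Unit.Base using (⊤)
open import Data.Vec.Base as Vec using (Vec; _∷ʳ_)
open import Data.Vec.Functional as Vector using (Vector)
open import Function.Base using (_∘_)
open import Function.Bundles using (Injection; _⇔_; Inverse)
open import Level using (0ℓ)
open import Relation.Binary.Bundles using (DecTotalOrder)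
open import Relation.Binary.PropositionalEquality
  using (_≡_; _≢_; refl; sym; trans; cong; subst; setoid)
open import Relation.Nullary using (¬_; yes; no)
open import Relation.Unary using (Pred; _∈_; _∉_)

------------------------------------------------------------------------
-- Growth rates

infix 4 _∈O_

_∈O_ : (ℕ → ℕ) → (ℕ → ℕ) → Set
f ∈O g = ∃₂ λ c N → ∀ n → N ≤ n → f n ≤ c * g n

Constant Logarithmic Polynomial : (ℕ → ℕ) → Set
Constant    f = f ∈O (λ _ → 1)
Logarithmic f = f ∈O ⌊log₂_⌋
Polynomial  f = ∃[ k ] f ∈O (_^ k)

------------------------------------------------------------------------
-- Word problems

WordProblem : ∀ {c ℓ} (G : Group c ℓ) {n : ℕ} → Pred (Vec (Group.Carrier G) n) ℓ
WordProblem G fs = Vec.foldr′ _∙_ ε fs ≈ ε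
  where open Group G

-- π ∙ ρ applies ρ first, whereas _∘ₚ_ is diagrammatic composition.
S₅ : Group 0ℓ 0ℓ
S₅ = record
  { Carrier = Permutation′ 5
  ; _≈_     = Perm._≈_
  ; _∙_     = λ π ρ → ρ ∘ₚ π
  ; ε       = Perm.id
  ; _⁻¹     = Perm.flip
  ; isGroup = record
    { isMonoid = record
      { isSemigroup = record
        { isMagma = record
          { isEquivalence = record
            { refl  = λ _ → refl
            ; sym   = λ π≈ρ i → sym (π≈ρ i)
            ; trans = λ π≈ρ ρ≈σ i → trans (π≈ρ i) (ρ≈σ i)
            }
          ; ∙-cong = λ {π} {π′} {ρ} {ρ′} π≈π′ ρ≈ρ′ i →
              trans (cong (π ⟨$⟩ʳ_) (ρ≈ρ′ i)) (π≈π′ (ρ′ ⟨$⟩ʳ i))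
          }
        ; assoc = λ _ _ _ _ → refl
        }
      ; identity = (λ _ _ → refl) , (λ _ _ → refl)
      }
    ; inverse = (λ π _ → Perm.inverseˡ π) , (λ π _ → Perm.inverseʳ π)
    ; ⁻¹-cong = λ {π} {ρ} π≈ρ i →
        trans (cong (Inverse.from π)
                (sym (trans (π≈ρ (Inverse.from ρ i)) (Perm.inverseʳ ρ))))
              (Perm.inverseˡ π)
    }
  }

------------------------------------------------------------------------
-- Circuits

-- A gate whose inputs are drawn from m existing nodes.  The same node may
-- be listed repeatedly.
data Gate (m : ℕ) : Set where
  AND OR MAJORITY : List (Fin m) → Gate m
  NOT             : Fin m → Gate m

-- Circuits are DAGs in topological order.  In Nodes n m there are m nodes
-- in total, including the n inputs; the latest gate is node zero.
infixl 5 _▷_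

data Nodes (n : ℕ) : ℕ → Set where
  inputs : Nodes n n
  _▷_    : ∀ {m} → Nodes n m → Gate m → Nodes n (suc m)

record Circuit (n : ℕ) : Set where
  field
    {#nodes} : ℕ
    nodes    : Nodes n #nodes
    output   : Fin #nodes

-- True iff strictly more than half of the inputs are true.
majority : List Bool → Bool
majority bs = List.length bs <ᵇ 2 * List.length (List.filterᵇ (λ b → b) bs)

fanIn : ∀ {m} → Gate m → List (Fin m)
fanIn (AND is)      = is
fanIn (OR is)       = is
fanIn (MAJORITY is) = is
fanIn (NOT i)       = i ∷ []

evalGate : ∀ {m} → Gate m → Vec Bool m → Bool
evalGate (AND is)      v = and (List.map (Vec.lookup v) is)
evalGate (OR is)       v = or (List.map (Vec.lookup v) is)
evalGate (MAJORITY is) v = majority (List.map (Vec.lookup v) is)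
evalGate (NOT i)       v = not (Vec.lookup v i)

evalNodes : ∀ {n m} → Nodes n m → Vec Bool n → Vec Bool m
evalNodes inputs   w = w
evalNodes (C ▷ g)  w = evalGate g (evalNodes C w) Vec.∷ evalNodes C w

eval : ∀ {n} → Circuit n → Vec Bool n → Bool
eval C w = Vec.lookup (evalNodes nodes w) output
  where open Circuit C

depths : ∀ {n m} → Nodes n m → Vec ℕ m
depths {n} inputs = Vec.replicate n 0
depths (C ▷ g)    =
  suc (List.foldr _⊔_ 0 (List.map (Vec.lookup (depths C)) (fanIn g))) Vec.∷ depths C

depth : ∀ {n} → Circuit n → ℕ
depth C = Vec.lookup (depths nodes) output
  where open Circuit C

-- Gates plus wires; since wires may be repeated, the number of gates alone
-- would not bound the description of a circuit.
sizeNodes : ∀ {n m} → Nodes n m → ℕ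
sizeNodes inputs  = 0
sizeNodes (C ▷ g) = suc (List.length (fanIn g)) + sizeNodes C

size : ∀ {n} → Circuit n → ℕ
size C = sizeNodes (Circuit.nodes C)

AllGates : (∀ {m} → Gate m → Set) → ∀ {n m} → Nodes n m → Set
AllGates P inputs  = ⊤
AllGates P (C ▷ g) = P g × AllGates P C

-- AND, OR and NOT gates of fan-in at most b.
BoundedGate : ℕ → ∀ {m} → Gate m → Set
BoundedGate b (AND is)     = List.length is ≤ b
BoundedGate b (OR is)      = List.length is ≤ b
BoundedGate b (MAJORITY _) = ⊥
BoundedGate b (NOT _)      = ⊤

Language : Set₁
Language = Pred (List Bool) 0ℓ

CircuitFamily : Set
CircuitFamily = ∀ n → Circuit n

Computes : CircuitFamily → Language → Set
Computes C ℒ = ∀ n (w : Vec Bool n) → (Vec.toList w ∈ ℒ) ⇔ (eval (C n) w ≡ true)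

TC⁰ : Pred Language 0ℓ
TC⁰ ℒ = Σ[ C ∈ CircuitFamily ]
    Computes C ℒ
  × Polynomial (λ n → size (C n))
  × Constant (λ n → depth (C n))

NC¹ : Pred Language 0ℓ
NC¹ ℒ = Σ[ C ∈ CircuitFamily ] ∃[ b ]
    Computes C ℒ
  × Polynomial (λ n → size (C n))
  × Logarithmic (λ n → depth (C n))
  × (∀ n → AllGates (BoundedGate b) (Circuit.nodes (C n)))

------------------------------------------------------------------------
-- Floating-point numbers

record Float (p : ℕ) : Set where
  constructor ⟨_,_⟩
  field
    significand exponent : ℤ
    .{significand-range} :
      significand ≡ + 0 ⊎ (2 ^ (p ∸ 1) ≤ ℤ.∣ significand ∣ × ℤ.∣ significand ∣ < 2 ^ p)
    .{exponent-range} :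
      (ℤ.- (+ (2 ^ p)) ℤ.≤ exponent) × (exponent ℤ.< + (2 ^ p))

⟦_⟧ : ∀ {p} → Float p → ℚ
⟦ ⟨ s , + e ⟩ ⟧      = (s ℤ.* + (2 ^ e)) ℚ./ 1
⟦ ⟨ s , -[1+ e ] ⟩ ⟧ = (s ℚ./ (2 ^ suc e)) {{m^n≢0 2 (suc e)}}

-- r is a value of precision p nearest to the limit of the convergent
-- rational sequence a, that is, |lim a - r| ≤ |lim a - r′| for all r′.
NearestToLimit : ∀ {p} → (ℕ → ℚ) → Float p → Set
NearestToLimit {p} a r = ∀ (r′ : Float p) (δ : ℚ) → 0ℚ ℚ.< δ →
  ∃[ K ] ∀ k → K ≤ k →
    ℚ.∣ a k ℚ.- ⟦ r ⟧ ∣ ℚ.≤ ℚ.∣ a k ℚ.- ⟦ r′ ⟧ ∣ ℚ.+ δ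

expTerm : ℚ → ℕ → ℚ
expTerm x zero    = 1ℚ
expTerm x (suc k) = expTerm x k ℚ.* x ℚ.* (+ 1 ℚ./ suc k)

expPartialSum : ℚ → ℕ → ℚ
expPartialSum x zero    = 0ℚ
expPartialSum x (suc k) = expPartialSum x k ℚ.+ expTerm x k

-- Rounding to nearest, with saturation at the ends of the range and with
-- any rule for breaking ties, together with a correctly rounded
-- exponential function.
record FloatArithmetic (p : ℕ) : Set where
  field
    round         : ℚ → Float p
    round-nearest : ∀ x (r : Float p) →
                    ℚ.∣ x ℚ.- ⟦ round x ⟧ ∣ ℚ.≤ ℚ.∣ x ℚ.- ⟦ r ⟧ ∣
    exp           : Float p → Float p
    exp-nearest   : ∀ x → NearestToLimit (expPartialSum ⟦ x ⟧) (exp x)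

------------------------------------------------------------------------
-- Modern Hopfield models

Matrix : Set → ℕ → ℕ → Set
Matrix A m n = Vector (Vector A n) m

infixl 8 _ᵀ

_ᵀ : ∀ {A m n} → Matrix A m n → Matrix A n m
(A ᵀ) i j = A j i

data ValueWeights (p d : ℕ) : Set where
  product    : (W-V : Matrix (Float p) d d) → ValueWeights p d    -- W̃_V = W_K W_V
  standalone : (W̃-V : Matrix (Float p) d d) → ValueWeights p d

record Layer (p d : ℕ) : Set where
  field
    β        : Float p
    β>0      : 0ℚ ℚ.< ⟦ β ⟧
    W-Q W-K  : Matrix (Float p) d d
    values   : ValueWeights p d
    W₁ W₂    : Matrix (Float p) d d
    b₁ b₂    : Vector (Float p) d

-- The parameters θ at precision p, with embedding size d, depth L, maximum
-- input length n-max and vocabulary Fin (suc v).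
record Parameters (p d L n-max v : ℕ) : Set where
  field
    θ-TE     : Fin (suc v) → Vector (Float p) d
    θ-PE     : Fin n-max → Vector (Float p) d
    layers   : Vec (Layer p d) L
    θ-OUTPUT : Matrix (Float p) (suc v) d

argmax : ∀ {v} → (Fin (suc v) → ℚ) → Fin (suc v)
argmax f = argmaxOn (DecTotalOrder.totalOrder ℚ.≤-decTotalOrder) f Fin.zero (List.allFin _)

module Model {p : ℕ} (𝔸 : FloatArithmetic p) where
  open FloatArithmetic 𝔸

  infixl 7 _⊗_ _⊘_ _·_
  infixl 6 _⊕_

  _⊕_ _⊗_ _⊘_ : Float p → Float p → Float p
  x ⊕ y = round (⟦ x ⟧ ℚ.+ ⟦ y ⟧)
  x ⊗ y = round (⟦ x ⟧ ℚ.* ⟦ y ⟧)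
  -- By convention x / 0 = 0.  This is only relevant to a softmax all of
  -- whose exponentials underflow.
  x ⊘ y with ⟦ y ⟧ ℚ.≟ 0ℚ
  ... | yes _   = round 0ℚ
  ... | no  y≢0 = round ((⟦ x ⟧ ℚ.÷ ⟦ y ⟧) {{ℚ.≢-nonZero y≢0}})

  -- An iterated sum is rounded only once.
  sum : ∀ {n} → Vector (Float p) n → Float p
  sum xs = round (Vector.foldr ℚ._+_ 0ℚ (λ i → ⟦ xs i ⟧))

  dot : ∀ {n} → Vector (Float p) n → Vector (Float p) n → Float p
  dot xs ys = sum (λ i → xs i ⊗ ys i)

  _·_ : ∀ {l m n} → Matrix (Float p) l m → Matrix (Float p) m n → Matrix (Float p) l n
  (A · B) i j = dot (A i) ((B ᵀ) j)

  softmax : ∀ {n} → Vector (Float p) n → Vector (Float p) n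
  softmax xs i = exp (xs i) ⊘ sum (exp ∘ xs)

  relu : Float p → Float p
  relu x = round (0ℚ ℚ.⊔ ⟦ x ⟧)

  valueMatrix : ∀ {d} → Layer p d → Matrix (Float p) d d
  valueMatrix ℓ with Layer.values ℓ
  ... | product W-V    = Layer.W-K ℓ · W-V
  ... | standalone W̃-V = W̃-V

  hopfield : ∀ {n d} → Layer p d →
             Matrix (Float p) n d → Matrix (Float p) n d → Matrix (Float p) n d
  hopfield ℓ R Y = (λ i → softmax (λ j → β ⊗ scores i j)) · Y · valueMatrix ℓ
    where
    open Layer ℓ
    scores = R · W-Q · W-K ᵀ · Y ᵀ

  affine : ∀ {d} → Matrix (Float p) d d → Vector (Float p) d →
           Vector (Float p) d → Vector (Float p) d
  affine W b x i = dot (W i) x ⊕ b i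

  feedForward : ∀ {d} → Layer p d → Vector (Float p) d → Vector (Float p) d
  feedForward ℓ x = affine W₂ b₂ (relu ∘ affine W₁ b₁ x)
    where open Layer ℓ

  -- The current hidden states are both the state and the stored patterns.
  layer : ∀ {n d} → Layer p d → Matrix (Float p) n d → Matrix (Float p) n d
  layer ℓ h i = feedForward ℓ (hopfield ℓ h h i)

  MHN : ∀ {n d L} → Vec (Layer p d) L → Matrix (Float p) n d → Matrix (Float p) n d
  MHN Vec.[]       h = h
  MHN (ℓ Vec.∷ ℓs) h = MHN ℓs (layer ℓ h)

  module _ {d L n-max v : ℕ} (θ : Parameters p d L n-max v) where
    open Parameters θ

    embed : ∀ {n} → .(n ≤ n-max) → Vec (Fin (suc v)) n → Matrix (Float p) n d
    embed n≤n-max xs i j = θ-TE (Vec.lookup xs i) j ⊕ θ-PE (inject≤ i n≤n-max) j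

    nextTokenProbabilities : ∀ {m} → .(suc m ≤ n-max) →
                             Vec (Fin (suc v)) (suc m) → Vector (Float p) (suc v)
    nextTokenProbabilities {m} n≤n-max xs =
      softmax (λ y → dot (θ-OUTPUT y) (MHN layers (embed n≤n-max xs) (fromℕ m)))

    MHM : ∀ {m} → .(suc m ≤ n-max) → Vec (Fin (suc v)) (suc m) → Fin (suc v)
    MHM n≤n-max xs = argmax (λ y → ⟦ nextTokenProbabilities n≤n-max xs y ⟧)

    -- The token generated in step suc i, for an input of length n = suc m.
    -- The bound suc i + n ≤ n-max - 1 is stated as suc i + n < n-max.
    MHM^[1+_] : ∀ i {m} → .(suc i + suc m < n-max) →
                Vec (Fin (suc v)) (suc m) → Fin (suc v)
    MHM^[1+ zero  ]     b xs = MHM (≤-trans (m≤n+m _ 1) (<⇒≤ b)) xs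
    MHM^[1+ suc i ] {m} b xs =
      MHM^[1+ i ] (subst (_< n-max) (sym (+-suc (suc i) (suc m))) b)
        (xs ∷ʳ MHM (≤-trans (m≤n+m _ (suc (suc i))) (<⇒≤ b)) xs)

------------------------------------------------------------------------
-- Solving the word problem of S₅ with a modern Hopfield model

record Vocabulary : Set where
  field
    {v}    : ℕ
    token  : Injection (Group.setoid S₅) (setoid (Fin (suc v)))
    accept : Fin (suc v)
    reject : Fin (suc v)
    accept≢reject : accept ≢ reject

module _ (𝒱 : Vocabulary) where
  open Vocabulary 𝒱

  Solves : ∀ {n} → (Vec (Fin (suc v)) n → Fin (suc v)) → Set
  Solves {n} M = ∀ (fs : Vec (Group.Carrier S₅) n) →
      (fs ∈ WordProblem S₅ → M (Vec.map (Injection.to token) fs) ≡ accept)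
    × (fs ∉ WordProblem S₅ → M (Vec.map (Injection.to token) fs) ≡ reject)

  module _ (𝔸 : ∀ p → FloatArithmetic p) where

    -- Input length n = suc m, with n steps of chain of thought.
    SolvesWithCoT : (p d L m : ℕ) → Set
    SolvesWithCoT p d L m =
      ∃[ n-max ] Σ[ θ ∈ Parameters p d L n-max v ] Σ[ b ∈ suc m + suc m < n-max ]
        Solves (Model.MHM^[1+_] (𝔸 p) θ m b)

    -- Input length n = suc m.
    SolvesWithoutCoT : (p d L m : ℕ) → Set
    SolvesWithoutCoT p d L m =
      ∃[ n-max ] Σ[ θ ∈ Parameters p d L n-max v ] Σ[ b ∈ suc m ≤ n-max ]
        Solves (Model.MHM (𝔸 p) θ b)

{-# OPTIONS --safe #-}

-- With chain of thought, the model multiplies the permutations from right to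
-- left: if the input occupies positions 0, …, m, then the token generated at
-- position m + k is the product of the generated token there with the input at
-- position m - k.  Both positions have distance k from m, so an attention layer
-- that matches the binary code of this distance averages exactly these two.
-- A previous layer, in which every position attends to itself, has combined
-- token and role, so that the two summands of the average can be told apart.
-- All hidden states are bits, and all computations are exact at precision 2.
--
-- Without chain of thought, every value in the model is one of polynomially
-- many floats, and knowing which one by means of constant-depth circuits is
-- preserved by each operation.  Finitary operations are table lookups; for an
-- iterated sum, rounding is monotone, hence a matter of comparing a sum of
-- integers with thresholds, which majority gates and one step of carry
-- lookahead in a polynomial base achieve.  Feeding the model with the programs
-- that Barrington's theorem assigns to NC¹ circuits gives NC¹ ⊆ TC⁰.

module Submission where

open import Defs
open import Data.Empty using (⊥; ⊥-elim)
open import Data.Product.Base using (_×_; _,_; proj₁; proj₂; ∃; ∃₂; Σ-syntax; ∃-syntax)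
open import Data.Sum.Base using (_⊎_; inj₁; inj₂; [_,_]′)
open import Data.Vec.Base as Vec using (Vec)
open import Data.Vec.Functional as Vector using (Vector)
open import Function.Base using (_∘_; id)
open import Relation.Binary.PropositionalEquality

-- Circuit families are nonuniform, so the parameters chosen for each input length are hard-wired,
-- and only tokens and activations depend on the input. The obstacle is the iterated sum: at
-- logarithmic precision exponents range over polynomially many integers, hence a float in fixed
-- point has polynomially many bits, and sums are rounded only at the end. A base slightly above the
-- number of summands keeps column sums few enough to enumerate and leaves carries of at most one
-- after a single redistribution. Since zero has many representations, values rather than floats are
-- tracked, and every operation must be shown to respect them. With chain of thought the obstacle is
-- the precision: two bits reach no further than 24 in magnitude and cannot count the mismatches of
-- long codes. Saturation turns this into an advantage: any number of mismatches scores the same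
-- -24, and after scaling the exponential of -6 rounds to 0. Attention thus becomes an exact
-- selection, and every further computation is a threshold of at most four bits.

-- Constant-depth formulas and the predicates that they decide

module Formulas where

  open import Data.Bool.Base using (Bool; true; false; not; T)
  open import Data.Bool.Properties using (T-≡; T?)
  open import Data.Bool.ListAction using (and; or)
  open import Data.Fin.Base as Fin using (Fin; zero; suc; toℕ; combine; remQuot)
  open import Data.Fin.Properties using (remQuot-combine)
  open import Data.List.Base as List using (List; []; _∷_; _++_)
  import Data.List.Properties as List
  open import Data.Nat.Base
  open import Data.Nat.Properties
  import Data.Vec.Properties as Vec
  open import Function.Bundles using (Equivalence)
  open import Relation.Nullary using (¬_; Dec; yes; no)

  private variable
    n m m′ d k F : ℕ

  ∑ : ∀ {k} → (Fin k → ℕ) → ℕ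
  ∑ = Vector.foldr _+_ 0

  mapGate : (Fin m → Fin m′) → Gate m → Gate m′
  mapGate ρ (AND is)      = AND (List.map ρ is)
  mapGate ρ (OR is)       = OR (List.map ρ is)
  mapGate ρ (MAJORITY is) = MAJORITY (List.map ρ is)
  mapGate ρ (NOT i)       = NOT (ρ i)

  fanIn-mapGate : (ρ : Fin m → Fin m′) (g : Gate m) → fanIn (mapGate ρ g) ≡ List.map ρ (fanIn g)
  fanIn-mapGate ρ (AND is)      = refl
  fanIn-mapGate ρ (OR is)       = refl
  fanIn-mapGate ρ (MAJORITY is) = refl
  fanIn-mapGate ρ (NOT i)       = refl

  map-lookup : (ρ : Fin m → Fin m′) (v : Vec Bool m′) (u : Vec Bool m) →
               (∀ i → Vec.lookup v (ρ i) ≡ Vec.lookup u i) → (is : List (Fin m)) →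
               List.map (Vec.lookup v) (List.map ρ is) ≡ List.map (Vec.lookup u) is
  map-lookup ρ v u eq is = trans (sym (List.map-∘ is)) (List.map-cong eq is)

  evalGate-mapGate : (ρ : Fin m → Fin m′) (v : Vec Bool m′) (u : Vec Bool m) →
                     (∀ i → Vec.lookup v (ρ i) ≡ Vec.lookup u i) → (g : Gate m) →
                     evalGate (mapGate ρ g) v ≡ evalGate g u
  evalGate-mapGate ρ v u eq (AND is)      = cong and (map-lookup ρ v u eq is)
  evalGate-mapGate ρ v u eq (OR is)       = cong or (map-lookup ρ v u eq is)
  evalGate-mapGate ρ v u eq (MAJORITY is) = cong majority (map-lookup ρ v u eq is)
  evalGate-mapGate ρ v u eq (NOT i)       = cong not (eq i)

  -- Trees instead of DAGs: at constant depth, unfolding all sharing keeps the size polynomial. The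
  -- function computed is an index, so that no separate evaluator is needed. Children and wires are
  -- bounded separately because a majority gate may read one child many times.
  data Formula {n : ℕ} (F : ℕ) : ℕ → (Vec Bool n → Bool) → Set where
    input : ∀ {d} i → Formula F d (λ w → Vec.lookup w i)
    gate  : ∀ {d k} (g : Gate k) (fs : Fin k → Vec Bool n → Bool) →
            k ≤ F → List.length (fanIn g) ≤ F → (∀ i → Formula F d (fs i)) →
            Formula F (suc d) (λ w → evalGate g (Vec.tabulate (λ i → fs i w)))

  infix 4 _⊑_

  data _⊑_ {n : ℕ} : ∀ {m m′} → Nodes n m → Nodes n m′ → Set where
    ⊑-refl : ∀ {m} {C : Nodes n m} → C ⊑ C
    ⊑-step : ∀ {m m′} {C : Nodes n m} {D : Nodes n m′} {g} → C ⊑ D → C ⊑ D ▷ g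

  ⊑-trans : ∀ {m m′ m″} {C : Nodes n m} {D : Nodes n m′} {E : Nodes n m″} → C ⊑ D → D ⊑ E → C ⊑ E
  ⊑-trans C⊑D ⊑-refl       = C⊑D
  ⊑-trans C⊑D (⊑-step D⊑E) = ⊑-step (⊑-trans C⊑D D⊑E)

  embedNode : {C : Nodes n m} {D : Nodes n m′} → C ⊑ D → Fin m → Fin m′
  embedNode ⊑-refl       i = i
  embedNode (⊑-step C⊑D) i = suc (embedNode C⊑D i)

  evalNodes-embedNode : {C : Nodes n m} {D : Nodes n m′} (C⊑D : C ⊑ D) → ∀ i w →
    Vec.lookup (evalNodes D w) (embedNode C⊑D i) ≡ Vec.lookup (evalNodes C w) i
  evalNodes-embedNode ⊑-refl       i w = refl
  evalNodes-embedNode (⊑-step C⊑D) i w = evalNodes-embedNode C⊑D i w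

  depths-embedNode : {C : Nodes n m} {D : Nodes n m′} (C⊑D : C ⊑ D) → ∀ i →
    Vec.lookup (depths D) (embedNode C⊑D i) ≡ Vec.lookup (depths C) i
  depths-embedNode ⊑-refl       i = refl
  depths-embedNode (⊑-step C⊑D) i = depths-embedNode C⊑D i

  -- Up to `F` children are compiled afresh, and `suc F` pays for the gate itself and its wires.
  formulaSize : ℕ → ℕ → ℕ
  formulaSize F zero    = 0
  formulaSize F (suc d) = F * formulaSize F d + suc F

  formulaSize-bound : ∀ F d → suc (formulaSize F d) ≤ (2 + F) ^ d
  formulaSize-bound F zero    = ≤-refl
  formulaSize-bound F (suc d) = begin
    suc (F * formulaSize F d + suc F)  ≡⟨ cong suc (+-suc _ F) ⟩
    2 + (F * formulaSize F d + F)      ≡⟨ cong (2 +_) (trans (+-comm _ F) (sym (*-suc F _))) ⟩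
    2 + F * suc (formulaSize F d)      ≤⟨ +-mono-≤ (s≤s {1} (s≤s z≤n)) (*-monoʳ-≤ F (formulaSize-bound F d)) ⟩
    2 + F * (2 + F) ^ d                ≤⟨ +-monoˡ-≤ _ (*-monoʳ-≤ 2 (m^n>0 (2 + F) d)) ⟩
    2 * (2 + F) ^ d + F * (2 + F) ^ d  ≡⟨ sym (*-distribʳ-+ ((2 + F) ^ d) 2 F) ⟩
    (2 + F) ^ suc d                    ∎
    where open ≤-Reasoning

  -- Nodes are added on top of an arbitrary `C`, so that subformulas compiled one after another
  -- share one circuit. Depth is bounded at the outputs only and hence does not depend on the depth
  -- of `C`.
  record Compiled {n m} (C : Nodes n m) (k s d : ℕ) (fs : Fin k → Vec Bool n → Bool) : Set where
    field
      {#nodes} : ℕ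
      result   : Nodes n #nodes
      extends  : C ⊑ result
      outputs  : Fin k → Fin #nodes
      correct  : ∀ i w → Vec.lookup (evalNodes result w) (outputs i) ≡ fs i w
      shallow  : ∀ i → Vec.lookup (depths result) (outputs i) ≤ d
      small    : sizeNodes result ≤ s + sizeNodes C

  open Compiled

  compileAll : ∀ {s} k (fs : Fin k → Vec Bool n → Bool) →
               (∀ i {m} (C : Nodes n m) → Compiled C 1 s d (λ _ → fs i)) →
               ∀ {m} (C : Nodes n m) → Compiled C k (k * s) d fs
  compileAll zero fs compile C = record
    { result = C ; extends = ⊑-refl ; outputs = λ () ; correct = λ () ; shallow = λ () ; small = ≤-refl }
  compileAll {d = d} {s} (suc k) fs compile C = record
    { result  = result Q
    ; extends = ⊑-trans (extends P) (extends Q)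
    ; outputs = outs
    ; correct = corr
    ; shallow = shal
    ; small   = ≤-trans (small Q) (≤-trans (+-monoʳ-≤ (k * s) (small P))
                  (≤-reflexive (trans (sym (+-assoc (k * s) s _)) (cong (_+ sizeNodes C) (+-comm (k * s) s)))))
    }
    where
    P = compile zero C
    Q = compileAll k (fs ∘ suc) (compile ∘ suc) (result P)
    outs : Fin (suc k) → _
    outs zero    = embedNode (extends Q) (outputs P zero)
    outs (suc i) = outputs Q i
    corr : ∀ i w → Vec.lookup (evalNodes (result Q) w) (outs i) ≡ fs i w
    corr zero    w = trans (evalNodes-embedNode (extends Q) _ w) (correct P zero w)
    corr (suc i) w = correct Q i w
    shal : ∀ i → Vec.lookup (depths (result Q)) (outs i) ≤ d
    shal zero    = ≤-trans (≤-reflexive (depths-embedNode (extends Q) _)) (shallow P zero)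
    shal (suc i) = shallow Q i

  foldr-⊔-≤ : ∀ {k} (v : Vec ℕ m) (ρ : Fin k → Fin m) → (∀ i → Vec.lookup v (ρ i) ≤ d) →
              (is : List (Fin k)) → List.foldr _⊔_ 0 (List.map (Vec.lookup v) (List.map ρ is)) ≤ d
  foldr-⊔-≤ v ρ h []       = z≤n
  foldr-⊔-≤ v ρ h (i ∷ is) = ⊔-lub (h i) (foldr-⊔-≤ v ρ h is)

  input-node : ∀ {n m} (C : Nodes n m) → Fin n → Fin m
  input-node inputs  i = i
  input-node (C ▷ _) i = suc (input-node C i)

  eval-input-node : ∀ {n m} (C : Nodes n m) i w → Vec.lookup (evalNodes C w) (input-node C i) ≡ Vec.lookup w i
  eval-input-node inputs  i w = refl
  eval-input-node (C ▷ _) i w = eval-input-node C i w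

  depth-input-node : ∀ {n m} (C : Nodes n m) i → Vec.lookup (depths C) (input-node C i) ≡ 0
  depth-input-node inputs  i = Vec.lookup-replicate i 0
  depth-input-node (C ▷ _) i = depth-input-node C i

  compile : ∀ {f : Vec Bool n → Bool} → Formula F d f → ∀ {m} (C : Nodes n m) →
            Compiled C 1 (formulaSize F d) d (λ _ → f)
  compile {F = F} {d} (input i) C = record
    { result  = C
    ; extends = ⊑-refl
    ; outputs = λ _ → input-node C i
    ; correct = λ _ → eval-input-node C i
    ; shallow = λ _ → ≤-trans (≤-reflexive (depth-input-node C i)) z≤n
    ; small   = m≤n+m (sizeNodes C) (formulaSize F d)
    }
  compile {F = F} {suc d} (gate {k = k} g fs k≤F g≤F φs) C = record
    { result  = result P ▷ g′
    ; extends = ⊑-step (extends P)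
    ; outputs = λ _ → zero
    ; correct = λ _ w → evalGate-mapGate (outputs P) _ _
                  (λ i → trans (correct P i w) (sym (Vec.lookup∘tabulate (λ i → fs i w) i))) g
    ; shallow = λ _ → s≤s (subst (λ is → List.foldr _⊔_ 0 (List.map (Vec.lookup (depths (result P))) is) ≤ d)
                  (sym (fanIn-mapGate (outputs P) g))
                  (foldr-⊔-≤ (depths (result P)) (outputs P) (shallow P) (fanIn g)))
    ; small   = begin
        suc (List.length (fanIn g′)) + sizeNodes (result P)
          ≡⟨ cong (λ is → suc (List.length is) + sizeNodes (result P)) (fanIn-mapGate (outputs P) g) ⟩
        suc (List.length (List.map (outputs P) (fanIn g))) + sizeNodes (result P)
          ≡⟨ cong (λ l → suc l + sizeNodes (result P)) (List.length-map (outputs P) (fanIn g)) ⟩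
        suc (List.length (fanIn g)) + sizeNodes (result P)
          ≤⟨ +-mono-≤ (s≤s g≤F) (≤-trans (small P) (+-monoˡ-≤ (sizeNodes C) (*-monoˡ-≤ _ k≤F))) ⟩
        suc F + (F * formulaSize F d + sizeNodes C)
          ≡⟨ sym (+-assoc (suc F) _ _) ⟩
        (suc F + F * formulaSize F d) + sizeNodes C
          ≡⟨ cong (_+ sizeNodes C) (+-comm (suc F) _) ⟩
        (F * formulaSize F d + suc F) + sizeNodes C ∎
    }
    where
    open ≤-Reasoning
    P  = compileAll k fs (λ i → compile (φs i)) C
    g′ = mapGate (outputs P) g

  formulaCircuit : ∀ {f : Vec Bool n → Bool} → Formula F d f →
    Σ[ C ∈ Circuit n ] (∀ w → eval C w ≡ f w) × size C ≤ formulaSize F d × depth C ≤ d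
  formulaCircuit φ = record { nodes = result P ; output = outputs P zero }
                   , correct P zero , ≤-trans (small P) (≤-reflexive (+-identityʳ _)) , shallow P zero
    where P = compile φ inputs

  -- Hiding the Boolean function lets formulas be combined by what they decide; passing to an
  -- equivalent predicate costs no gate.
  record Decides {n} (F d : ℕ) (P : Vec Bool n → Set) : Set where
    field
      {function} : Vec Bool n → Bool
      formula  : Formula F d function
      sound    : ∀ w → function w ≡ true → P w
      complete : ∀ w → P w → function w ≡ true

  open Decides

  private variable
    P Q : Vec Bool n → Set

  deepen : ∀ {f : Vec Bool n → Bool} → Formula F d f → Formula F (suc d) f
  deepen (input i)            = input i
  deepen (gate g fs k≤F g≤F φs) = gate g fs k≤F g≤F (λ i → deepen (φs i))

  decides-deepen : Decides F d P → Decides F (suc d) P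
  decides-deepen D = record { formula = deepen (formula D) ; sound = sound D ; complete = complete D }

  decides-+ : ∀ k → Decides F d P → Decides F (k + d) P
  decides-+ zero    D = D
  decides-+ (suc k) D = decides-deepen (decides-+ k D)

  decides-map : (∀ w → P w → Q w) → (∀ w → Q w → P w) → Decides F d P → Decides F d Q
  decides-map to from D = record
    { formula = formula D ; sound = λ w → to w ∘ sound D w ; complete = λ w → complete D w ∘ from w }

  decides-input : ∀ {n} (i : Fin n) → Decides F d (λ w → Vec.lookup w i ≡ true)
  decides-input i = record { formula = input i ; sound = λ _ eq → eq ; complete = λ _ eq → eq }

  and-tabulate⁻ : ∀ {k} (b : Fin k → Bool) → and (List.tabulate b) ≡ true → ∀ i → b i ≡ true
  and-tabulate⁻ b eq zero    with true ← b zero = refl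
  and-tabulate⁻ b eq (suc i) with true ← b zero = and-tabulate⁻ (b ∘ suc) eq i

  and-tabulate⁺ : ∀ {k} (b : Fin k → Bool) → (∀ i → b i ≡ true) → and (List.tabulate b) ≡ true
  and-tabulate⁺ {zero}  b h = refl
  and-tabulate⁺ {suc k} b h rewrite h zero = and-tabulate⁺ (b ∘ suc) (h ∘ suc)

  or-tabulate⁻ : ∀ {k} (b : Fin k → Bool) → or (List.tabulate b) ≡ true → ∃[ i ] b i ≡ true
  or-tabulate⁻ {suc k} b eq with b zero in eq₀
  ... | true  = zero , eq₀
  ... | false with i , bi ← or-tabulate⁻ (b ∘ suc) eq = suc i , bi

  or-tabulate⁺ : ∀ {k} (b : Fin k → Bool) i → b i ≡ true → or (List.tabulate b) ≡ true
  or-tabulate⁺ b zero    eq rewrite eq = refl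
  or-tabulate⁺ b (suc i) eq with b zero
  ... | true  = refl
  ... | false = or-tabulate⁺ (b ∘ suc) i eq

  module _ {k : ℕ} {P : Fin k → Vec Bool n → Set} (k≤F : k ≤ F) (D : ∀ i → Decides F d (P i)) where

    private
      values : Vec Bool n → Vec Bool k
      values w = Vec.tabulate (λ i → function (D i) w)

      lookup-values : ∀ w i → Vec.lookup (values w) i ≡ function (D i) w
      lookup-values w = Vec.lookup∘tabulate _

      wires : List (Fin k)
      wires = List.allFin k

      wires≤F : List.length wires ≤ F
      wires≤F = ≤-trans (≤-reflexive (List.length-tabulate id)) k≤F

      wire-values : ∀ w → List.map (Vec.lookup (values w)) wires ≡ List.tabulate (λ i → function (D i) w)
      wire-values w = trans (List.map-tabulate id _) (List.tabulate-cong (lookup-values w))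

    decides-∀ : Decides F (suc d) (λ w → ∀ i → P i w)
    decides-∀ = record
      { formula  = gate (AND wires) _ k≤F wires≤F (λ i → formula (D i))
      ; sound    = λ w eq i → sound (D i) w (and-tabulate⁻ _ (trans (cong and (sym (wire-values w))) eq) i)
      ; complete = λ w p → trans (cong and (wire-values w)) (and-tabulate⁺ _ (λ i → complete (D i) w (p i)))
      }

    decides-∃ : Decides F (suc d) (λ w → ∃[ i ] P i w)
    decides-∃ = record
      { formula  = gate (OR wires) _ k≤F wires≤F (λ i → formula (D i))
      ; sound    = λ w eq → let i , bi = or-tabulate⁻ _ (trans (cong or (sym (wire-values w))) eq) in i , sound (D i) w bi
      ; complete = λ w (i , p) → trans (cong or (wire-values w)) (or-tabulate⁺ _ i (complete (D i) w p))
      }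

  decides-¬ : 1 ≤ F → Decides F d P → Decides F (suc d) (λ w → ¬ P w)
  decides-¬ {P = P} 1≤F D = record
    { formula  = gate {k = 1} (NOT zero) (λ _ → function D) 1≤F 1≤F (λ _ → formula D)
    ; sound    = sound′
    ; complete = complete′
    }
    where
    sound′ : ∀ w → not (function D w) ≡ true → ¬ P w
    sound′ w eq p with () ← trans (sym eq) (cong not (complete D w p))
    complete′ : ∀ w → ¬ P w → not (function D w) ≡ true
    complete′ w ¬p with function D w in eq
    ... | true  = ⊥-elim (¬p (sound D w eq))
    ... | false = refl

  -- Constants are empty conjunctions and disjunctions. They cost one level, whence the `suc d` in
  -- many later statements.
  decides-const : ∀ {A : Set} → Dec A → Decides {n} F (suc d) (λ _ → A)
  decides-const (yes a) = record
    { formula = gate {k = 0} (AND []) (λ ()) z≤n z≤n (λ ()) ; sound = λ _ _ → a ; complete = λ _ _ → refl }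
  decides-const (no ¬a) = record
    { formula = gate {k = 0} (OR []) (λ ()) z≤n z≤n (λ ()) ; sound = λ _ () ; complete = λ _ a → ⊥-elim (¬a a) }

  decides-× : 2 ≤ F → Decides F d P → Decides F d Q → Decides F (suc d) (λ w → P w × Q w)
  decides-× {F = F} {d} {P = P} {Q = Q} 2≤F D E =
    decides-map {P = λ w → ∀ (i : Fin 2) → Vec.lookup (P Vec.∷ Q Vec.∷ Vec.[]) i w} (λ _ h → h zero , h (suc zero)) (λ _ → λ { (p , q) zero → p ; (p , q) (suc zero) → q })
      (decides-∀ 2≤F both)
    where
    both : ∀ i → Decides F d (Vec.lookup (P Vec.∷ Q Vec.∷ Vec.[]) i)
    both zero       = D
    both (suc zero) = E

  decides-⊎ : 2 ≤ F → Decides F d P → Decides F d Q → Decides F (suc d) (λ w → P w ⊎ Q w)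
  decides-⊎ {F = F} {d} {P = P} {Q = Q} 2≤F D E =
    decides-map {P = λ w → ∃[ i ] Vec.lookup (P Vec.∷ Q Vec.∷ Vec.[]) i w} (λ _ → λ { (zero , p) → inj₁ p ; (suc zero , q) → inj₂ q })
      (λ _ → λ { (inj₁ p) → zero , p ; (inj₂ q) → suc zero , q })
      (decides-∃ 2≤F both)
    where
    both : ∀ i → Decides F d (Vec.lookup (P Vec.∷ Q Vec.∷ Vec.[]) i)
    both zero       = D
    both (suc zero) = E

  count : List Bool → ℕ
  count = List.length ∘ List.filterᵇ id

  count-++ : ∀ xs ys → count (xs ++ ys) ≡ count xs + count ys
  count-++ xs ys = trans (cong List.length (List.filter-++ (T? ∘ id) xs ys)) (List.length-++ (List.filterᵇ id xs))

  count-replicate-true : ∀ a → count (List.replicate a true) ≡ a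
  count-replicate-true zero    = refl
  count-replicate-true (suc a) = cong suc (count-replicate-true a)

  count-replicate-false : ∀ a → count (List.replicate a false) ≡ 0
  count-replicate-false zero    = refl
  count-replicate-false (suc a) = count-replicate-false a

  count-concat : ∀ {k} (xss : Fin k → List Bool) → count (List.concat (List.tabulate xss)) ≡ ∑ (count ∘ xss)
  count-concat {zero}  xss = refl
  count-concat {suc k} xss = trans (count-++ (xss zero) _) (cong (count (xss zero) +_) (count-concat (xss ∘ suc)))

  count-tabulate : ∀ {B} (b : Fin B → Bool) c → c ≤ B → (∀ j → b j ≡ true → toℕ j < c) →
                   (∀ j → toℕ j < c → b j ≡ true) → count (List.tabulate b) ≡ c
  count-tabulate {zero}  b zero    c≤B to from = refl
  count-tabulate {suc B} b zero    c≤B to from with b zero in eq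
  ... | true  = ⊥-elim (n≮0 (to zero eq))
  ... | false = count-tabulate (b ∘ suc) 0 z≤n (λ j eq → ⊥-elim (n≮0 (to (suc j) eq))) (λ j ())
  count-tabulate {suc B} b (suc c) (s≤s c≤B) to from rewrite from zero (s≤s z≤n) =
    cong suc (count-tabulate (b ∘ suc) c c≤B (λ j → s≤s⁻¹ ∘ to (suc j)) (λ j → from (suc j) ∘ s≤s))

  ∑-cong : ∀ {k} {f g : Fin k → ℕ} → (∀ i → f i ≡ g i) → ∑ f ≡ ∑ g
  ∑-cong {zero}  h = refl
  ∑-cong {suc k} h = cong₂ _+_ (h zero) (∑-cong (h ∘ suc))

  length-concat-tabulate : ∀ {A : Set} {B} k (xss : Fin k → List A) → (∀ i → List.length (xss i) ≡ B) →
                           List.length (List.concat (List.tabulate xss)) ≡ k * B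
  length-concat-tabulate zero    xss h = refl
  length-concat-tabulate (suc k) xss h = trans (List.length-++ (xss zero)) (cong₂ _+_ (h zero) (length-concat-tabulate k (xss ∘ suc) (h ∘ suc)))

  thresholdFanIn : (k B t : ℕ) → ℕ
  thresholdFanIn k B t = suc (k * B) + (2 * t + k * B)

  -- Padding with suc (k * B) true and 2 * t false inputs moves the threshold
  -- of the majority to t.
  decides-≤∑ : ∀ {k} (c : Fin k → Vec Bool n → ℕ) B t → thresholdFanIn k B t ≤ F → 2 + k * B ≤ F →
               (∀ i w → c i w ≤ B) → (∀ i (j : Fin B) → Decides F (suc d) (λ w → toℕ j < c i w)) →
               Decides F (2 + d) (λ w → t ≤ ∑ (λ i → c i w))
  decides-≤∑ {n = n} {F = F} {d = d} {k = k} c B t fanIn≤F nodes≤F c≤B D = record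
    { formula  = gate (MAJORITY wires) _ nodes≤F wires≤F (λ i → formula (E i))
    ; sound    = λ w eq → sound′ w (subst T (majority-value w) (Equivalence.from T-≡ eq))
    ; complete = λ w t≤ → Equivalence.to T-≡ (subst T (sym (majority-value w)) (complete′ w t≤))
    }
    where
    a b : ℕ
    a = suc (k * B)
    b = 2 * t

    -- Two constant children supply the padding; the others are the unary digits of the `k`
    -- summands, so that counting true bits adds the summands.
    fs-P : Fin (2 + k * B) → Vec Bool n → Set
    fs-P zero          w = 0 ≡ 0
    fs-P (suc zero)    w = ⊥
    fs-P (suc (suc x)) w = toℕ (proj₂ (remQuot {k} B x)) < c (proj₁ (remQuot {k} B x)) w

    E : ∀ x → Decides F (suc d) (fs-P x)
    E zero          = decides-const (yes refl)
    E (suc zero)    = decides-const (no id)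
    E (suc (suc x)) = D (proj₁ (remQuot {k} B x)) (proj₂ (remQuot {k} B x))

    wire : Fin k → Fin B → Fin (2 + k * B)
    wire i j = suc (suc (combine i j))

    block : Fin k → List (Fin (2 + k * B))
    block i = List.tabulate (wire i)

    wires : List (Fin (2 + k * B))
    wires = List.replicate a zero ++ (List.replicate b (suc zero) ++ List.concat (List.tabulate block))

    length-wires : List.length wires ≡ a + (b + k * B)
    length-wires = trans (List.length-++ (List.replicate a zero)) (cong₂ _+_ (List.length-replicate a)
      (trans (List.length-++ (List.replicate b (suc zero))) (cong₂ _+_ (List.length-replicate b)
        (length-concat-tabulate k block (λ i → List.length-tabulate (wire i))))))

    wires≤F : List.length wires ≤ F
    wires≤F = ≤-trans (≤-reflexive length-wires) fanIn≤F

    module _ (w : Vec Bool n) where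
      v : Vec Bool (2 + k * B)
      v = Vec.tabulate (λ x → function (E x) w)

      S : ℕ
      S = ∑ (λ i → c i w)

      lv : Fin (2 + k * B) → Bool
      lv = Vec.lookup v

      lv-wire : ∀ i j → lv (wire i j) ≡ function (D i j) w
      lv-wire i j = trans (Vec.lookup∘tabulate (λ x → function (E x) w) (wire i j))
        (cong (λ (i , j) → function (D i j) w) (remQuot-combine i j))

      count-block : ∀ i → count (List.map lv (block i)) ≡ c i w
      count-block i = trans (cong count (List.map-tabulate (wire i) lv))
        (count-tabulate (lv ∘ wire i) (c i w) (c≤B i w)
          (λ j eq → sound (D i j) w (trans (sym (lv-wire i j)) eq))
          (λ j j< → trans (lv-wire i j) (complete (D i j) w j<)))

      count-wires : count (List.map lv wires) ≡ a + S
      count-wires = begin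
        count (List.map lv wires)
          ≡⟨ cong count (List.map-++ lv (List.replicate a zero) _) ⟩
        count (List.map lv (List.replicate a zero) ++ List.map lv (List.replicate b (suc zero) ++ _))
          ≡⟨ count-++ (List.map lv (List.replicate a zero)) _ ⟩
        count (List.map lv (List.replicate a zero)) + count (List.map lv (List.replicate b (suc zero) ++ _))
          ≡⟨ cong₂ _+_ (trans (cong count (List.map-replicate lv a zero)) (count-replicate-true a))
               (trans (cong count (List.map-++ lv (List.replicate b (suc zero)) _))
                 (trans (count-++ (List.map lv (List.replicate b (suc zero))) _)
                   (cong₂ _+_ (trans (cong count (List.map-replicate lv b (suc zero))) (count-replicate-false b))
                     (trans (cong count (trans (sym (List.concat-map (List.tabulate block))) (cong List.concat (List.map-tabulate block (List.map lv)))))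
                       (trans (count-concat (List.map lv ∘ block)) (∑-cong count-block)))))) ⟩
        a + S ∎
        where open ≡-Reasoning

      majority-value : majority (List.map lv wires) ≡ (a + (b + k * B) <ᵇ 2 * (a + S))
      majority-value = cong₂ (λ l c → l <ᵇ 2 * c) (trans (List.length-map lv wires) length-wires) count-wires

      -- With S the sum, the majority test `length < 2 * count` becomes 2kB + 2t + 1 < 2kB + 2 + 2S.
      -- The odd left side makes the strict test succeed at t = S.
      lhs : a + (b + k * B) ≡ suc (2 * (k * B) + 2 * t)
      lhs = cong suc (begin
        k * B + (2 * t + k * B)  ≡⟨ cong (k * B +_) (+-comm (2 * t) (k * B)) ⟩
        k * B + (k * B + 2 * t)  ≡⟨ sym (+-assoc (k * B) (k * B) (2 * t)) ⟩
        k * B + k * B + 2 * t    ≡⟨ cong (λ z → k * B + z + 2 * t) (sym (+-identityʳ (k * B))) ⟩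
        2 * (k * B) + 2 * t      ∎)
        where open ≡-Reasoning

      rhs : 2 * (a + S) ≡ 2 + (2 * (k * B) + 2 * S)
      rhs = trans (*-distribˡ-+ 2 a S) (cong (_+ 2 * S) (*-suc 2 (k * B)))

      sound′ : T (a + (b + k * B) <ᵇ 2 * (a + S)) → t ≤ S
      sound′ h = *-cancelˡ-≤ 2 (+-cancelˡ-≤ (2 * (k * B)) _ _ (s≤s⁻¹ (s≤s⁻¹ (subst₂ _<_ lhs rhs (<ᵇ⇒< _ _ h)))))

      complete′ : t ≤ S → T (a + (b + k * B) <ᵇ 2 * (a + S))
      complete′ t≤S = <⇒<ᵇ (subst₂ _<_ (sym lhs) (sym rhs) (s≤s (s≤s (+-monoʳ-≤ (2 * (k * B)) (*-monoʳ-≤ 2 t≤S)))))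

-- Iterated addition by carry-save and carry lookahead

module IteratedSums where

  open import Data.Bool.Base using (Bool)
  open import Data.Fin.Base as Fin using (Fin; zero; suc; toℕ; fromℕ<)
  open import Data.Fin.Properties using (toℕ-fromℕ<; toℕ<n)
  open import Data.Nat.Base
  open import Data.Nat.DivMod
  open import Data.Nat.Properties
  open import Data.Nat.Solver using (module +-*-Solver)
  open import Relation.Nullary using (¬_; Dec; yes; no)
  open Formulas

  module Radix (B : ℕ) .{{B≢0 : NonZero B}} where

    -- The entries of `w` need not be digits: column sums, which may exceed the base, are evaluated
    -- in the same way.
    fromDigits : (ℕ → ℕ) → ℕ → ℕ
    fromDigits w zero    = 0
    fromDigits w (suc K) = fromDigits w K + w K * B ^ K

    digit : ℕ → ℕ → ℕ
    digit V zero    = V % B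
    digit V (suc b) = digit (V / B) b

    digit< : ∀ V b → digit V b < B
    digit< V zero    = m%n<n V B
    digit< V (suc b) = digit< (V / B) b

    fromDigits-suc : ∀ w K → fromDigits w (suc K) ≡ w 0 + B * fromDigits (w ∘ suc) K
    fromDigits-suc w zero    = trans (*-identityʳ (w 0)) (sym (trans (cong (w 0 +_) (*-zeroʳ B)) (+-identityʳ (w 0))))
    fromDigits-suc w (suc K) = begin
      fromDigits w (suc K) + w (suc K) * (B * B ^ K)
        ≡⟨ cong (_+ w (suc K) * (B * B ^ K)) (fromDigits-suc w K) ⟩
      w 0 + B * fromDigits (w ∘ suc) K + w (suc K) * (B * B ^ K)
        ≡⟨ solve 5 (λ a b x y z → a :+ b :* x :+ y :* (b :* z) := a :+ b :* (x :+ y :* z)) refl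
             (w 0) B (fromDigits (w ∘ suc) K) (w (suc K)) (B ^ K) ⟩
      w 0 + B * (fromDigits (w ∘ suc) K + w (suc K) * B ^ K) ∎
      where
      open ≡-Reasoning
      open +-*-Solver

    fromDigits-digit : ∀ K V → V < B ^ K → fromDigits (digit V) K ≡ V
    fromDigits-digit zero    V (s≤s z≤n) = refl
    fromDigits-digit (suc K) V V<        = begin
      fromDigits (digit V) (suc K)                ≡⟨ fromDigits-suc (digit V) K ⟩
      V % B + B * fromDigits (digit (V / B)) K    ≡⟨ cong (λ z → V % B + B * z)
                                                       (fromDigits-digit K (V / B) (m<n*o⇒m/o<n (<-≤-trans V< (≤-reflexive (*-comm B (B ^ K)))))) ⟩
      V % B + B * (V / B)                         ≡⟨ cong (V % B +_) (*-comm B (V / B)) ⟩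
      V % B + V / B * B                           ≡⟨ sym (m≡m%n+[m/n]*n V B) ⟩
      V                                           ∎
      where open ≡-Reasoning

    fromDigits-+ : ∀ v w K → fromDigits (λ b → v b + w b) K ≡ fromDigits v K + fromDigits w K
    fromDigits-+ v w zero    = refl
    fromDigits-+ v w (suc K) = trans (cong (_+ (v K + w K) * B ^ K) (fromDigits-+ v w K))
      (solve 5 (λ a b x y z → a :+ b :+ (x :+ y) :* z := a :+ x :* z :+ (b :+ y :* z)) refl
        (fromDigits v K) (fromDigits w K) (v K) (w K) (B ^ K))
      where open +-*-Solver

    fromDigits-zero : ∀ K → fromDigits (λ _ → 0) K ≡ 0
    fromDigits-zero zero    = refl
    fromDigits-zero (suc K) = trans (+-identityʳ _) (fromDigits-zero K)

    fromDigits-∑ : ∀ {k} (v : Fin k → ℕ → ℕ) K →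
                   fromDigits (λ b → ∑ (λ i → v i b)) K ≡ ∑ (λ i → fromDigits (v i) K)
    fromDigits-∑ {zero}  v K = fromDigits-zero K
    fromDigits-∑ {suc k} v K = trans (fromDigits-+ (v zero) _ K) (cong (fromDigits (v zero) K +_) (fromDigits-∑ (v ∘ suc) K))

    -- The carry lookahead formula: `B ≤ u j` says that position `j` generates a carry unaided,
    -- `B ≤ suc (u i)` that position `i` passes an incoming carry on.
    Carry : (ℕ → ℕ) → ℕ → Set
    Carry u K = ∃[ j ] j < K × B ≤ u j × (∀ i → j < i → i < K → B ≤ suc (u i))

    module _ (u : ℕ → ℕ) (u≤ : ∀ b → 2 + u b ≤ 2 * B) where

      private
        -- Entries of at most 2B - 2 produce a carry of at most one out of each position. Hence a
        -- position can only generate, propagate or absorb.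
        bound : ∀ K → 2 + fromDigits u K ≤ 2 * B ^ K
        bound zero    = ≤-refl
        bound (suc K) = begin
          2 + (fromDigits u K + u K * B ^ K)  ≤⟨ +-monoˡ-≤ (u K * B ^ K) (bound K) ⟩
          2 * B ^ K + u K * B ^ K             ≡⟨ sym (*-distribʳ-+ (B ^ K) 2 (u K)) ⟩
          (2 + u K) * B ^ K                   ≤⟨ *-monoˡ-≤ (B ^ K) (u≤ K) ⟩
          2 * B * B ^ K                       ≡⟨ *-assoc 2 B (B ^ K) ⟩
          2 * B ^ suc K                       ∎
          where open ≤-Reasoning

      overflow⇒Carry : ∀ K → B ^ K ≤ fromDigits u K → Carry u K
      overflow⇒Carry zero    ()
      overflow⇒Carry (suc K) h with B ≤? u K | B ≤? suc (u K)
      ... | yes B≤u | _       = K , ≤-refl , B≤u , λ i K<i i≤K → ⊥-elim (<⇒≱ K<i (s≤s⁻¹ i≤K))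
      -- The top entry is at most B - 2 and absorbs the incoming carry, so that nothing overflows.
      ... | no B≰u  | no B≰1+u = ⊥-elim (<⇒≱ (begin-strict
          fromDigits u K + u K * B ^ K  <⟨ +-monoˡ-< (u K * B ^ K) (≤-trans (n≤1+n _) (bound K)) ⟩
          2 * B ^ K + u K * B ^ K       ≡⟨ sym (*-distribʳ-+ (B ^ K) 2 (u K)) ⟩
          (2 + u K) * B ^ K             ≤⟨ *-monoˡ-≤ (B ^ K) (≰⇒> B≰1+u) ⟩
          B ^ suc K                     ∎) h)
        where open ≤-Reasoning
      ... | no B≰u  | yes B≤1+u with j , j<K , B≤uj , propagates ← overflow⇒Carry K (+-cancelʳ-≤ (u K * B ^ K) (B ^ K) (fromDigits u K)
                                  (≤-trans (*-monoˡ-≤ (B ^ K) (≰⇒> B≰u)) h))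
        = j , m≤n⇒m≤1+n j<K , B≤uj , extended
        where
        extended : ∀ i → j < i → i < suc K → B ≤ suc (u i)
        extended i j<i i≤K with m≤n⇒m<n∨m≡n (s≤s⁻¹ i≤K)
        ... | inj₁ i<K  = propagates i j<i i<K
        ... | inj₂ refl = B≤1+u

      Carry⇒overflow : ∀ K → Carry u K → B ^ K ≤ fromDigits u K
      Carry⇒overflow (suc K) (j , j≤K , B≤uj , propagates) with m≤n⇒m<n∨m≡n (s≤s⁻¹ j≤K)
      ... | inj₂ refl = ≤-trans (*-monoˡ-≤ (B ^ K) B≤uj) (m≤n+m _ (fromDigits u K))
      ... | inj₁ j<K  = begin
          B * B ^ K                     ≤⟨ *-monoˡ-≤ (B ^ K) (propagates K j<K ≤-refl) ⟩
          suc (u K) * B ^ K             ≤⟨ +-monoˡ-≤ (u K * B ^ K) (Carry⇒overflow K (j , j<K , B≤uj , λ i j<i i<K → propagates i j<i (m≤n⇒m≤1+n i<K))) ⟩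
          fromDigits u K + u K * B ^ K  ∎
        where open ≤-Reasoning

    -- All columns hand their quotients to the next column simultaneously, without rippling. The
    -- value is preserved except for the quotient that leaves the top column, and the entries become
    -- small enough for carry lookahead.
    carrySave : (ℕ → ℕ) → ℕ → ℕ
    carrySave w zero    = w 0 % B
    carrySave w (suc b) = w (suc b) % B + w b / B

    fromDigits-carrySave : ∀ w K → fromDigits w (suc K) ≡ fromDigits (carrySave w) (suc K) + w K / B * B ^ suc K
    fromDigits-carrySave w zero    = trans (*-identityʳ (w 0)) (trans (m≡m%n+[m/n]*n (w 0) B)
      (sym (cong₂ (λ x y → x + w 0 / B * y) (*-identityʳ (w 0 % B)) (*-identityʳ B))))
    fromDigits-carrySave w (suc K) = begin
      fromDigits w (suc K) + w (suc K) * B ^ suc K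
        ≡⟨ cong₂ (λ x y → x + y * B ^ suc K) (fromDigits-carrySave w K) (m≡m%n+[m/n]*n (w (suc K)) B) ⟩
      fromDigits (carrySave w) (suc K) + w K / B * B ^ suc K + (w (suc K) % B + w (suc K) / B * B) * B ^ suc K
        ≡⟨ solve 6 (λ x q p r s b → x :+ q :* p :+ (r :+ s :* b) :* p := x :+ (r :+ q) :* p :+ s :* (b :* p)) refl
             (fromDigits (carrySave w) (suc K)) (w K / B) (B ^ suc K) (w (suc K) % B) (w (suc K) / B) B ⟩
      fromDigits (carrySave w) (suc (suc K)) + w (suc K) / B * B ^ suc (suc K) ∎
      where
      open ≡-Reasoning
      open +-*-Solver

    -- The first alternative accounts for the quotient that `carrySave` drops at the top.
    Overflow : (ℕ → ℕ) → ℕ → Set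
    Overflow w K = 1 ≤ w K / B ⊎ Carry (carrySave w) (suc K)

    module _ (w : ℕ → ℕ) (u≤ : ∀ b → 2 + carrySave w b ≤ 2 * B) where

      overflow⁺ : ∀ K → B ^ suc K ≤ fromDigits w (suc K) → Overflow w K
      overflow⁺ K h with w K / B in eq
      ... | suc q = inj₁ (s≤s z≤n)
      ... | zero  = inj₂ (overflow⇒Carry (carrySave w) u≤ (suc K) (≤-trans h (≤-reflexive
                      (trans (fromDigits-carrySave w K) (trans (cong (λ q → fromDigits (carrySave w) (suc K) + q * B ^ suc K) eq) (+-identityʳ _))))))

      overflow⁻ : ∀ K → Overflow w K → B ^ suc K ≤ fromDigits w (suc K)
      overflow⁻ K (inj₁ 1≤q) = ≤-trans (≤-trans (≤-trans (≤-reflexive (sym (*-identityˡ _))) (*-monoˡ-≤ (B ^ suc K) 1≤q)) (m≤n+m _ _))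
                                (≤-reflexive (sym (fromDigits-carrySave w K)))
      overflow⁻ K (inj₂ c)   = ≤-trans (≤-trans (Carry⇒overflow (carrySave w) u≤ (suc K) c) (m≤m+n _ _))
                                (≤-reflexive (sym (fromDigits-carrySave w K)))

  ∑-bound : ∀ {k B} (f : Fin k → ℕ) → (∀ i → f i ≤ B) → ∑ f ≤ k * B
  ∑-bound {zero}  f h = z≤n
  ∑-bound {suc k} f h = +-mono-≤ (h zero) (∑-bound (f ∘ suc) (h ∘ suc))

  private variable
    n d F : ℕ

  decides-→ : ∀ {A : Set} {P : Vec Bool n → Set} → Dec A → Decides F (suc d) P → Decides F (suc d) (λ w → A → P w)
  decides-→ (yes a) D = decides-map (λ _ p _ → p) (λ _ f → f a) D
  decides-→ (no ¬a) D = decides-map {P = λ _ → 0 ≡ 0} (λ _ _ a → ⊥-elim (¬a a)) (λ _ _ → refl) (decides-const (yes refl))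

  -- The range of `c` is enumerated: this costs width but only constantly many levels. A value `x`
  -- is recognised as the largest threshold that `c` reaches.
  decides-bind : ∀ {c : Vec Bool n → ℕ} {W} {R : ℕ → Vec Bool n → Set} → 2 ≤ F → suc W ≤ F → (∀ w → c w ≤ W) →
                 (∀ t → t ≤ suc W → Decides F d (λ w → t ≤ c w)) → (∀ x → Decides F (2 + d) (R x)) →
                 Decides F (4 + d) (λ w → R (c w) w)
  decides-bind {n} {F} {d} {c} {W} {R} 2≤F W<F c≤W D E =
    decides-map to from (decides-∃ {P = λ x w → (toℕ x ≤ c w × ¬ (suc (toℕ x) ≤ c w)) × R (toℕ x) w} W<F
      (λ x → decides-× 2≤F (decides-× 2≤F (decides-deepen (D (toℕ x) (<⇒≤ (toℕ<n x))))
                                           (decides-¬ (≤-trans (n≤1+n 1) 2≤F) (D (suc (toℕ x)) (toℕ<n x))))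
                           (E (toℕ x))))
    where
    to : ∀ w → (∃[ x ] (toℕ {suc W} x ≤ c w × ¬ (suc (toℕ x) ≤ c w)) × R (toℕ x) w) → R (c w) w
    to w (x , (x≤ , x≥) , r) = subst (λ x → R x w) (≤-antisym x≤ (s≤s⁻¹ (≰⇒> x≥))) r
    from : ∀ w → R (c w) w → ∃[ x ] (toℕ {suc W} x ≤ c w × ¬ (suc (toℕ x) ≤ c w)) × R (toℕ x) w
    from w r = x , (≤-reflexive eq , <⇒≱ (s≤s (≤-reflexive (sym eq)))) , subst (λ x → R x w) (sym eq) r
      where
      x  = fromℕ< (s≤s (c≤W w))
      eq = toℕ-fromℕ< (s≤s (c≤W w))

  module _ {B : ℕ} .{{_ : NonZero B}} where

    open Radix B

    -- The complement B ^ suc K ∸ T is added as one more summand, which turns the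
    -- comparison with T into a test for overflow.
    decides-≤-iteratedSum : ∀ {k} (V : Fin k → Vec Bool n → ℕ) K T → T ≤ B ^ suc K → 2 + k ≤ B →
      3 + 4 * (suc k * B) ≤ F → suc K ≤ F → (∀ i w → V i w < B ^ suc K) →
      (∀ i b (j : Fin B) → Decides F (suc d) (λ w → toℕ j < digit (V i w) b)) →
      Decides F (12 + d) (λ w → T ≤ ∑ (λ i → V i w))
    -- The complement of T = 0 would be `B ^ suc K` itself, which needs one digit too many.
    decides-≤-iteratedSum V K zero _ _ _ _ _ _ =
      decides-map {P = λ _ → 0 ≡ 0} (λ _ _ → z≤n) (λ _ _ → refl) (decides-const (yes refl))
    decides-≤-iteratedSum {n} {F} {d} {k} V K T@(suc T′) T≤ k<B F≥ K<F V< D =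
      decides-map (λ w → to w ∘ overflow⁻ (column w) (carrySave≤ w) K) (λ w → overflow⁺ (column w) (carrySave≤ w) K ∘ from w) decides-Overflow
      where
      W = suc k * B
      C = B ^ suc K ∸ T

      summand : Fin (suc k) → Vec Bool n → ℕ
      summand zero    w = C
      summand (suc i) w = V i w

      column : Vec Bool n → ℕ → ℕ
      column w b = ∑ (λ i → digit (summand i w) b)

      W<F : suc W ≤ F
      W<F = ≤-trans (s≤s (≤-trans (m≤n*m W 4) (m≤n+m (4 * W) 2))) F≥

      2≤F : 2 ≤ F
      2≤F = ≤-trans (s≤s (s≤s z≤n)) F≥

      C< : C < B ^ suc K
      C< = ≤-trans (≤-reflexive (sym (+-∸-assoc 1 T≤))) (m∸n≤m (B ^ suc K) T′)

      summand< : ∀ i w → summand i w < B ^ suc K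
      summand< zero    w = C<
      summand< (suc i) w = V< i w

      column≤ : ∀ w b → column w b ≤ W
      column≤ w b = ∑-bound _ (λ i → <⇒≤ (digit< (summand i w) b))

      -- A column of k + 1 digits has quotient at most k + 1, so an entry is at most (B - 1) + (k +
      -- 1). The condition 2 + k ≤ B brings this down to 2B - 2.
      carrySave≤ : ∀ w b → 2 + carrySave (column w) b ≤ 2 * B
      carrySave≤ w b = ≤-trans (≤-trans (s≤s (helper b)) (≤-reflexive (sym (+-suc B (suc k)))))
        (≤-trans (+-monoʳ-≤ B k<B) (≤-reflexive (cong (B +_) (sym (+-identityʳ B)))))
        where
        helper : ∀ b → suc (carrySave (column w) b) ≤ B + suc k
        helper zero    = ≤-trans (m%n<n (column w 0) B) (m≤m+n B (suc k))
        helper (suc b) = +-mono-≤ (m%n<n (column w (suc b)) B)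
          (≤-trans (/-monoˡ-≤ B (column≤ w b)) (≤-reflexive (m*n/n≡m (suc k) B)))

      decides-summand : ∀ i b (j : Fin B) → Decides F (suc d) (λ w → toℕ j < digit (summand i w) b)
      decides-summand zero    b j = decides-const (toℕ j <? digit C b)
      decides-summand (suc i) b j = D i b j

      decides-column : ∀ b t → t ≤ suc W → Decides F (2 + d) (λ w → t ≤ column w b)
      decides-column b t t≤ = decides-≤∑ (λ i w → digit (summand i w) b) B t
        -- The padded majority gate has fan-in (W + 1) + 2t + W, which is 4W + 3 for the largest
        -- threshold t = W + 1.
        (≤-trans (s≤s (+-monoʳ-≤ W (+-monoˡ-≤ W (*-monoʳ-≤ 2 t≤))))
          (≤-trans (≤-reflexive (solve 1 (λ w → con 1 :+ (w :+ (con 2 :* (con 1 :+ w) :+ w)) := con 3 :+ con 4 :* w) refl W)) F≥))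
        (≤-trans (s≤s (s≤s (≤-trans (m≤n*m W 4) (n≤1+n _)))) F≥)
        (λ i w → <⇒≤ (digit< (summand i w) b))
        (λ i j → decides-summand i b j)
        where open +-*-Solver

      decides-carrySave : ∀ s b → Decides F (8 + d) (λ w → s ≤ carrySave (column w) b)
      decides-carrySave s zero = decides-bind {c = λ w → column w 0} {R = λ x _ → s ≤ x % B} 2≤F W<F (λ w → column≤ w 0)
        (λ t t≤ → decides-+ 2 (decides-column 0 t t≤)) (λ x → decides-const (s ≤? x % B))
      decides-carrySave s (suc b) = decides-bind {c = λ w → column w (suc b)} {R = λ x w → s ≤ x % B + column w b / B}
        2≤F W<F (λ w → column≤ w (suc b)) (λ t t≤ → decides-+ 2 (decides-column (suc b) t t≤))
        (λ x → decides-bind {c = λ w → column w b} {R = λ y _ → s ≤ x % B + y / B} 2≤F W<F (λ w → column≤ w b)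
          (decides-column b) (λ y → decides-const (s ≤? x % B + y / B)))

      CarryFrom : Fin (suc K) → Vec Bool n → Set
      CarryFrom j w = B ≤ carrySave (column w) (toℕ j)
                    × (∀ (i : Fin (suc K)) → toℕ j < toℕ i → B ≤ suc (carrySave (column w) (toℕ i)))

      decides-Carry : Decides F (11 + d) (λ w → Carry (carrySave (column w)) (suc K))
      decides-Carry = decides-map to′ from′ (decides-∃ {P = CarryFrom} K<F
        (λ j → decides-× 2≤F (decides-deepen (decides-carrySave B (toℕ j)))
          (decides-∀ K<F (λ i → decides-→ (toℕ j <? toℕ i) (decides-map (λ _ → m∸n≤o⇒m≤n+o′) (λ _ → m≤n+o⇒m∸n≤o′) (decides-carrySave (B ∸ 1) (toℕ i)))))))
        where
        m∸n≤o⇒m≤n+o′ : ∀ {x} → B ∸ 1 ≤ x → B ≤ suc x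
        m∸n≤o⇒m≤n+o′ h = ≤-trans (m≤n+m∸n B 1) (s≤s h)
        m≤n+o⇒m∸n≤o′ : ∀ {x} → B ≤ suc x → B ∸ 1 ≤ x
        m≤n+o⇒m∸n≤o′ h = ∸-monoˡ-≤ 1 h
        to′ : ∀ w → ∃[ j ] CarryFrom j w → Carry (carrySave (column w)) (suc K)
        to′ w (j , B≤ , propagates) = toℕ j , toℕ<n j , B≤ , λ i j<i i≤K →
          subst (λ i → B ≤ suc (carrySave (column w) i)) (toℕ-fromℕ< i≤K) (propagates (fromℕ< i≤K) (subst (toℕ j <_) (sym (toℕ-fromℕ< i≤K)) j<i))
        from′ : ∀ w → Carry (carrySave (column w)) (suc K) → ∃[ j ] CarryFrom j w
        from′ w (j , j≤K , B≤ , propagates) = fromℕ< j≤K , subst (λ j → B ≤ carrySave (column w) j) (sym (toℕ-fromℕ< j≤K)) B≤ ,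
          λ i j<i → propagates (toℕ i) (subst (_< toℕ i) (toℕ-fromℕ< j≤K) j<i) (toℕ<n i)

      decides-Overflow : Decides F (12 + d) (λ w → Overflow (column w) K)
      decides-Overflow = decides-⊎ 2≤F
        (decides-+ 5 (decides-bind {c = λ w → column w K} {R = λ x _ → 1 ≤ x / B} 2≤F W<F (λ w → column≤ w K)
          (decides-column K) (λ x → decides-const (1 ≤? x / B))))
        decides-Carry

      column-sum : ∀ w → fromDigits (column w) (suc K) ≡ C + ∑ (λ i → V i w)
      column-sum w = trans (fromDigits-∑ (λ i → digit (summand i w)) (suc K))
        (∑-cong (λ i → fromDigits-digit (suc K) (summand i w) (summand< i w)))

      to : ∀ w → B ^ suc K ≤ fromDigits (column w) (suc K) → T ≤ ∑ (λ i → V i w)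
      to w h = +-cancelˡ-≤ C T _ (≤-trans (≤-reflexive (m∸n+n≡m T≤)) (≤-trans h (≤-reflexive (column-sum w))))

      from : ∀ w → T ≤ ∑ (λ i → V i w) → B ^ suc K ≤ fromDigits (column w) (suc K)
      from w h = ≤-trans (≤-reflexive (sym (m∸n+n≡m T≤))) (≤-trans (+-monoʳ-≤ C h) (≤-reflexive (sym (column-sum w))))

-- Floats as integers, and rounding and exponential as functions of values

module FloatValues where

  open import Algebra.Bundles using (AbelianGroup)
  import Algebra.Properties.Group as GroupProperties
  open import Data.Fin.Base as Fin using (Fin; zero; suc; toℕ; fromℕ<; combine; remQuot)
  open import Data.Fin.Properties using (toℕ-fromℕ<; remQuot-combine)
  open import Data.Integer.Base as ℤ using (ℤ; +_; -[1+_])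
  import Data.Integer.Properties as ℤ
  open import Data.Nat.Base
  open import Data.Nat.Properties
  open import Data.Rational.Base as ℚ using (ℚ; 0ℚ; 1ℚ)
  import Data.Rational.Properties as ℚ
  import Data.Rational.Solver as ℚ
  import Data.Rational.Unnormalised.Base as ℚᵘ
  import Data.Rational.Unnormalised.Properties as ℚᵘ
  open import Data.Integer.Solver using (module +-*-Solver)
  open import Relation.Binary.Definitions using (tri<; tri≈; tri>)
  open import Relation.Nullary using (¬_; Dec; yes; no)
  open import Relation.Nullary.Decidable using (_×-dec_; _⊎-dec_; recompute)
  open Formulas using (∑; ∑-cong)

  module ℤGroup = GroupProperties (AbelianGroup.group ℤ.+-0-abelianGroup)
  module ℚGroup = GroupProperties ℚ.+-0-group

  fromℤ : ℤ → ℚ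
  fromℤ i = i ℚ./ 1

  fromℕ′ : ℕ → ℚ
  fromℕ′ n = fromℤ (+ n)

  toℚᵘ-/ : ∀ i d → ℚ.toℚᵘ (i ℚ./ suc d) ℚᵘ.≃ ℚᵘ.mkℚᵘ i d
  toℚᵘ-/ i d = ℚ.toℚᵘ-fromℚᵘ (ℚᵘ.mkℚᵘ i d)

  fromℤ-+ : ∀ i j → fromℤ (i ℤ.+ j) ≡ fromℤ i ℚ.+ fromℤ j
  fromℤ-+ i j = ℚ.toℚᵘ-injective (ℚᵘ.≃-trans (toℚᵘ-/ (i ℤ.+ j) 0) (ℚᵘ.≃-sym (ℚᵘ.≃-trans (ℚ.toℚᵘ-homo-+ (fromℤ i) (fromℤ j))
    (ℚᵘ.≃-trans (ℚᵘ.+-cong (toℚᵘ-/ i 0) (toℚᵘ-/ j 0)) (ℚᵘ.*≡* (solve 2 (λ i j → (i :* con (+ 1) :+ j :* con (+ 1)) :* con (+ 1) := (i :+ j) :* con (+ 1)) refl i j))))))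
    where open +-*-Solver

  fromℤ-mono-≤ : ∀ {i j} → i ℤ.≤ j → fromℤ i ℚ.≤ fromℤ j
  fromℤ-mono-≤ {i} {j} i≤j = ℚ.toℚᵘ-cancel-≤ (ℚᵘ.≤-respˡ-≃ (ℚᵘ.≃-sym (toℚᵘ-/ i 0)) (ℚᵘ.≤-respʳ-≃ (ℚᵘ.≃-sym (toℚᵘ-/ j 0))
    (ℚᵘ.*≤* (ℤ.*-monoʳ-≤-nonNeg (+ 1) i≤j))))

  fromℤ-injective : ∀ {i j} → fromℤ i ≡ fromℤ j → i ≡ j
  fromℤ-injective {i} {j} eq with ℚᵘ.*≡* h ← ℚᵘ.≃-trans (ℚᵘ.≃-sym (toℚᵘ-/ i 0)) (ℚᵘ.≃-trans (ℚᵘ.≃-reflexive (cong ℚ.toℚᵘ eq)) (toℚᵘ-/ j 0))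
    = ℤ.*-cancelʳ-≡ i j (+ 1) h

  fromℤ-*-/ : ∀ i m d → (i ℚ./ suc d) ℚ.* fromℕ′ (suc d * m) ≡ fromℤ (i ℤ.* + m)
  fromℤ-*-/ i m d = ℚ.toℚᵘ-injective (ℚᵘ.≃-trans (ℚ.toℚᵘ-homo-* (i ℚ./ suc d) (fromℕ′ (suc d * m)))
    (ℚᵘ.≃-trans (ℚᵘ.*-cong (toℚᵘ-/ i d) (toℚᵘ-/ (+ (suc d * m)) 0)) (ℚᵘ.≃-trans (ℚᵘ.*≡* eq) (ℚᵘ.≃-sym (toℚᵘ-/ (i ℤ.* + m) 0)))))
    where
    open +-*-Solver
    eq : i ℤ.* + (suc d * m) ℤ.* + 1 ≡ i ℤ.* + m ℤ.* (+ suc (d * 1))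
    eq = trans (cong (λ x → i ℤ.* x ℤ.* + 1) (ℤ.pos-* (suc d) m))
      (trans (solve 3 (λ i d m → i :* (d :* m) :* con (+ 1) := i :* m :* d) refl i (+ suc d) (+ m))
        (cong (λ x → i ℤ.* + m ℤ.* + suc x) (sym (*-identityʳ d))))

  /-*-fromℕ : ∀ i n m .{{_ : NonZero n}} → (i ℚ./ n) ℚ.* fromℕ′ (n * m) ≡ fromℤ (i ℤ.* + m)
  /-*-fromℕ i (suc d) m = fromℤ-*-/ i m d

  ℚ<⇒≱ : ∀ {p q} → p ℚ.< q → ¬ (q ℚ.≤ p)
  ℚ<⇒≱ p<q q≤p = ℚ.<-irrefl refl (ℚ.<-≤-trans p<q q≤p)

  -- Two inequalities are interchangeable when their sides differ by the same amount.
  ≤-shift : ∀ {p q r s} → s ℚ.- r ≡ q ℚ.- p → p ℚ.≤ q → r ℚ.≤ s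
  ≤-shift {p} {q} {r} {s} eq p≤q = subst₂ ℚ._≤_ lhs rhs (ℚ.+-monoˡ-≤ (r ℚ.- p) p≤q)
    where
    open ℚ.+-*-Solver using (solve; _:+_; _:*_; _:-_; :-_; _:=_)
    lhs : p ℚ.+ (r ℚ.- p) ≡ r
    lhs = solve 2 (λ p r → p :+ (r :- p) := r) refl p r
    rhs : q ℚ.+ (r ℚ.- p) ≡ s
    rhs = trans (solve 3 (λ p q r → q :+ (r :- p) := (q :- p) :+ r) refl p q r)
      (trans (cong (ℚ._+ r) (sym eq)) (solve 2 (λ r s → (s :- r) :+ r := s) refl r s))

  p≤∣p∣ : ∀ p → p ℚ.≤ ℚ.∣ p ∣
  p≤∣p∣ p with ℚ.≤-total 0ℚ p
  ... | inj₁ 0≤p = ℚ.≤-reflexive (sym (ℚ.0≤p⇒∣p∣≡p 0≤p))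
  ... | inj₂ p≤0 = ℚ.≤-trans p≤0 (ℚ.0≤∣p∣ p)

  ∣p-q∣≡∣q-p∣ : ∀ p q → ℚ.∣ p ℚ.- q ∣ ≡ ℚ.∣ q ℚ.- p ∣
  ∣p-q∣≡∣q-p∣ p q = trans (sym (ℚ.∣-p∣≡∣p∣ (p ℚ.- q))) (cong ℚ.∣_∣ (solve 2 (λ p q → :- (p :- q) := q :- p) refl p q))
    where open ℚ.+-*-Solver using (solve; _:+_; _:*_; _:-_; :-_; _:=_)

  closer-to-larger : ∀ {a b} x → a ℚ.< b → ℚ.∣ x ℚ.- b ∣ ℚ.≤ ℚ.∣ x ℚ.- a ∣ → a ℚ.+ b ℚ.≤ x ℚ.+ x
  closer-to-larger {a} {b} x a<b h with ℚ.∣p∣≡p∨∣p∣≡-p (x ℚ.- a)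
  ... | inj₁ eq = ≤-shift (solve 3 (λ a b x → (x :+ x) :- (a :+ b) := (x :- a) :- (b :- x)) refl a b x)
                    (ℚ.≤-trans (ℚ.≤-trans (p≤∣p∣ (b ℚ.- x)) (ℚ.≤-reflexive (∣p-q∣≡∣q-p∣ b x))) (ℚ.≤-trans h (ℚ.≤-reflexive eq)))
    where open ℚ.+-*-Solver using (solve; _:+_; _:*_; _:-_; :-_; _:=_)
  ... | inj₂ eq = ⊥-elim (ℚ<⇒≱ a<b (≤-shift (solve 3 (λ a b x → a :- b := (:- (x :- a)) :- (b :- x)) refl a b x)
                    (ℚ.≤-trans (ℚ.≤-trans (p≤∣p∣ (b ℚ.- x)) (ℚ.≤-reflexive (∣p-q∣≡∣q-p∣ b x))) (ℚ.≤-trans h (ℚ.≤-reflexive eq)))))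
    where open ℚ.+-*-Solver using (solve; _:+_; _:*_; _:-_; :-_; _:=_)

  closer-to-smaller : ∀ {a b} y → a ℚ.< b → ℚ.∣ y ℚ.- a ∣ ℚ.≤ ℚ.∣ y ℚ.- b ∣ → y ℚ.+ y ℚ.≤ a ℚ.+ b
  closer-to-smaller {a} {b} y a<b h with ℚ.∣p∣≡p∨∣p∣≡-p (y ℚ.- b)
  ... | inj₂ eq = ≤-shift (solve 3 (λ a b y → (a :+ b) :- (y :+ y) := (:- (y :- b)) :- (y :- a)) refl a b y)
                    (ℚ.≤-trans (p≤∣p∣ (y ℚ.- a)) (ℚ.≤-trans h (ℚ.≤-reflexive eq)))
    where open ℚ.+-*-Solver using (solve; _:+_; _:*_; _:-_; :-_; _:=_)
  ... | inj₁ eq = ⊥-elim (ℚ<⇒≱ a<b (≤-shift (solve 3 (λ a b y → a :- b := (y :- b) :- (y :- a)) refl a b y)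
                    (ℚ.≤-trans (p≤∣p∣ (y ℚ.- a)) (ℚ.≤-trans h (ℚ.≤-reflexive eq)))))
    where open ℚ.+-*-Solver using (solve; _:+_; _:*_; _:-_; :-_; _:=_)

  module _ {p : ℕ} (𝔸 : FloatArithmetic p) where

    open FloatArithmetic 𝔸

    -- If the rounded values were in reverse order, nearness would put `y` at or below their
    -- midpoint and `x` at or above it, so that x = y. But `round` is a function of the rational,
    -- whence no rule for ties can break monotonicity.
    round-mono-≤ : ∀ {x y} → x ℚ.≤ y → ⟦ round x ⟧ ℚ.≤ ⟦ round y ⟧
    round-mono-≤ {x} {y} x≤y with ⟦ round x ⟧ ℚ.≤? ⟦ round y ⟧
    ... | yes h = h
    ... | no  h = ℚ.≤-reflexive (cong (λ z → ⟦ round z ⟧) (ℚ.≤-antisym x≤y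
      (ℚ.≮⇒≥ λ x<y → ℚ<⇒≱ (ℚ.+-mono-< x<y x<y)
        (ℚ.≤-trans (closer-to-smaller y ry<rx (round-nearest y (round x))) (closer-to-larger x ry<rx (round-nearest x (round y)))))))
      where
      ry<rx = ℚ.≰⇒> h

    round-exact : ∀ (r : Float p) {x} → x ≡ ⟦ r ⟧ → ⟦ round x ⟧ ≡ x
    round-exact r {x} x≡r = sym (ℚGroup.x∙y⁻¹≈ε⇒x≈y x _ (ℚ.∣p∣≡0⇒p≡0 _ (ℚ.≤-antisym
      (ℚ.≤-trans (round-nearest x r) (ℚ.≤-reflexive (trans (cong (λ y → ℚ.∣ y ℚ.- ⟦ r ⟧ ∣) x≡r) (cong ℚ.∣_∣ (ℚ.+-inverseʳ ⟦ r ⟧)))))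
      (ℚ.0≤∣p∣ _))))

  -- Compared with the candidate `c` itself, a tolerance strictly below the distance of `r` from `c`
  -- would bound this very distance.
  nearest-eventually-constant : ∀ {p} {a : ℕ → ℚ} {r : Float p} → NearestToLimit a r →
    ∀ N c (r′ : Float p) → ⟦ r′ ⟧ ≡ c → (∀ k → N ≤ k → a k ≡ c) → ⟦ r ⟧ ≡ c
  nearest-eventually-constant {a = a} {r} near N c r′ r′≡c a≡c with 0ℚ ℚ.<? ℚ.∣ c ℚ.- ⟦ r ⟧ ∣
  ... | no  h = sym (ℚGroup.x∙y⁻¹≈ε⇒x≈y c ⟦ r ⟧ (ℚ.∣p∣≡0⇒p≡0 _ (ℚ.≤-antisym (ℚ.≮⇒≥ h) (ℚ.0≤∣p∣ _))))
  ... | yes h with δ , 0<δ , δ< ← ℚ.<-dense h with K , close ← near r′ δ 0<δ =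
    ⊥-elim (ℚ<⇒≱ δ< (begin
      ℚ.∣ c ℚ.- ⟦ r ⟧ ∣        ≡⟨ cong (λ x → ℚ.∣ x ℚ.- ⟦ r ⟧ ∣) (sym (a≡c (K ⊔ N) (m≤n⊔m K N))) ⟩
      ℚ.∣ a (K ⊔ N) ℚ.- ⟦ r ⟧ ∣ ≤⟨ close (K ⊔ N) (m≤m⊔n K N) ⟩
      ℚ.∣ a (K ⊔ N) ℚ.- ⟦ r′ ⟧ ∣ ℚ.+ δ ≡⟨ cong₂ (λ x y → ℚ.∣ x ℚ.- y ∣ ℚ.+ δ) (a≡c (K ⊔ N) (m≤n⊔m K N)) r′≡c ⟩
      ℚ.∣ c ℚ.- c ∣ ℚ.+ δ       ≡⟨ cong (λ x → ℚ.∣ x ∣ ℚ.+ δ) (ℚ.+-inverseʳ c) ⟩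
      0ℚ ℚ.+ δ                 ≡⟨ ℚ.+-identityˡ δ ⟩
      δ                        ∎))
    where open ℚ.≤-Reasoning

  expPartialSum-zero : ∀ k → expPartialSum 0ℚ (suc k) ≡ 1ℚ
  expPartialSum-zero zero    = refl
  expPartialSum-zero (suc k) = cong₂ ℚ._+_ (expPartialSum-zero k)
    (trans (cong (ℚ._* (+ 1 ℚ./ suc k)) (ℚ.*-zeroʳ (expTerm 0ℚ k))) (ℚ.*-zeroˡ (+ 1 ℚ./ suc k)))

  n<2^n : ∀ n → n < 2 ^ n
  n<2^n zero    = s≤s z≤n
  n<2^n (suc n) = ≤-trans (s≤s (n<2^n n)) (+-mono-≤ (m^n>0 2 n) (m≤m+n (2 ^ n) 0))

  module FloatCode (p : ℕ) where

    E : ℕ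
    E = 2 ^ p

    SignificandRange : ℤ → Set
    SignificandRange s = s ≡ + 0 ⊎ (2 ^ (p ∸ 1) ≤ ℤ.∣ s ∣ × ℤ.∣ s ∣ < 2 ^ p)

    ExponentRange : ℤ → Set
    ExponentRange e = (ℤ.- (+ (2 ^ p)) ℤ.≤ e) × (e ℤ.< + (2 ^ p))

    significandRange? : ∀ s → Dec (SignificandRange s)
    significandRange? s = s ℤ.≟ + 0 ⊎-dec (2 ^ (p ∸ 1) ≤? ℤ.∣ s ∣ ×-dec ℤ.∣ s ∣ <? 2 ^ p)

    exponentRange? : ∀ e → Dec (ExponentRange e)
    exponentRange? e = ℤ.- (+ (2 ^ p)) ℤ.≤? e ×-dec e ℤ.<? + (2 ^ p)

    shift : ℤ → ℕ
    shift e = ℤ.∣ e ℤ.+ + E ∣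

    +-shift : ∀ {e} → ExponentRange e → + shift e ≡ e ℤ.+ + E
    +-shift {e} (-E≤e , _) = ℤ.0≤i⇒+∣i∣≡i (subst (ℤ._≤ e ℤ.+ + E) (ℤ.+-inverseˡ (+ E)) (ℤ.+-monoˡ-≤ (+ E) -E≤e))

    shift-injective : ∀ {e e′} → ExponentRange e → ExponentRange e′ → shift e ≡ shift e′ → e ≡ e′
    shift-injective {e} {e′} r r′ eq = ℤGroup.∙-cancelʳ (+ E) e e′ (trans (sym (+-shift r)) (trans (cong (λ n → + n) eq) (+-shift r′)))

    shift< : ∀ {e} → ExponentRange e → shift e < E + E
    shift< {e} r@(_ , e<E) = ℤ.drop‿+<+ (subst (ℤ._< + (E + E)) (sym (+-shift r)) (ℤ.+-monoˡ-< (+ E) e<E))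

    scaled : Float p → ℤ
    scaled a = Float.significand a ℤ.* + (2 ^ shift (Float.exponent a))

    exponentRange : ∀ (a : Float p) → ExponentRange (Float.exponent a)
    exponentRange (⟨ s , e ⟩ {_} {re}) = recompute (exponentRange? e) re

    significandRange : ∀ (a : Float p) → SignificandRange (Float.significand a)
    significandRange (⟨ s , e ⟩ {rs}) = recompute (significandRange? s) rs

    value-scaled : ∀ a → ⟦ a ⟧ ℚ.* fromℕ′ (2 ^ E) ≡ fromℤ (scaled a)
    value-scaled ⟨ s , + k ⟩ = begin
      fromℤ (s ℤ.* + (2 ^ k)) ℚ.* fromℕ′ (2 ^ E)
        ≡⟨ cong (λ x → fromℤ (s ℤ.* + (2 ^ k)) ℚ.* fromℕ′ x) (sym (*-identityˡ (2 ^ E))) ⟩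
      fromℤ (s ℤ.* + (2 ^ k)) ℚ.* fromℕ′ (1 * 2 ^ E)
        ≡⟨ /-*-fromℕ (s ℤ.* + (2 ^ k)) 1 (2 ^ E) ⟩
      fromℤ (s ℤ.* + (2 ^ k) ℤ.* + (2 ^ E))
        ≡⟨ cong fromℤ (trans (ℤ.*-assoc s (+ (2 ^ k)) (+ (2 ^ E))) (cong (s ℤ.*_) (trans (sym (ℤ.pos-* (2 ^ k) (2 ^ E))) (cong +_ (sym (^-distribˡ-+-* 2 k E)))))) ⟩
      fromℤ (s ℤ.* + (2 ^ (k + E))) ∎
      where open ≡-Reasoning
    value-scaled a@(⟨ s , -[1+ k ] ⟩) = begin
      (s ℚ./ (2 ^ suc k)) {{m^n≢0 2 (suc k)}} ℚ.* fromℕ′ (2 ^ E)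
        ≡⟨ cong (λ x → (s ℚ./ (2 ^ suc k)) {{m^n≢0 2 (suc k)}} ℚ.* fromℕ′ (2 ^ x)) (sym (m+[n∸m]≡n k<E)) ⟩
      (s ℚ./ (2 ^ suc k)) {{m^n≢0 2 (suc k)}} ℚ.* fromℕ′ (2 ^ (suc k + (E ∸ suc k)))
        ≡⟨ cong (λ x → (s ℚ./ (2 ^ suc k)) {{m^n≢0 2 (suc k)}} ℚ.* fromℕ′ x) (^-distribˡ-+-* 2 (suc k) (E ∸ suc k)) ⟩
      (s ℚ./ (2 ^ suc k)) {{m^n≢0 2 (suc k)}} ℚ.* fromℕ′ (2 ^ suc k * 2 ^ (E ∸ suc k))
        ≡⟨ /-*-fromℕ s (2 ^ suc k) (2 ^ (E ∸ suc k)) {{m^n≢0 2 (suc k)}} ⟩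
      fromℤ (s ℤ.* + (2 ^ (E ∸ suc k)))
        ≡⟨ cong (λ i → fromℤ (s ℤ.* + (2 ^ ℤ.∣ i ∣))) (sym (ℤ.⊖-≥ k<E)) ⟩
      fromℤ (scaled a) ∎
      where
      open ≡-Reasoning
      k<E : suc k ≤ E
      k<E = ℤ.drop‿+≤+ (ℤ.neg-cancel-≤ (proj₁ (exponentRange a)))

    bound : ℕ
    bound = 2 ^ (p + (E + E))

    ∣significand∣< : ∀ {s} → SignificandRange s → ℤ.∣ s ∣ < 2 ^ p
    ∣significand∣< (inj₁ refl)    = m^n>0 2 p
    ∣significand∣< (inj₂ (_ , h)) = h

    ∣scaled∣< : ∀ a → ℤ.∣ scaled a ∣ < bound
    ∣scaled∣< a = begin-strict
      ℤ.∣ scaled a ∣                                           ≡⟨ ℤ.abs-* (Float.significand a) _ ⟩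
      ℤ.∣ Float.significand a ∣ * 2 ^ shift (Float.exponent a) ≤⟨ *-monoʳ-≤ ℤ.∣ Float.significand a ∣ (^-monoʳ-≤ 2 (<⇒≤ (shift< (exponentRange a)))) ⟩
      ℤ.∣ Float.significand a ∣ * 2 ^ (E + E)                  <⟨ *-monoˡ-< (2 ^ (E + E)) {{m^n≢0 2 (E + E)}} (∣significand∣< (significandRange a)) ⟩
      2 ^ p * 2 ^ (E + E)                                     ≡⟨ sym (^-distribˡ-+-* 2 p (E + E)) ⟩
      bound                                                   ∎
      where open ≤-Reasoning

    -- The value in units of 2 ^ (- E), shifted to be nonnegative.
    code : Float p → ℕ
    code a = ℤ.∣ scaled a ℤ.+ + bound ∣

    +-code : ∀ a → + code a ≡ scaled a ℤ.+ + bound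
    +-code a = ℤ.0≤i⇒+∣i∣≡i (nonNeg (scaled a) (∣scaled∣< a))
      where
      nonNeg : ∀ i → ℤ.∣ i ∣ < bound → + 0 ℤ.≤ i ℤ.+ + bound
      nonNeg (+ n)    h = ℤ.+≤+ z≤n
      nonNeg -[1+ n ] h = ℤ.≤-trans (ℤ.+≤+ z≤n) (ℤ.≤-reflexive (sym (ℤ.⊖-≥ (<⇒≤ h))))

    code< : ∀ a → code a < 2 * bound
    code< a = ≤-<-trans (ℤ.∣i+j∣≤∣i∣+∣j∣ (scaled a) (+ bound)) (<-≤-trans (+-monoˡ-< bound (∣scaled∣< a)) (≤-reflexive (cong (λ x → bound + x) (sym (+-identityʳ bound)))))

    unit : ℚ
    unit = (+ 1 ℚ./ (2 ^ E)) {{m^n≢0 2 E}}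

    unit-inverse : unit ℚ.* fromℕ′ (2 ^ E) ≡ 1ℚ
    unit-inverse = trans (cong (λ x → unit ℚ.* fromℕ′ x) (sym (*-identityʳ (2 ^ E)))) (/-*-fromℕ (+ 1) (2 ^ E) 1 {{m^n≢0 2 E}})

    offset : ℚ
    offset = fromℕ′ bound ℚ.* unit

    value-scaled′ : ∀ a → ⟦ a ⟧ ≡ fromℤ (scaled a) ℚ.* unit
    value-scaled′ a = sym (begin
      fromℤ (scaled a) ℚ.* unit               ≡⟨ cong (ℚ._* unit) (sym (value-scaled a)) ⟩
      ⟦ a ⟧ ℚ.* fromℕ′ (2 ^ E) ℚ.* unit        ≡⟨ solve 3 (λ a n u → a :* n :* u := a :* (u :* n)) refl ⟦ a ⟧ (fromℕ′ (2 ^ E)) unit ⟩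
      ⟦ a ⟧ ℚ.* (unit ℚ.* fromℕ′ (2 ^ E))      ≡⟨ cong (⟦ a ⟧ ℚ.*_) unit-inverse ⟩
      ⟦ a ⟧ ℚ.* 1ℚ                            ≡⟨ ℚ.*-identityʳ ⟦ a ⟧ ⟩
      ⟦ a ⟧                                   ∎)
      where
      open ≡-Reasoning
      open ℚ.+-*-Solver using (solve; _:+_; _:*_; _:-_; :-_; _:=_)

    value-code : ∀ a → ⟦ a ⟧ ℚ.+ offset ≡ fromℕ′ (code a) ℚ.* unit
    value-code a = begin
      ⟦ a ⟧ ℚ.+ offset                                ≡⟨ cong (ℚ._+ offset) (value-scaled′ a) ⟩
      fromℤ (scaled a) ℚ.* unit ℚ.+ offset            ≡⟨ sym (ℚ.*-distribʳ-+ unit (fromℤ (scaled a)) (fromℕ′ bound)) ⟩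
      (fromℤ (scaled a) ℚ.+ fromℕ′ bound) ℚ.* unit    ≡⟨ cong (ℚ._* unit) (sym (trans (cong fromℤ (+-code a)) (fromℤ-+ (scaled a) (+ bound)))) ⟩
      fromℕ′ (code a) ℚ.* unit                        ∎
      where open ≡-Reasoning

    scaled-cong : ∀ a b → ⟦ a ⟧ ≡ ⟦ b ⟧ → scaled a ≡ scaled b
    scaled-cong a b eq = fromℤ-injective (trans (sym (value-scaled a)) (trans (cong (ℚ._* fromℕ′ (2 ^ E)) eq) (value-scaled b)))

    code-cong : ∀ a b → ⟦ a ⟧ ≡ ⟦ b ⟧ → code a ≡ code b
    code-cong a b eq = cong (λ i → ℤ.∣ i ℤ.+ + bound ∣) (scaled-cong a b eq)

    offsets : ℕ → ℚ
    offsets zero    = 0ℚ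
    offsets (suc k) = offset ℚ.+ offsets k

    -- This separates the exact sum into a sum of natural numbers, which formulas can compare with
    -- thresholds, and an increasing affine map that depends only on `k`.
    sum-code : ∀ {k} (as : Fin k → Float p) →
               Vector.foldr ℚ._+_ 0ℚ (λ i → ⟦ as i ⟧) ≡ fromℕ′ (∑ (λ i → code (as i))) ℚ.* unit ℚ.- offsets k
    sum-code {zero}  as = sym (trans (ℚ.+-identityʳ _) (ℚ.*-zeroˡ unit))
    sum-code {suc k} as = begin
      ⟦ as zero ⟧ ℚ.+ Vector.foldr ℚ._+_ 0ℚ (λ i → ⟦ as (suc i) ⟧)
        ≡⟨ cong (⟦ as zero ⟧ ℚ.+_) (sum-code (as ∘ suc)) ⟩
      ⟦ as zero ⟧ ℚ.+ (fromℕ′ N ℚ.* unit ℚ.- offsets k)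
        ≡⟨ solve 4 (λ a o s t → a :+ (s :- t) := (a :+ o) :+ s :- (o :+ t)) refl ⟦ as zero ⟧ offset (fromℕ′ N ℚ.* unit) (offsets k) ⟩
      (⟦ as zero ⟧ ℚ.+ offset) ℚ.+ fromℕ′ N ℚ.* unit ℚ.- offsets (suc k)
        ≡⟨ cong (λ x → x ℚ.+ fromℕ′ N ℚ.* unit ℚ.- offsets (suc k)) (value-code (as zero)) ⟩
      fromℕ′ (code (as zero)) ℚ.* unit ℚ.+ fromℕ′ N ℚ.* unit ℚ.- offsets (suc k)
        ≡⟨ cong (ℚ._- offsets (suc k)) (trans (sym (ℚ.*-distribʳ-+ unit (fromℕ′ (code (as zero))) (fromℕ′ N)))
             (cong (ℚ._* unit) (sym (fromℤ-+ (+ code (as zero)) (+ N))))) ⟩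
      fromℕ′ (code (as zero) + N) ℚ.* unit ℚ.- offsets (suc k) ∎
      where
      open ≡-Reasoning
      open ℚ.+-*-Solver using (solve; _:+_; _:*_; _:-_; :-_; _:=_)
      N = ∑ (λ i → code (as (suc i)))

    unit-nonNeg : ℚ.NonNegative unit
    unit-nonNeg = ℚ.normalize-nonNeg 1 (2 ^ E) {{m^n≢0 2 E}}

    sum-code-mono : ∀ k {M N} → M ≤ N → fromℕ′ M ℚ.* unit ℚ.- offsets k ℚ.≤ fromℕ′ N ℚ.* unit ℚ.- offsets k
    sum-code-mono k M≤N = ℚ.+-monoˡ-≤ (ℚ.- offsets k) (ℚ.*-monoʳ-≤-nonNeg unit {{unit-nonNeg}} (fromℤ-mono-≤ (ℤ.+≤+ M≤N)))

    float-≡ : ∀ (a b : Float p) → Float.significand a ≡ Float.significand b → Float.exponent a ≡ Float.exponent b → a ≡ b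
    float-≡ ⟨ _ , _ ⟩ ⟨ _ , _ ⟩ refl refl = refl

    -- An overcount by sign and magnitude of each component; `fromParts` sends the pairs outside the
    -- ranges to zero. Only surjectivity and a polynomial bound in 2 ^ p matter.
    #floats : ℕ
    #floats = (2 * 2 ^ p) * (2 * 2 ^ p)

    significandOf exponentOf : Fin 2 × Fin (2 ^ p) → ℤ
    significandOf (zero  , k) = + toℕ k
    significandOf (suc _ , k) = ℤ.- (+ toℕ k)
    exponentOf (zero  , k) = + toℕ k
    exponentOf (suc _ , k) = -[1+ toℕ k ]

    zeroFloat : Float p
    zeroFloat = ⟨ + 0 , + 0 ⟩ {inj₁ refl} {ℤ.neg-≤-pos , ℤ.+<+ (m^n>0 2 p)}

    fromParts : ℤ → ℤ → Float p
    fromParts s e with significandRange? s | exponentRange? e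
    ... | yes rs | yes re = ⟨ s , e ⟩ {rs} {re}
    ... | _      | _      = zeroFloat

    fromParts-complete : ∀ a → fromParts (Float.significand a) (Float.exponent a) ≡ a
    fromParts-complete a@(⟨ s , e ⟩) with significandRange? s | exponentRange? e
    ... | yes _ | yes _ = refl
    ... | yes _ | no ¬re = ⊥-elim (¬re (exponentRange a))
    ... | no ¬rs | _     = ⊥-elim (¬rs (significandRange a))

    float : Fin #floats → Float p
    float i with s , e ← remQuot {2 * 2 ^ p} (2 * 2 ^ p) i =
      fromParts (significandOf (remQuot {2} (2 ^ p) s)) (exponentOf (remQuot {2} (2 ^ p) e))

    significand-index : ∀ s → SignificandRange s → ∃[ i ] significandOf (remQuot {2} (2 ^ p) i) ≡ s
    significand-index (+ n)    r = let s< = ∣significand∣< r in combine {2} zero (fromℕ< s<) ,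
      trans (cong significandOf (remQuot-combine {2} zero (fromℕ< s<))) (cong +_ (toℕ-fromℕ< s<))
    significand-index -[1+ n ] r = let s< = ∣significand∣< r in combine {2} (suc zero) (fromℕ< s<) ,
      trans (cong significandOf (remQuot-combine {2} (suc zero) (fromℕ< s<))) (cong (λ n → ℤ.- (+ n)) (toℕ-fromℕ< s<))

    exponent-index : ∀ e → ExponentRange e → ∃[ i ] exponentOf (remQuot {2} (2 ^ p) i) ≡ e
    exponent-index (+ n) (_ , ℤ.+<+ n<) = combine {2} zero (fromℕ< n<) ,
      trans (cong exponentOf (remQuot-combine {2} zero (fromℕ< n<))) (cong +_ (toℕ-fromℕ< n<))
    exponent-index -[1+ n ] (≤e , _) = combine {2} (suc zero) (fromℕ< n<) ,
      trans (cong exponentOf (remQuot-combine {2} (suc zero) (fromℕ< n<))) (cong -[1+_] (toℕ-fromℕ< n<))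
      where
      n< : n < 2 ^ p
      n< = ℤ.drop‿+≤+ (ℤ.neg-cancel-≤ ≤e)

    float-surjective : ∀ a → ∃[ i ] float i ≡ a
    float-surjective a with i , eqᵢ ← significand-index _ (significandRange a) | j , eqⱼ ← exponent-index _ (exponentRange a) =
      combine i j , trans (cong (λ (i , j) → fromParts (significandOf (remQuot {2} (2 ^ p) i)) (exponentOf (remQuot {2} (2 ^ p) j))) (remQuot-combine i j))
        (trans (cong₂ fromParts eqᵢ eqⱼ) (fromParts-complete a))

  module _ {p : ℕ} where

    open FloatCode (suc p)

    oneFloat : Float (suc p)
    oneFloat = ⟨ + (2 ^ p) , ℤ.- (+ p) ⟩
      {inj₂ (≤-refl , m<m*n (2 ^ p) 2 {{m^n≢0 2 p}} (s≤s (s≤s z≤n)) ⟪ *-comm (2 ^ p) 2 ⟫)}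
      {ℤ.neg-mono-≤ (ℤ.+≤+ (≤-trans (n≤1+n p) (<⇒≤ (n<2^n (suc p))))) , ℤ.≤-<-trans ℤ.neg-≤-pos (ℤ.+<+ (m^n>0 2 (suc p)))}
      where
      infixl 5 _⟪_⟫
      _⟪_⟫ : ∀ {x y z} → x < y → y ≡ z → x < z
      h ⟪ refl ⟫ = h

    value-oneFloat : ⟦ oneFloat ⟧ ≡ 1ℚ
    value-oneFloat = begin
      ⟦ oneFloat ⟧                                      ≡⟨ value-scaled′ oneFloat ⟩
      fromℤ (scaled oneFloat) ℚ.* unit                  ≡⟨ cong (λ i → fromℤ i ℚ.* unit) scaled-one ⟩
      fromℕ′ (2 ^ E) ℚ.* unit                           ≡⟨ ℚ.*-comm (fromℕ′ (2 ^ E)) unit ⟩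
      unit ℚ.* fromℕ′ (2 ^ E)                           ≡⟨ unit-inverse ⟩
      1ℚ                                                ∎
      where
      open ≡-Reasoning
      p≤E : p ≤ E
      p≤E = ≤-trans (<⇒≤ (n<2^n p)) (m≤m+n (2 ^ p) _)
      shift-one : shift (ℤ.- (+ p)) ≡ E ∸ p
      shift-one = cong ℤ.∣_∣ (trans (ℤ.+-comm (ℤ.- (+ p)) (+ E)) (trans (ℤ.m-n≡m⊖n E p) (ℤ.⊖-≥ p≤E)))
      scaled-one : scaled oneFloat ≡ + (2 ^ E)
      scaled-one = trans (sym (ℤ.pos-* (2 ^ p) (2 ^ shift (ℤ.- (+ p))))) (cong +_ (trans (sym (^-distribˡ-+-* 2 p _))
        (cong (2 ^_) (trans (cong (λ x → p + x) shift-one) (m+[n∸m]≡n p≤E)))))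

    exp-zero : (𝔸 : FloatArithmetic (suc p)) → ∀ x → ⟦ x ⟧ ≡ 0ℚ → ⟦ FloatArithmetic.exp 𝔸 x ⟧ ≡ 1ℚ
    exp-zero 𝔸 x x≡0 = nearest-eventually-constant {a = expPartialSum ⟦ x ⟧} {FloatArithmetic.exp 𝔸 x} (FloatArithmetic.exp-nearest 𝔸 x) 1 1ℚ oneFloat value-oneFloat
      λ { (suc k) _ → trans (cong (λ q → expPartialSum q (suc k)) x≡0) (expPartialSum-zero k) }

    value-zero : ∀ a → Float.significand a ≡ + 0 → ⟦ a ⟧ ≡ 0ℚ
    value-zero a s≡0 = trans (value-scaled′ a) (trans (cong (λ s → fromℤ (s ℤ.* + (2 ^ shift (Float.exponent a))) ℚ.* unit) s≡0) (ℚ.*-zeroˡ unit))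

    -- Every significand is below 2 * 2 ^ p in magnitude and a normalised one is at least 2 ^ p, so
    -- a single extra unit in the exponent already makes the magnitude strictly larger.
    exponents-≮ : ∀ a b → scaled a ≡ scaled b → 2 ^ p ≤ ℤ.∣ Float.significand b ∣ → ¬ (shift (Float.exponent a) < shift (Float.exponent b))
    exponents-≮ a b eq normalised h = <⇒≢ (begin-strict
      ℤ.∣ scaled a ∣                                            ≡⟨ ℤ.abs-* (Float.significand a) _ ⟩
      ℤ.∣ Float.significand a ∣ * 2 ^ shift (Float.exponent a)  <⟨ *-monoˡ-< _ {{m^n≢0 2 (shift (Float.exponent a))}} (∣significand∣< (significandRange a)) ⟩
      2 * 2 ^ p * 2 ^ shift (Float.exponent a)                  ≡⟨ trans (cong (_* 2 ^ shift (Float.exponent a)) (*-comm 2 (2 ^ p))) (*-assoc (2 ^ p) 2 _) ⟩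
      2 ^ p * 2 ^ suc (shift (Float.exponent a))                ≤⟨ *-mono-≤ normalised (^-monoʳ-≤ 2 h) ⟩
      ℤ.∣ Float.significand b ∣ * 2 ^ shift (Float.exponent b)  ≡⟨ sym (ℤ.abs-* (Float.significand b) _) ⟩
      ℤ.∣ scaled b ∣                                            ∎) (cong ℤ.∣_∣ eq)
      where open ≤-Reasoning

    float-injective : ∀ a b → ⟦ a ⟧ ≡ ⟦ b ⟧ → 2 ^ p ≤ ℤ.∣ Float.significand a ∣ → 2 ^ p ≤ ℤ.∣ Float.significand b ∣ → a ≡ b
    float-injective a b eq na nb with <-cmp (shift (Float.exponent a)) (shift (Float.exponent b))
    ... | tri< h _ _ = ⊥-elim (exponents-≮ a b (scaled-cong a b eq) nb h)
    ... | tri> _ _ h = ⊥-elim (exponents-≮ b a (sym (scaled-cong a b eq)) na h)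
    ... | tri≈ _ h _ = float-≡ a b
      (ℤ.*-cancelʳ-≡ _ _ (+ (2 ^ shift (Float.exponent a))) {{m^n≢0 2 (shift (Float.exponent a))}}
        (trans (scaled-cong a b eq) (cong (λ k → Float.significand b ℤ.* + (2 ^ k)) (sym h))))
      (shift-injective (exponentRange a) (exponentRange b) h)

    value≢0 : ∀ a → 2 ^ p ≤ ℤ.∣ Float.significand a ∣ → ⟦ a ⟧ ≢ 0ℚ
    value≢0 a normalised a≡0 = contradiction (ℤ.i*j≡0⇒i≡0∨j≡0 (Float.significand a) (trans (scaled-cong a zeroFloat a≡0) (ℤ.*-zeroˡ (+ (2 ^ shift (+ 0))))))
      where
      contradiction : Float.significand a ≡ + 0 ⊎ + (2 ^ shift (Float.exponent a)) ≡ + 0 → ⊥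
      contradiction (inj₁ eq) = <⇒≢ (≤-trans (m^n>0 2 p) normalised) (sym (cong ℤ.∣_∣ eq))
      contradiction (inj₂ eq) = <⇒≢ (m^n>0 2 (shift (Float.exponent a))) (sym (ℤ.+-injective eq))

  -- Truncated subtraction makes the range of nonzero significands 1 ≤ |s| < 1, which is empty.
  value-precision-zero : (a : Float 0) → ⟦ a ⟧ ≡ 0ℚ
  value-precision-zero a with FloatCode.significandRange 0 a
  ... | inj₁ s≡0       = trans (value-scaled′ a) (trans (cong (λ s → fromℤ (s ℤ.* + (2 ^ shift (Float.exponent a))) ℚ.* unit) s≡0) (ℚ.*-zeroˡ unit))
    where open FloatCode 0
  ... | inj₂ (1≤s , s<1) = ⊥-elim (<⇒≱ s<1 1≤s)

  -- `exp` acts on representations, of which a nonzero value has just one. Zero has several, but its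
  -- exponential 1 is representable at positive precision, so that correct rounding returns the
  -- value 1 for all of them.
  exp-cong : ∀ {p} (𝔸 : FloatArithmetic p) x y → ⟦ x ⟧ ≡ ⟦ y ⟧ → ⟦ FloatArithmetic.exp 𝔸 x ⟧ ≡ ⟦ FloatArithmetic.exp 𝔸 y ⟧
  exp-cong {zero}  𝔸 x y eq = trans (value-precision-zero (FloatArithmetic.exp 𝔸 x)) (sym (value-precision-zero (FloatArithmetic.exp 𝔸 y)))
  exp-cong {suc p} 𝔸 x y eq with FloatCode.significandRange (suc p) x | FloatCode.significandRange (suc p) y
  ... | inj₁ x≡0      | _             = trans (exp-zero 𝔸 x (value-zero x x≡0)) (sym (exp-zero 𝔸 y (trans (sym eq) (value-zero x x≡0))))
  ... | inj₂ (nx , _) | inj₁ y≡0      = ⊥-elim (value≢0 x nx (trans eq (value-zero y y≡0)))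
  ... | inj₂ (nx , _) | inj₂ (ny , _) = cong (λ z → ⟦ FloatArithmetic.exp 𝔸 z ⟧) (float-injective x y eq nx ny)

-- Constant-depth simulation of the model

module Simulation where

  open import Data.Bool.Base using (Bool)
  open import Data.Fin.Base as Fin using (Fin; zero; suc; toℕ; fromℕ)
  open import Data.List.Base as List using (List; []; _∷_)
  import Data.Fin.Properties as Fin
  import Data.List.Properties as List
  import Data.List.Extrema.Core as Extrema
  import Algebra.Construct.NaturalChoice.Max as MaxOperator
  open import Relation.Binary.Bundles using (DecTotalOrder)
  open import Data.Nat.Base
  open import Data.Nat.Properties
  open import Data.Rational.Base as ℚ using (ℚ; 0ℚ)
  import Data.Rational.Properties as ℚ
  open import Relation.Nullary using (Dec; yes; no)
  open Formulas
  open IteratedSums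
  open FloatValues

  -- An upward closed property is a threshold; `T = U` serves a property that fails everywhere below
  -- `U`.
  least : {Q : ℕ → Set} → (∀ N → Dec (Q N)) → (∀ {M N} → M ≤ N → Q M → Q N) → ∀ U →
          ∃[ T ] T ≤ U × (∀ N → N < U → Q N → T ≤ N) × (∀ N → N < U → T ≤ N → Q N)
  least Q? mono zero = 0 , z≤n , (λ _ ()) , (λ _ ())
  least Q? mono (suc U) with Q? U | least Q? mono U
  ... | no ¬q | _ = suc U , ≤-refl , (λ N N≤U q → ⊥-elim (¬q (mono (s≤s⁻¹ N≤U) q))) , (λ N N≤U U<N → ⊥-elim (<⇒≱ N≤U U<N))
  ... | yes q | T , T≤U , to , from = T , m≤n⇒m≤1+n T≤U , to′ , from′
    where
    to′ : ∀ N → N < suc U → _ → T ≤ N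
    to′ N N≤U qN with m≤n⇒m<n∨m≡n (s≤s⁻¹ N≤U)
    ... | inj₁ N<U  = to N N<U qN
    ... | inj₂ refl = T≤U
    from′ : ∀ N → N < suc U → T ≤ N → _
    from′ N N≤U T≤N with m≤n⇒m<n∨m≡n (s≤s⁻¹ N≤U)
    ... | inj₁ N<U  = from N N<U T≤N
    ... | inj₂ refl = q

  argmax-cong : ∀ {v} (f g : Fin (suc v) → ℚ) → (∀ y → f y ≡ g y) → argmax f ≡ argmax g
  argmax-cong f g f≗g = List.foldr-cong lift-cong refl (List.allFin _)
    where
    open Extrema (DecTotalOrder.totalOrder ℚ.≤-decTotalOrder) using (⊔ᴸ)
    open MaxOperator (DecTotalOrder.totalOrder ℚ.≤-decTotalOrder) using () renaming (⊔-sel to ⊔ℚ-sel)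
    lift-cong : ∀ x y → ⊔ᴸ f x y ≡ ⊔ᴸ g x y
    lift-cong x y = cong₂ (λ a b → [ (λ _ → x) , (λ _ → y) ]′ (⊔ℚ-sel a b)) (f≗g x) (f≗g y)

  -- A unary operation adds 2 levels, a binary one 4 and an iterated sum 15; hence 19 for a dot
  -- product and 21 for a softmax. The Hopfield layer takes five products, a scaling and a softmax,
  -- 120 in total, and the feed-forward network 2 * (19 + 4) + 2 = 48.
  networkDepth : ℕ → ℕ → ℕ
  networkDepth zero    d = d
  networkDepth (suc L) d = networkDepth L (168 + d)

  vectorDepth : ℕ → ℕ → ℕ
  vectorDepth zero    d = d
  vectorDepth (suc k) d = 2 + vectorDepth k d

  -- The embedding is known at depth 5 = `suc 4`, the output product and its softmax add 40, and the
  -- joint lookup of all probabilities adds two levels per token of the vocabulary.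
  modelDepth : ℕ → ℕ → ℕ
  modelDepth L v = suc (vectorDepth (suc v) (40 + networkDepth L 4))

  module Tracking {p : ℕ} (𝔸 : FloatArithmetic p) {n F κ : ℕ}
                  (floats≤F : FloatCode.#floats p ≤ F) (2≤F : 2 ≤ F)
                  (sum≤F : 3 + 4 * (suc κ * (2 + κ)) ≤ F) (digits≤F : 2 + (p + (2 ^ p + 2 ^ p)) ≤ F) where

    open FloatCode p

    open FloatArithmetic 𝔸
    open Model 𝔸

    record Tracks (d : ℕ) (x : Vec Bool n → Float p) : Set where
      constructor tracks
      field decides-value : ∀ q → Decides F d (λ w → ⟦ x w ⟧ ≡ q)

    open Tracks

    private variable
      d k : ℕ
      x y : Vec Bool n → Float p

    tracks-const : ∀ a → Tracks (suc d) (λ _ → a)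
    tracks-const a = tracks λ q → decides-const (⟦ a ⟧ ℚ.≟ q)

    tracks-+ : ∀ k → Tracks d x → Tracks (k + d) x
    tracks-+ k X = tracks λ q → decides-+ k (decides-value X q)

    -- `P` may still depend on the input, so that lookups can be nested; this is how operations with
    -- two arguments are handled.
    tracks-bind : (P : Float p → Vec Bool n → Set) → (∀ a b → ⟦ a ⟧ ≡ ⟦ b ⟧ → ∀ w → P a w → P b w) →
                  Tracks d x → (∀ a → Decides F d (P a)) → Decides F (2 + d) (λ w → P (x w) w)
    tracks-bind {x = x} P resp X D = decides-map
      (λ w (i , eq , Pi) → resp (float i) (x w) (sym eq) w Pi)
      (λ w Pw → let i , eq = float-surjective (x w) in
         i , cong ⟦_⟧ (sym eq) , subst (λ a → P a w) (sym eq) Pw)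
      (decides-∃ {P = λ i w → ⟦ x w ⟧ ≡ ⟦ float i ⟧ × P (float i) w} floats≤F
        (λ i → decides-× 2≤F (decides-value X ⟦ float i ⟧) (D (float i))))

    tracks-decide : (P : Float p → Set) → (∀ a b → ⟦ a ⟧ ≡ ⟦ b ⟧ → P a → P b) → (∀ a → Dec (P a)) →
                    Tracks (suc d) x → Decides F (3 + d) (λ w → P (x w))
    tracks-decide P resp P? X = tracks-bind (λ a _ → P a) (λ a b eq _ → resp a b eq) X (λ a → decides-const (P? a))

    tracks-unary : (g : Float p → Float p) → (∀ a b → ⟦ a ⟧ ≡ ⟦ b ⟧ → ⟦ g a ⟧ ≡ ⟦ g b ⟧) →
                   Tracks (suc d) x → Tracks (3 + d) (g ∘ x)
    tracks-unary g g-cong X = tracks λ q → tracks-decide (λ a → ⟦ g a ⟧ ≡ q) (λ a b eq h → trans (sym (g-cong a b eq)) h) (λ a → ⟦ g a ⟧ ℚ.≟ q) X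

    tracks-binary : (g : Float p → Float p → Float p) →
                    (∀ a a′ b b′ → ⟦ a ⟧ ≡ ⟦ a′ ⟧ → ⟦ b ⟧ ≡ ⟦ b′ ⟧ → ⟦ g a b ⟧ ≡ ⟦ g a′ b′ ⟧) →
                    Tracks (suc d) x → Tracks (suc d) y → Tracks (5 + d) (λ w → g (x w) (y w))
    tracks-binary {y = y} g g-cong X Y = tracks λ q → tracks-bind (λ a w → ⟦ g a (y w) ⟧ ≡ q)
      (λ a b eq w h → trans (sym (g-cong a b (y w) (y w) eq refl)) h) (tracks-+ 2 X)
      (λ a → decides-value (tracks-unary (g a) (λ b b′ → g-cong a a b b′ refl) Y) q)

    ⊕-cong : ∀ a a′ b b′ → ⟦ a ⟧ ≡ ⟦ a′ ⟧ → ⟦ b ⟧ ≡ ⟦ b′ ⟧ → ⟦ a ⊕ b ⟧ ≡ ⟦ a′ ⊕ b′ ⟧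
    ⊕-cong a a′ b b′ eq eq′ = cong ⟦_⟧ (cong₂ (λ x y → round (x ℚ.+ y)) eq eq′)

    ⊗-cong : ∀ a a′ b b′ → ⟦ a ⟧ ≡ ⟦ a′ ⟧ → ⟦ b ⟧ ≡ ⟦ b′ ⟧ → ⟦ a ⊗ b ⟧ ≡ ⟦ a′ ⊗ b′ ⟧
    ⊗-cong a a′ b b′ eq eq′ = cong ⟦_⟧ (cong₂ (λ x y → round (x ℚ.* y)) eq eq′)

    ⊘-cong : ∀ a a′ b b′ → ⟦ a ⟧ ≡ ⟦ a′ ⟧ → ⟦ b ⟧ ≡ ⟦ b′ ⟧ → ⟦ a ⊘ b ⟧ ≡ ⟦ a′ ⊘ b′ ⟧
    ⊘-cong a a′ b b′ eq eq′ with ⟦ b ⟧ ℚ.≟ 0ℚ | ⟦ b′ ⟧ ℚ.≟ 0ℚ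
    ... | yes _   | yes _    = refl
    ... | yes b≡0 | no b′≢0  = ⊥-elim (b′≢0 (trans (sym eq′) b≡0))
    ... | no b≢0  | yes b′≡0 = ⊥-elim (b≢0 (trans eq′ b′≡0))
    ... | no b≢0  | no b′≢0  = cong (⟦_⟧ ∘ round) (÷-cong ⟦ a ⟧ ⟦ a′ ⟧ ⟦ b ⟧ ⟦ b′ ⟧ b≢0 b′≢0 eq eq′)
      where
      ÷-cong : ∀ p p′ q q′ (q≢0 : q ≢ 0ℚ) (q′≢0 : q′ ≢ 0ℚ) → p ≡ p′ → q ≡ q′ →
               (p ℚ.÷ q) {{ℚ.≢-nonZero q≢0}} ≡ (p′ ℚ.÷ q′) {{ℚ.≢-nonZero q′≢0}}
      ÷-cong p p′ q q′ _ _ refl refl = refl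

    relu-cong : ∀ a b → ⟦ a ⟧ ≡ ⟦ b ⟧ → ⟦ relu a ⟧ ≡ ⟦ relu b ⟧
    relu-cong a b eq = cong (λ x → ⟦ round (0ℚ ℚ.⊔ x) ⟧) eq

    tracks-⊕ : Tracks (suc d) x → Tracks (suc d) y → Tracks (5 + d) (λ w → x w ⊕ y w)
    tracks-⊕ = tracks-binary _⊕_ ⊕-cong

    tracks-⊗ : Tracks (suc d) x → Tracks (suc d) y → Tracks (5 + d) (λ w → x w ⊗ y w)
    tracks-⊗ = tracks-binary _⊗_ ⊗-cong

    tracks-⊘ : Tracks (suc d) x → Tracks (suc d) y → Tracks (5 + d) (λ w → x w ⊘ y w)
    tracks-⊘ = tracks-binary _⊘_ ⊘-cong

    TracksAll : ∀ {k} → ℕ → (Vec Bool n → Vector (Float p) k) → Set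
    TracksAll d xs = ∀ i → Tracks d (λ w → xs w i)

    -- `κ` bounds the length of every vector, and the base exceeds it by the 2 that carry lookahead
    -- requires. Codes are below 2 ^ K and so fit into `K` digits; one more digit makes room for the
    -- sum of up to `κ` codes.
    B K : ℕ
    B = 2 + κ
    K = suc (p + (E + E))

    open Radix B using (digit)

    code<B^K : ∀ a → code a < B ^ suc K
    code<B^K a = begin-strict
      code a                ≡⟨ sym (*-identityˡ _) ⟩
      1 * code a            <⟨ *-monoʳ-< 1 (code< a) ⟩
      1 * (2 * bound)       ≡⟨ *-identityˡ _ ⟩
      2 ^ K                 ≤⟨ ^-monoˡ-≤ K (s≤s (s≤s z≤n)) ⟩
      B ^ K                 ≤⟨ m≤n*m (B ^ K) B ⟩
      B ^ suc K             ∎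
      where open ≤-Reasoning

    ∑code<B^K : ∀ {k} → k ≤ κ → (as : Fin k → Float p) → ∑ (code ∘ as) < B ^ suc K
    ∑code<B^K {k} k≤κ as = begin-strict
      ∑ (code ∘ as)         ≤⟨ ∑-bound _ (λ i → <⇒≤ (code< (as i))) ⟩
      k * 2 ^ K             <⟨ *-monoˡ-< (2 ^ K) {{m^n≢0 2 K}} (s≤s (≤-trans k≤κ (n≤1+n κ))) ⟩
      B * 2 ^ K             ≤⟨ *-monoʳ-≤ B (^-monoˡ-≤ K (s≤s (s≤s z≤n))) ⟩
      B ^ suc K             ∎
      where open ≤-Reasoning

    module _ {k} (k≤κ : k ≤ κ) (xs : Vec Bool n → Vector (Float p) k) (X : TracksAll (suc d) xs) where

      private
        total : Vec Bool n → ℕ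
        total w = ∑ (λ i → code (xs w i))

        value : ℕ → ℚ
        value N = ⟦ round (fromℕ′ N ℚ.* unit ℚ.- offsets k) ⟧

        value-total : ∀ w → ⟦ sum (xs w) ⟧ ≡ value (total w)
        value-total w = cong (⟦_⟧ ∘ round) (sum-code (xs w))

        value-mono : ∀ {M N} → M ≤ N → value M ℚ.≤ value N
        value-mono M≤N = round-mono-≤ 𝔸 (sum-code-mono k M≤N)

        decides-≤total : ∀ T → T ≤ B ^ suc K → Decides F (14 + d) (λ w → T ≤ total w)
        decides-≤total T T≤ = decides-≤-iteratedSum {B = B} (λ i w → code (xs w i)) K T T≤ (+-monoʳ-≤ 2 k≤κ)
          (≤-trans (+-monoʳ-≤ 3 (*-monoʳ-≤ 4 (*-monoˡ-≤ B (s≤s k≤κ)))) sum≤F) digits≤F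
          (λ i w → code<B^K (xs w i))
          (λ i b j → tracks-decide (λ a → toℕ j < digit (code a) b)
            (λ a a′ eq → subst (λ c → toℕ j < digit c b) (code-cong a a′ eq))
            (λ a → toℕ j <? digit (code a) b) (X i))

        decides-upward : (Q : ℚ → Set) → (∀ q → Dec (Q q)) → (∀ {q r} → q ℚ.≤ r → Q q → Q r) →
                         Decides F (14 + d) (λ w → Q ⟦ sum (xs w) ⟧)
        decides-upward Q Q? mono with T , T≤ , to , from ← least (λ N → Q? (value N)) (λ M≤N → mono (value-mono M≤N)) (B ^ suc K) =
          decides-map (λ w T≤N → subst Q (sym (value-total w)) (from (total w) (∑code<B^K k≤κ (xs w)) T≤N))
                      (λ w q → to (total w) (∑code<B^K k≤κ (xs w)) (subst Q (value-total w) q))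
                      (decides-≤total T T≤)

      tracks-sum : Tracks (16 + d) (λ w → sum (xs w))
      -- Equality with `q` is the difference of the two upward closed conditions `q ≤` and `q <`.
      tracks-sum = tracks λ q → decides-map
        (λ w (q≤ , q≮) → ℚ.≤-antisym (ℚ.≮⇒≥ q≮) q≤)
        (λ w eq → ℚ.≤-reflexive (sym eq) , ℚ.<-irrefl (sym eq))
        (decides-× 2≤F (decides-deepen (decides-upward (q ℚ.≤_) (q ℚ.≤?_) (λ q≤r h → ℚ.≤-trans h q≤r)))
                       (decides-¬ (≤-trans (n≤1+n 1) 2≤F) (decides-upward (q ℚ.<_) (q ℚ.<?_) (λ q≤r h → ℚ.<-≤-trans h q≤r))))

    tracks-dot : k ≤ κ → {xs ys : Vec Bool n → Vector (Float p) k} → TracksAll (suc d) xs → TracksAll (suc d) ys →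
                 Tracks (20 + d) (λ w → dot (xs w) (ys w))
    tracks-dot k≤κ {xs} {ys} X Y = tracks-sum k≤κ (λ w i → xs w i ⊗ ys w i) (λ i → tracks-⊗ (X i) (Y i))

    tracks-softmax : k ≤ κ → {xs : Vec Bool n → Vector (Float p) k} → TracksAll (suc d) xs →
                     TracksAll (22 + d) (λ w → softmax (xs w))
    tracks-softmax k≤κ {xs} X i = tracks-⊘ (tracks-+ 15 (exps i)) (tracks-sum k≤κ (λ w i → exp (xs w i)) exps)
      where
      exps : TracksAll _ (λ w i → exp (xs w i))
      exps i = tracks-unary exp (exp-cong 𝔸) (X i)

    TracksMatrix : ∀ {a b} → ℕ → (Vec Bool n → Matrix (Float p) a b) → Set
    TracksMatrix d A = ∀ i → TracksAll d (λ w → A w i)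

    tracks-· : ∀ {a b c} → b ≤ κ → {X : Vec Bool n → Matrix (Float p) a b} {Y : Vec Bool n → Matrix (Float p) b c} →
               TracksMatrix (suc d) X → TracksMatrix (suc d) Y → TracksMatrix (20 + d) (λ w → X w · Y w)
    tracks-· b≤κ X Y i j = tracks-dot b≤κ (X i) (λ k → Y k j)

    tracks-constMatrix : ∀ {a b} (A : Matrix (Float p) a b) → TracksMatrix (suc d) (λ _ → A)
    tracks-constMatrix A i j = tracks-const (A i j)

    module _ {l e : ℕ} (l≤κ : l ≤ κ) (e≤κ : e ≤ κ) where

      tracks-affine : ∀ (W : Matrix (Float p) e e) b {x : Vec Bool n → Vector (Float p) e} → TracksAll (suc d) x →
                      TracksAll (24 + d) (λ w → affine W b (x w))
      tracks-affine W b X i = tracks-⊕ (tracks-dot e≤κ (λ k → tracks-const (W i k)) X) (tracks-const (b i))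

      tracks-feedForward : ∀ ℓ {x : Vec Bool n → Vector (Float p) e} → TracksAll (suc d) x →
                           TracksAll (49 + d) (λ w → feedForward ℓ (x w))
      tracks-feedForward ℓ X = tracks-affine W₂ b₂ (λ i → tracks-unary relu relu-cong (tracks-affine W₁ b₁ X i))
        where open Layer ℓ

      tracks-hopfield : ∀ ℓ {h : Vec Bool n → Matrix (Float p) l e} → TracksMatrix (suc d) h →
                        TracksMatrix (121 + d) (λ w → hopfield ℓ (h w) (h w))
      tracks-hopfield ℓ {h} H = tracks-· e≤κ
        (tracks-· l≤κ
          (λ i → tracks-softmax l≤κ (λ j → tracks-⊗ (tracks-const β)
            -- Both factors of a product must be tracked at the same depth. The padding 38 matches
            -- two earlier products, and 82 matches three products, the scaling and the softmax.
            (tracks-· e≤κ {Y = λ w → h w ᵀ} (tracks-· e≤κ (tracks-· e≤κ H (tracks-constMatrix W-Q)) (tracks-constMatrix (W-K ᵀ))) (λ i j → tracks-+ 38 (H j i)) i j)))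
          (λ i j → tracks-+ 82 (H i j)))
        (tracks-constMatrix (valueMatrix ℓ))
        where open Layer ℓ

      tracks-layer : ∀ ℓ {h : Vec Bool n → Matrix (Float p) l e} → TracksMatrix (suc d) h →
                     TracksMatrix (169 + d) (λ w → layer ℓ (h w))
      tracks-layer ℓ H i = tracks-feedForward ℓ (λ j → tracks-hopfield ℓ H i j)

      tracks-MHN : ∀ {L} (ℓs : Vec (Layer p e) L) {h : Vec Bool n → Matrix (Float p) l e} → TracksMatrix (suc d) h →
                   TracksMatrix (suc (networkDepth L d)) (λ w → MHN ℓs (h w))
      tracks-MHN Vec.[]       H = H
      tracks-MHN (ℓ Vec.∷ ℓs) H = tracks-MHN ℓs (tracks-layer ℓ H)

    -- The entries are looked up one after another, at a depth linear in the length. This is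
    -- affordable for vectors indexed by the vocabulary, whose size is fixed.
    tracks-vector : ∀ {k} (xs : Vec Bool n → Vector (Float p) k) → TracksAll (suc d) xs → (Q : Vector (Float p) k → Set) →
                    (∀ as bs → (∀ i → ⟦ as i ⟧ ≡ ⟦ bs i ⟧) → Q as → Q bs) → (∀ as → Dec (Q as)) →
                    Decides F (suc (vectorDepth k d)) (λ w → Q (xs w))
    tracks-vector {k = zero}  xs X Q resp Q? =
      decides-map {P = λ _ → Q Vector.[]} (λ w → resp _ _ (λ ())) (λ w → resp _ _ (λ ())) (decides-const (Q? Vector.[]))
    tracks-vector {d = d} {k = suc k} xs X Q resp Q? = decides-map
      (λ w → resp _ _ λ { zero → refl ; (suc _) → refl }) (λ w → resp _ _ λ { zero → refl ; (suc _) → refl })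
      (tracks-bind (λ a w → Q (a Vector.∷ (λ i → xs w (suc i))))
        (λ a b eq w → resp _ _ λ { zero → eq ; (suc _) → refl })
        (subst (λ e → Tracks e (λ w → xs w zero)) (depth-eq k) (tracks-+ (2* k) (X zero)))
        (λ a → tracks-vector (λ w i → xs w (suc i)) (λ i → X (suc i)) (λ bs → Q (a Vector.∷ bs))
          (λ as bs eq → resp _ _ λ { zero → refl ; (suc i) → eq i }) (λ bs → Q? (a Vector.∷ bs))))
      where
      2* : ℕ → ℕ
      2* zero    = 0
      2* (suc k) = 2 + 2* k
      depth-eq : ∀ k → 2* k + suc d ≡ suc (vectorDepth k d)
      depth-eq zero    = refl
      depth-eq (suc k) = cong (2 +_) (depth-eq k)

    decides-MHM : ∀ {e L n-max v m} (θ : Parameters p e L n-max v) .(b : suc m ≤ n-max) → e ≤ κ → suc m ≤ κ → suc v ≤ κ →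
      (xs : Vec Bool n → Vec (Fin (suc v)) (suc m)) →
      (∀ i (A : Fin (suc v) → Set) → (∀ t → Dec (A t)) → Decides F 5 (λ w → A (Vec.lookup (xs w) i))) →
      ∀ y → Decides F (modelDepth L v) (λ w → MHM θ b (xs w) ≡ y)
    decides-MHM {e} {L} {n-max} {v} {m} θ b e≤κ l≤κ v≤κ xs X y =
      tracks-vector (λ w → nextTokenProbabilities θ b (xs w)) probabilities
        (λ as → argmax (λ t → ⟦ as t ⟧) ≡ y) (λ as bs eq → trans (sym (argmax-cong _ _ eq)))
        (λ as → argmax (λ t → ⟦ as t ⟧) Fin.≟ y)
      where
      open Parameters θ
      embedding : TracksMatrix 5 (λ w → embed θ b (xs w))
      embedding i j = tracks λ q → X i (λ t → ⟦ θ-TE t j ⊕ θ-PE (Fin.inject≤ i b) j ⟧ ≡ q) (λ t → _ ℚ.≟ q)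
      probabilities : TracksAll (suc (40 + networkDepth L 4)) (λ w → nextTokenProbabilities θ b (xs w))
      probabilities = tracks-softmax v≤κ (λ t → tracks-dot e≤κ (λ k → tracks-const (θ-OUTPUT t k)) (tracks-MHN l≤κ e≤κ layers embedding (fromℕ m)))

-- Calculus of polynomial bounds

module PolynomialBounds where

  open import Data.Bool.Base using (not)
  open import Data.Nat.Base
  open import Data.Nat.Induction using (<-rec)
  open import Data.Nat.Logarithm
  open import Data.Nat.Properties
  open import Data.Nat.Solver using (module +-*-Solver)

  -- Unlike Polynomial, this bounds every value, not just almost all of them.
  PolynomiallyBounded : (ℕ → ℕ) → Set
  PolynomiallyBounded f = ∃[ k ] ∀ n → f n ≤ (2 + n) ^ k

  private variable
    f g : ℕ → ℕ

  poly-mono : (∀ n → f n ≤ g n) → PolynomiallyBounded g → PolynomiallyBounded f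
  poly-mono f≤g (k , g≤) = k , λ n → ≤-trans (f≤g n) (g≤ n)

  poly-id : PolynomiallyBounded id
  poly-id = 1 , λ n → ≤-trans (m≤n+m n 2) (≤-reflexive (sym (*-identityʳ (2 + n))))

  n≤2^n : ∀ n → n ≤ 2 ^ n
  n≤2^n zero    = z≤n
  n≤2^n (suc n) = +-mono-≤ (m^n>0 2 n) (≤-trans (n≤2^n n) (m≤m+n _ 0))

  poly-const : ∀ c → PolynomiallyBounded (λ _ → c)
  poly-const c = c , λ n → ≤-trans (n≤2^n c) (^-monoˡ-≤ c (s≤s (s≤s z≤n)))

  poly-* : PolynomiallyBounded f → PolynomiallyBounded g → PolynomiallyBounded (λ n → f n * g n)
  poly-* (k , f≤) (l , g≤) = k + l , λ n → ≤-trans (*-mono-≤ (f≤ n) (g≤ n)) (≤-reflexive (sym (^-distribˡ-+-* (2 + n) k l)))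

  poly-+ : PolynomiallyBounded f → PolynomiallyBounded g → PolynomiallyBounded (λ n → f n + g n)
  poly-+ (k , f≤) (l , g≤) = suc (k + l) , λ n → ≤-trans
    (+-mono-≤ (≤-trans (f≤ n) (^-monoʳ-≤ (2 + n) (m≤m+n k l))) (≤-trans (g≤ n) (^-monoʳ-≤ (2 + n) (m≤n+m l k))))
    (≤-trans (≤-reflexive (cong (λ x → (2 + n) ^ (k + l) + x) (sym (+-identityʳ ((2 + n) ^ (k + l)))))) (*-monoˡ-≤ ((2 + n) ^ (k + l)) {2} (s≤s (s≤s (z≤n {n})))))

  poly-^ : ∀ e → PolynomiallyBounded f → PolynomiallyBounded (λ n → f n ^ e)
  poly-^ e (k , f≤) = k * e , λ n → ≤-trans (^-monoˡ-≤ e (f≤ n)) (≤-reflexive (^-*-assoc (2 + n) k e))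

  poly-∘ : PolynomiallyBounded f → PolynomiallyBounded g → PolynomiallyBounded (f ∘ g)
  poly-∘ {g = g} (k , f≤) poly-g = poly-mono (λ n → f≤ (g n)) (poly-^ k (poly-+ (poly-const 2) poly-g))

  eventually⇒always : ∀ (f g : ℕ → ℕ) N → (∀ n → N ≤ n → f n ≤ g n) → ∃[ c ] ∀ n → f n ≤ c + g n
  eventually⇒always f g zero    f≤g = 0 , λ n → f≤g n z≤n
  eventually⇒always f g (suc N) f≤g with c , h ← eventually⇒always (f ∘ suc) (g ∘ suc) N (λ n N≤n → f≤g (suc n) (s≤s N≤n)) =
    f 0 + c , λ { zero    → ≤-trans (m≤m+n (f 0) c) (m≤m+n _ (g 0))
                ; (suc n) → ≤-trans (h n) (+-monoˡ-≤ (g (suc n)) (m≤n+m c (f 0))) }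

  Polynomial⇒bounded : Polynomial f → PolynomiallyBounded f
  Polynomial⇒bounded {f} (k , c , N , f≤) with c′ , h ← eventually⇒always f (λ n → c * n ^ k) N f≤ =
    poly-mono h (poly-+ (poly-const c′) (poly-* (poly-const c) (poly-^ k poly-id)))

  bounded⇒Polynomial : PolynomiallyBounded f → Polynomial f
  bounded⇒Polynomial (k , f≤) = k , 3 ^ k , 1 , λ { n@(suc n′) _ → ≤-trans (f≤ n)
    (≤-trans (^-monoˡ-≤ k (≤-trans (+-monoˡ-≤ n (*-monoʳ-≤ 2 (s≤s (z≤n {n′})))) (≤-reflexive (+-comm (2 * n) n)))) (≤-reflexive (^-distribʳ-* k 3 n))) }
    where
    ^-distribʳ-* : ∀ k a b → (a * b) ^ k ≡ a ^ k * b ^ k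
    ^-distribʳ-* zero    a b = refl
    ^-distribʳ-* (suc k) a b = trans (cong (a * b *_) (^-distribʳ-* k a b))
      (solve 4 (λ a b x y → a :* b :* (x :* y) := a :* x :* (b :* y)) refl a b (a ^ k) (b ^ k))
      where open +-*-Solver

  2^⌊log₂1+n⌋≤1+n : ∀ n → 2 ^ ⌊log₂ suc n ⌋ ≤ suc n
  2^⌊log₂1+n⌋≤1+n = <-rec _ step
    where
    step : ∀ n → (∀ {m} → m < n → 2 ^ ⌊log₂ suc m ⌋ ≤ suc m) → 2 ^ ⌊log₂ suc n ⌋ ≤ suc n
    step zero    rec = ≤-refl
    step (suc n) rec = begin
      2 ^ ⌊log₂ 2 + n ⌋              ≡⟨ cong (λ l → 2 * 2 ^ l) (sym (⌊log₂⌊n/2⌋⌋≡⌊log₂n⌋∸1 (2 + n))) ⟩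
      2 * 2 ^ ⌊log₂ suc ⌊ n /2⌋ ⌋    ≤⟨ *-monoʳ-≤ 2 (rec (s≤s (⌊n/2⌋≤n n))) ⟩
      2 * suc ⌊ n /2⌋                ≡⟨ *-suc 2 ⌊ n /2⌋ ⟩
      2 + (⌊ n /2⌋ + (⌊ n /2⌋ + 0))  ≡⟨ cong (λ x → 2 + (⌊ n /2⌋ + x)) (+-identityʳ ⌊ n /2⌋) ⟩
      2 + (⌊ n /2⌋ + ⌊ n /2⌋)        ≤⟨ +-monoʳ-≤ 2 (+-monoʳ-≤ ⌊ n /2⌋ (⌊n/2⌋≤⌈n/2⌉ n)) ⟩
      2 + (⌊ n /2⌋ + ⌈ n /2⌉)        ≡⟨ cong (2 +_) (⌊n/2⌋+⌈n/2⌉≡n n) ⟩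
      2 + n                         ∎
      where open ≤-Reasoning

  poly-2^⌊log₂⌋ : PolynomiallyBounded (λ n → 2 ^ ⌊log₂ n ⌋)
  poly-2^⌊log₂⌋ = poly-mono (λ { zero → s≤s z≤n ; (suc n) → ≤-trans (2^⌊log₂1+n⌋≤1+n n) (n≤1+n (suc n)) }) (poly-+ (poly-const 1) poly-id)

  poly-2^ : Logarithmic f → PolynomiallyBounded (λ n → 2 ^ f n)
  poly-2^ {f} (c , N , f≤) with c′ , h ← eventually⇒always f (λ n → c * ⌊log₂ n ⌋) N f≤ =
    poly-mono (λ n → ≤-trans (^-monoʳ-≤ 2 (h n)) (≤-reflexive (trans (^-distribˡ-+-* 2 c′ _)
        (cong (2 ^ c′ *_) (trans (cong (2 ^_) (*-comm c ⌊log₂ n ⌋)) (sym (^-*-assoc 2 ⌊log₂ n ⌋ c)))))))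
      (poly-* (poly-const (2 ^ c′)) (poly-^ c poly-2^⌊log₂⌋))

  poly-exp : ∀ A → Logarithmic f → PolynomiallyBounded (λ n → A ^ f n)
  poly-exp {f} A log-f = poly-mono (λ n → ≤-trans (^-monoˡ-≤ (f n) (n≤2^n A)) (≤-reflexive
      (trans (^-*-assoc 2 A (f n)) (trans (cong (2 ^_) (*-comm A (f n))) (sym (^-*-assoc 2 (f n) A))))))
    (poly-^ A (poly-2^ log-f))

-- Barrington's theorem over S₅

module Barrington where

  open import Algebra.Bundles using (Group)
  open import Data.Bool.Base using (Bool; true; false; not; _∧_; if_then_else_)
  open import Data.Bool.ListAction using (and; or)
  open import Data.Fin.Base as Fin using (Fin; zero; suc)
  open import Data.Fin.Patterns
  open import Data.Fin.Properties using (all?; _≟_)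
  open import Data.Fin.Permutation using (Permutation′; _⟨$⟩ʳ_; _⟨$⟩ˡ_; permutation)
  open import Data.List.Base as List using (List; []; _∷_; _++_)
  import Data.List.Properties as List
  open import Data.Nat.Base
  open import Data.Nat.Properties hiding (_≟_)
  open import Data.Nat.Solver using (module +-*-Solver)
  open import Relation.Nullary using (¬_)
  open import Relation.Nullary.Decidable using (True; toWitness)

  open Group S₅ using (_∙_; ε; _⁻¹; _≈_)

  private variable
    n m : ℕ

  -- Constant factors are instructions of their own instead of being merged into neighbouring
  -- branches. Each instruction reads at most one bit, so its token is available to a formula at
  -- constant depth.
  data Instruction (n : ℕ) : Set where
    always : Permutation′ 5 → Instruction n
    branch : Fin n → (π ρ : Permutation′ 5) → Instruction n

  Program : ℕ → Set
  Program n = List (Instruction n)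

  run : Vec Bool n → Instruction n → Permutation′ 5
  run w (always π)     = π
  run w (branch i π ρ) = if Vec.lookup w i then π else ρ

  evaluate : Vec Bool n → Program n → Permutation′ 5
  evaluate w []      = ε
  evaluate w (x ∷ P) = run w x ∙ evaluate w P

  evaluate-++ : ∀ (w : Vec Bool n) P Q → evaluate w (P ++ Q) ≈ (evaluate w P ∙ evaluate w Q)
  evaluate-++ w []      Q i = refl
  evaluate-++ w (x ∷ P) Q i = cong (run w x ⟨$⟩ʳ_) (evaluate-++ w P Q i)

  invert : Instruction n → Instruction n
  invert (always π)     = always (π ⁻¹)
  invert (branch i π ρ) = branch i (π ⁻¹) (ρ ⁻¹)

  run-invert : ∀ (w : Vec Bool n) x → run w (invert x) ≡ run w x ⁻¹
  run-invert w (always π) = refl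
  run-invert w (branch i π ρ) with Vec.lookup w i
  ... | true  = refl
  ... | false = refl

  inverse : Program n → Program n
  inverse []      = []
  inverse (x ∷ P) = inverse P ++ invert x ∷ []

  evaluate-inverse : ∀ (w : Vec Bool n) P → evaluate w (inverse P) ≈ (evaluate w P ⁻¹)
  evaluate-inverse w []      i = refl
  evaluate-inverse w (x ∷ P) i = trans (evaluate-++ w (inverse P) (invert x ∷ []) i)
    (trans (cong (λ π → evaluate w (inverse P) ⟨$⟩ʳ (π ⟨$⟩ʳ i)) (run-invert w x)) (evaluate-inverse w P _))

  length-inverse : ∀ (P : Program n) → List.length (inverse P) ≡ List.length P
  length-inverse []      = refl
  length-inverse (x ∷ P) = trans (List.length-++ (inverse P)) (trans (+-comm _ 1) (cong suc (length-inverse P)))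

  pointwise : {f g : Fin 5 → Fin 5} → {True (all? λ i → f i ≟ g i)} → ∀ i → f i ≡ g i
  pointwise {_} {_} {t} = toWitness t

  fromTable : (f g : Vec (Fin 5) 5) → {True (all? λ i → Vec.lookup f (Vec.lookup g i) ≟ i)} →
              {True (all? λ i → Vec.lookup g (Vec.lookup f i) ≟ i)} → Permutation′ 5
  fromTable f g {p} {q} = permutation (Vec.lookup f) (Vec.lookup g) (toWitness p) (toWitness q)

  -- The commutator of the 5-cycle α with its conjugate by γ₁ is the conjugate of α
  -- by γ₂; conjugation by δ inverts α.
  α γ₁ γ₂ δ : Permutation′ 5
  α  = fromTable (1F Vec.∷ 2F Vec.∷ 3F Vec.∷ 4F Vec.∷ 0F Vec.∷ Vec.[]) (4F Vec.∷ 0F Vec.∷ 1F Vec.∷ 2F Vec.∷ 3F Vec.∷ Vec.[])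
  γ₁ = fromTable (0F Vec.∷ 1F Vec.∷ 3F Vec.∷ 4F Vec.∷ 2F Vec.∷ Vec.[]) (0F Vec.∷ 1F Vec.∷ 4F Vec.∷ 2F Vec.∷ 3F Vec.∷ Vec.[])
  γ₂ = fromTable (0F Vec.∷ 4F Vec.∷ 1F Vec.∷ 3F Vec.∷ 2F Vec.∷ Vec.[]) (0F Vec.∷ 2F Vec.∷ 4F Vec.∷ 3F Vec.∷ 1F Vec.∷ Vec.[])
  δ  = fromTable (0F Vec.∷ 4F Vec.∷ 3F Vec.∷ 2F Vec.∷ 1F Vec.∷ Vec.[]) (0F Vec.∷ 4F Vec.∷ 3F Vec.∷ 2F Vec.∷ 1F Vec.∷ Vec.[])

  _^ᵇ_ : Permutation′ 5 → Bool → Permutation′ 5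
  π ^ᵇ b = if b then π else ε

  infix 4 _Realizes_

  -- One fixed 5-cycle serves all subprograms, because each gate ends with a conjugation that leads
  -- back to `α`.
  record _Realizes_ (P : Program n) (f : Vec Bool n → Bool) : Set where
    constructor realizes
    field evaluates : ∀ w → evaluate w P ≈ (α ^ᵇ f w)

  open _Realizes_

  conjugate : Permutation′ 5 → Program n → Program n
  conjugate γ P = always γ ∷ P ++ always (γ ⁻¹) ∷ []

  evaluate-conjugate : ∀ (w : Vec Bool n) γ P → evaluate w (conjugate γ P) ≈ (γ ∙ (evaluate w P ∙ γ ⁻¹))
  evaluate-conjugate w γ P i = cong (γ ⟨$⟩ʳ_) (evaluate-++ w P (always (γ ⁻¹) ∷ []) i)

  length-conjugate : ∀ γ (P : Program n) → List.length (conjugate γ P) ≡ 2 + List.length P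
  length-conjugate γ P = cong suc (trans (List.length-++ P) (+-comm _ 1))

  -- Multiplication by the inverse of `α` sends `α` to `ε` and `ε` to the inverse of `α`, which
  -- conjugation by `δ` turns into `α`.
  notProgram : Program n → Program n
  notProgram P = conjugate δ (P ++ always (α ⁻¹) ∷ [])

  notProgram-realizes : ∀ {f : Vec Bool n → Bool} P → P Realizes f → notProgram P Realizes (not ∘ f)
  notProgram-realizes {f = f} P (realizes P-f) = realizes λ w i → trans (evaluate-conjugate w δ (P ++ always (α ⁻¹) ∷ []) i)
    (trans (cong (δ ⟨$⟩ʳ_) (trans (evaluate-++ w P (always (α ⁻¹) ∷ []) _) (P-f w _)))
      (table (f w) i))
    where
    table : ∀ b → (δ ∙ ((α ^ᵇ b) ∙ (α ⁻¹ ∙ δ ⁻¹))) ≈ (α ^ᵇ not b)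
    table true  = pointwise
    table false = pointwise

  -- A commutator is trivial as soon as one of its arguments is, which is the behaviour of a
  -- conjunction. The outer conjugation restores `α` when both are nontrivial.
  andProgram : Program n → Program n → Program n
  andProgram P Q = conjugate (γ₂ ⁻¹) (P ++ conjugate γ₁ Q ++ inverse P ++ conjugate γ₁ (inverse Q))

  andProgram-realizes : ∀ {f g : Vec Bool n → Bool} P Q → P Realizes f → Q Realizes g →
                        andProgram P Q Realizes (λ w → f w ∧ g w)
  andProgram-realizes {f = f} {g} P Q (realizes P-f) (realizes Q-g) = realizes λ w i →
    trans (evaluate-conjugate w (γ₂ ⁻¹) (P ++ conjugate γ₁ Q ++ inverse P ++ conjugate γ₁ (inverse Q)) i)
      (trans (cong (γ₂ ⟨$⟩ˡ_) (trans (evaluate-++ w P _ _) (trans (P-f w _) (cong (α ^ᵇ f w ⟨$⟩ʳ_)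
        (trans (evaluate-++ w (conjugate γ₁ Q) _ _) (trans (evaluate-conjugate w γ₁ Q _) (cong (γ₁ ⟨$⟩ʳ_) (trans (Q-g w _) (cong (λ j → α ^ᵇ g w ⟨$⟩ʳ (γ₁ ⟨$⟩ˡ j))
          (trans (evaluate-++ w (inverse P) _ _) (trans (evaluate-inverse w P _) (trans (⁻¹-cong {evaluate w P} {α ^ᵇ f w} (P-f w) _) (cong ((α ^ᵇ f w) ⟨$⟩ˡ_)
            (trans (evaluate-conjugate w γ₁ (inverse Q) _) (cong (γ₁ ⟨$⟩ʳ_) (trans (evaluate-inverse w Q _) (⁻¹-cong {evaluate w Q} {α ^ᵇ g w} (Q-g w) _)))))))))))))))))
        (table (f w) (g w) i))
    where
    open Group S₅ using (⁻¹-cong)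
    table : ∀ b c → (γ₂ ⁻¹ ∙ ((α ^ᵇ b) ∙ (γ₁ ∙ ((α ^ᵇ c) ∙ (γ₁ ⁻¹ ∙ ((α ^ᵇ b) ⁻¹ ∙ (γ₁ ∙ ((α ^ᵇ c) ⁻¹ ∙ (γ₁ ⁻¹ ∙ γ₂))))))))) ≈ (α ^ᵇ (b ∧ c))
    table true  true  = pointwise
    table true  false = pointwise
    table false true  = pointwise
    table false false = pointwise

  length-andProgram : ∀ (P Q : Program n) → List.length (andProgram P Q) ≡ 2 * List.length P + 2 * List.length Q + 6
  length-andProgram P Q = begin
    List.length (andProgram P Q)
      ≡⟨ length-conjugate (γ₂ ⁻¹) (P ++ conjugate γ₁ Q ++ inverse P ++ conjugate γ₁ (inverse Q)) ⟩
    2 + List.length (P ++ conjugate γ₁ Q ++ inverse P ++ conjugate γ₁ (inverse Q))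
      ≡⟨ cong (2 +_) (trans (List.length-++ P) (cong (p +_) (trans (List.length-++ (conjugate γ₁ Q))
           (cong₂ _+_ (length-conjugate γ₁ Q) (trans (List.length-++ (inverse P)) (cong₂ _+_ (length-inverse P)
             (trans (length-conjugate γ₁ (inverse Q)) (cong (2 +_) (length-inverse Q))))))))) ⟩
    2 + (p + (2 + q + (p + (2 + q))))
      ≡⟨ solve 2 (λ p q → con 2 :+ (p :+ (con 2 :+ q :+ (p :+ (con 2 :+ q)))) := con 2 :* p :+ con 2 :* q :+ con 6) refl p q ⟩
    2 * p + 2 * q + 6 ∎
    where
    open ≡-Reasoning
    open +-*-Solver
    p = List.length P
    q = List.length Q

  conjunction : ∀ {A : Set} → (A → Program n) → List A → Program n
  conjunction P []       = always α ∷ []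
  conjunction P (i ∷ is) = andProgram (P i) (conjunction P is)

  conjunction-realizes : ∀ {A : Set} (P : A → Program n) (f : Vec Bool n → A → Bool) → (∀ i → P i Realizes (λ w → f w i)) →
                         ∀ is → conjunction P is Realizes (λ w → and (List.map (f w) is))
  conjunction-realizes P f P-f []       = realizes λ _ _ → refl
  conjunction-realizes P f P-f (j ∷ is) = andProgram-realizes (P j) (conjunction P is) (P-f j) (conjunction-realizes P f P-f is)

  or-deMorgan : ∀ bs → not (and (List.map not bs)) ≡ or bs
  or-deMorgan []           = refl
  or-deMorgan (true ∷ bs)  = refl
  or-deMorgan (false ∷ bs) = or-deMorgan bs

  -- Shared nodes are expanded at every use. The length is then governed by the depth instead of the
  -- size, and stays polynomial at logarithmic depth.
  nodeProgram : ∀ {b} (C : Nodes n m) → AllGates (BoundedGate b) C → Fin m → Program n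
  gateProgram : ∀ {b} (g : Gate m) → BoundedGate b g → (Fin m → Program n) → Program n

  nodeProgram inputs  _         i       = branch i α ε ∷ []
  nodeProgram (C ▷ g) (bg , bC) zero    = gateProgram g bg (nodeProgram C bC)
  nodeProgram (C ▷ g) (bg , bC) (suc i) = nodeProgram C bC i

  gateProgram (AND is) _ P = conjunction P is
  gateProgram (OR is)  _ P = notProgram (conjunction (notProgram ∘ P) is)
  gateProgram (NOT i)  _ P = notProgram (P i)

  realizes-cong : ∀ {f g : Vec Bool n → Bool} P → (∀ w → f w ≡ g w) → P Realizes f → P Realizes g
  realizes-cong P f≗g (realizes P-f) = realizes λ w i → trans (P-f w i) (cong (λ b → α ^ᵇ b ⟨$⟩ʳ i) (f≗g w))

  gateProgram-realizes : ∀ {b} (g : Gate m) (bg : BoundedGate b g) (P : Fin m → Program n) (v : Vec Bool n → Vec Bool m) →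
                         (∀ i → P i Realizes (λ w → Vec.lookup (v w) i)) → gateProgram g bg P Realizes (λ w → evalGate g (v w))
  gateProgram-realizes (AND is) _ P v P-v = conjunction-realizes P (λ w → Vec.lookup (v w)) P-v is
  gateProgram-realizes (OR is)  _ P v P-v = realizes-cong _
    (λ w → trans (cong (not ∘ and) (List.map-∘ is)) (or-deMorgan (List.map (Vec.lookup (v w)) is)))
    (notProgram-realizes _ (conjunction-realizes (notProgram ∘ P) (λ w → not ∘ Vec.lookup (v w)) (λ i → notProgram-realizes (P i) (P-v i)) is))
  gateProgram-realizes (NOT i)  _ P v P-v = notProgram-realizes (P i) (P-v i)

  nodeProgram-realizes : ∀ {b} (C : Nodes n m) (bC : AllGates (BoundedGate b) C) i →
                         nodeProgram C bC i Realizes (λ w → Vec.lookup (evalNodes C w) i)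
  nodeProgram-realizes inputs _ i = realizes λ _ _ → refl
  nodeProgram-realizes (C ▷ g) (bg , bC) zero    = gateProgram-realizes g bg (nodeProgram C bC) (evalNodes C) (nodeProgram-realizes C bC)
  nodeProgram-realizes (C ▷ g) (bg , bC) (suc i) = nodeProgram-realizes C bC i

  length-notProgram : ∀ (P : Program n) → List.length (notProgram P) ≡ 3 + List.length P
  length-notProgram P = trans (length-conjugate δ (P ++ always (α ⁻¹) ∷ [])) (cong (2 +_) (trans (List.length-++ P) (+-comm _ 1)))

  -- With c = 6 + 2 * ℓ D, one more conjunct takes length L to at most 2L + c, so that L + c merely
  -- doubles. The empty conjunction has L = 1, whence the 7.
  length-conjunction : ∀ (P : Fin m → Program n) (δs : Vec ℕ m) (ℓ : ℕ → ℕ) → (∀ {d e} → d ≤ e → ℓ d ≤ ℓ e) →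
    (∀ i → List.length (P i) ≤ ℓ (Vec.lookup δs i)) → ∀ D is → List.foldr _⊔_ 0 (List.map (Vec.lookup δs) is) ≤ D →
    List.length (conjunction P is) + (6 + 2 * ℓ D) ≤ 2 ^ List.length is * (7 + 2 * ℓ D)
  length-conjunction P δs ℓ ℓ-mono P≤ D []       h = ≤-reflexive (sym (+-identityʳ _))
  length-conjunction P δs ℓ ℓ-mono P≤ D (i ∷ is) h = begin
    List.length (conjunction P (i ∷ is)) + c       ≡⟨ cong (_+ c) (length-andProgram (P i) (conjunction P is)) ⟩
    2 * List.length (P i) + 2 * L + 6 + c          ≤⟨ +-monoˡ-≤ c (+-monoˡ-≤ 6 (+-monoˡ-≤ (2 * L) (*-monoʳ-≤ 2 (≤-trans (P≤ i) (ℓ-mono (m⊔n≤o⇒m≤o _ _ h)))))) ⟩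
    2 * ℓ D + 2 * L + 6 + c                        ≡⟨ solve 2 (λ e l → con 2 :* e :+ con 2 :* l :+ con 6 :+ (con 6 :+ con 2 :* e) := con 2 :* (l :+ (con 6 :+ con 2 :* e))) refl (ℓ D) L ⟩
    2 * (L + c)                                    ≤⟨ *-monoʳ-≤ 2 (length-conjunction P δs ℓ ℓ-mono P≤ D is (m⊔n≤o⇒n≤o (Vec.lookup δs i) _ h)) ⟩
    2 * (2 ^ List.length is * (7 + 2 * ℓ D))       ≡⟨ sym (*-assoc 2 (2 ^ List.length is) (7 + 2 * ℓ D)) ⟩
    2 ^ suc (List.length is) * (7 + 2 * ℓ D)       ∎
    where
    open ≤-Reasoning
    open +-*-Solver
    c = 6 + 2 * ℓ D
    L = List.length (conjunction P is)

  -- The factor 2 ^ b pays for a conjunction of `b` programs, and 18 = 16 + 2 bounds 16 + 2 * A ^ D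
  -- by 18 * A ^ D. Here 16 covers the additive constants of all gates, among them 7 for AND and 13
  -- for OR.
  programBase : ℕ → ℕ
  programBase b = 2 ^ b * 18

  length-gateProgram : ∀ {b} (g : Gate m) (bg : BoundedGate b g) (P : Fin m → Program n) (δs : Vec ℕ m) →
    (∀ i → List.length (P i) ≤ programBase b ^ Vec.lookup δs i) →
    List.length (gateProgram g bg P) ≤ programBase b ^ suc (List.foldr _⊔_ 0 (List.map (Vec.lookup δs) (fanIn g)))
  length-gateProgram {b = b} g bg P δs P≤ = helper g bg
    where
    open ≤-Reasoning
    open +-*-Solver
    A = programBase b
    instance
      A≢0 : NonZero A
      A≢0 = m*n≢0 (2 ^ b) 18 {{m^n≢0 2 b}}
    1≤A^ : ∀ D → 1 ≤ A ^ D
    1≤A^ D = m^n>0 A D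
    final : ∀ D l → l ≤ 2 ^ b * (16 + 2 * A ^ D) → l ≤ A ^ suc D
    final D l h = begin
      l                                  ≤⟨ h ⟩
      2 ^ b * (16 + 2 * A ^ D)           ≤⟨ *-monoʳ-≤ (2 ^ b) (+-monoˡ-≤ (2 * A ^ D) (*-monoʳ-≤ 16 (1≤A^ D))) ⟩
      2 ^ b * (16 * A ^ D + 2 * A ^ D)   ≡⟨ solve 2 (λ x y → x :* (con 16 :* y :+ con 2 :* y) := x :* con 18 :* y) refl (2 ^ b) (A ^ D) ⟩
      A ^ suc D                          ∎
    helper : (g : Gate _) (bg : BoundedGate b g) →
             List.length (gateProgram g bg P) ≤ A ^ suc (List.foldr _⊔_ 0 (List.map (Vec.lookup δs) (fanIn g)))
    helper (AND is) len = final D _ (begin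
      List.length (conjunction P is)                       ≤⟨ m≤m+n _ _ ⟩
      List.length (conjunction P is) + (6 + 2 * A ^ D)     ≤⟨ length-conjunction P δs (A ^_) (^-monoʳ-≤ A) P≤ D is ≤-refl ⟩
      2 ^ List.length is * (7 + 2 * A ^ D)                 ≤⟨ *-mono-≤ (^-monoʳ-≤ 2 len) (+-monoˡ-≤ (2 * A ^ D) (m≤m+n 7 9)) ⟩
      2 ^ b * (16 + 2 * A ^ D)                             ∎)
      where D = List.foldr _⊔_ 0 (List.map (Vec.lookup δs) is)
    helper (OR is) len = final D _ (begin
      List.length (notProgram Q)                           ≡⟨ length-notProgram Q ⟩
      3 + List.length Q                                    ≤⟨ ≤-trans (+-monoˡ-≤ (List.length Q) (m≤m+n 3 (3 + 2 * (3 + A ^ D)))) (≤-reflexive (+-comm _ (List.length Q))) ⟩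
      List.length Q + (6 + 2 * (3 + A ^ D))                ≤⟨ length-conjunction (notProgram ∘ P) δs (λ d → 3 + A ^ d) (λ d≤e → +-monoʳ-≤ 3 (^-monoʳ-≤ A d≤e))
                                                               (λ i → ≤-trans (≤-reflexive (length-notProgram (P i))) (+-monoʳ-≤ 3 (P≤ i))) D is ≤-refl ⟩
      2 ^ List.length is * (7 + 2 * (3 + A ^ D))           ≤⟨ *-mono-≤ (^-monoʳ-≤ 2 len) (≤-trans (≤-reflexive
                                                               (solve 1 (λ y → con 7 :+ con 2 :* (con 3 :+ y) := con 13 :+ con 2 :* y) refl (A ^ D))) (+-monoˡ-≤ (2 * A ^ D) (m≤m+n 13 3))) ⟩
      2 ^ b * (16 + 2 * A ^ D)                             ∎)
      where
      D = List.foldr _⊔_ 0 (List.map (Vec.lookup δs) is)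
      Q = conjunction (notProgram ∘ P) is
    helper (NOT i) _ = final D _ (begin
      List.length (notProgram (P i))     ≡⟨ length-notProgram (P i) ⟩
      3 + List.length (P i)              ≤⟨ +-monoʳ-≤ 3 (≤-trans (P≤ i) (^-monoʳ-≤ A (m≤m⊔n (Vec.lookup δs i) 0))) ⟩
      3 + A ^ D                          ≤⟨ +-mono-≤ (m≤m+n 3 13) (m≤m+n (A ^ D) _) ⟩
      16 + 2 * A ^ D                     ≤⟨ m≤n*m (16 + 2 * A ^ D) (2 ^ b) {{m^n≢0 2 b}} ⟩
      2 ^ b * (16 + 2 * A ^ D)           ∎)
      where D = Vec.lookup δs i ⊔ 0

  length-nodeProgram : ∀ {b} (C : Nodes n m) (bC : AllGates (BoundedGate b) C) i →
                       List.length (nodeProgram C bC i) ≤ programBase b ^ Vec.lookup (depths C) i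
  length-nodeProgram {n = n} {b = b} inputs _ i = m^n>0 (programBase b) {{m*n≢0 (2 ^ b) 18 {{m^n≢0 2 b}}}} (Vec.lookup (Vec.replicate n 0) i)
  length-nodeProgram (C ▷ g) (bg , bC) zero    = length-gateProgram g bg (nodeProgram C bC) (depths C) (length-nodeProgram C bC)
  length-nodeProgram (C ▷ g) (bg , bC) (suc i) = length-nodeProgram C bC i

  α≉ε : ¬ (α ≈ ε)
  α≉ε α≈ε with () ← α≈ε 0F

-- From a solution without chain of thought to TC⁰ circuits for NC¹

module WithoutChainOfThought where

  open import Algebra.Bundles using (Group)
  open import Data.Bool.Base using (Bool; true; false; if_then_else_)
  open import Data.Fin.Base as Fin using (Fin; suc)
  import Data.Fin.Properties as Fin
  open import Data.Fin.Permutation using (Permutation′; _⟨$⟩ʳ_)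
  open import Data.List.Base as List using (List; []; _∷_)
  open import Data.Nat.Base
  open import Data.Nat.Properties
  import Data.Vec.Properties as Vec
  open import Function.Bundles using (Injection; mk⇔; Equivalence)
  open import Relation.Nullary using (¬_; Dec; yes; no)
  open import Relation.Unary using (_∈_; _⊂_)
  open Formulas
  open FloatValues
  open Simulation
  open PolynomialBounds
  open Barrington

  open Group S₅ using (ε; _∙_; _≈_)

  private variable
    n d F : ℕ

  decides-bit : ∀ (i : Fin n) {A : Bool → Set} → (∀ b → Dec (A b)) → 1 ≤ F → Decides F (suc d) (λ w → A (Vec.lookup w i))
  decides-bit i {A} A? 1≤F with A? true | A? false
  ... | yes at | yes af = decides-map (λ w _ → always-true (Vec.lookup w i)) (λ _ _ → refl) (decides-const {A = 0 ≡ 0} (yes refl))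
    where
    always-true : ∀ b → A b
    always-true true  = at
    always-true false = af
  ... | no ¬at | no ¬af = decides-map {P = λ _ → ⊥} (λ _ ()) (λ w a → never (Vec.lookup w i) a) (decides-const (no id))
    where
    never : ∀ b → A b → ⊥
    never true  = ¬at
    never false = ¬af
  ... | yes at | no ¬af = decides-map (λ w eq → subst A (sym eq) at) (λ w a → only-true (Vec.lookup w i) a) (decides-input i)
    where
    only-true : ∀ b → A b → b ≡ true
    only-true true  a = refl
    only-true false a = ⊥-elim (¬af a)
  ... | no ¬at | yes af = decides-map {P = λ w → ¬ (Vec.lookup w i ≡ true)} (λ w ne → only-false (Vec.lookup w i) ne) (λ w a eq → ¬at (subst A eq a))
                            (decides-¬ 1≤F (decides-input i))
    where
    only-false : ∀ b → ¬ (b ≡ true) → A b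
    only-false true  ne = ⊥-elim (ne refl)
    only-false false ne = af

  decides-run : ∀ (x : Instruction n) {A : Permutation′ 5 → Set} → (∀ π → Dec (A π)) → 1 ≤ F → Decides F (suc d) (λ w → A (run w x))
  decides-run (always π)     A? 1≤F = decides-const (A? π)
  decides-run (branch i π ρ) A? 1≤F = decides-bit i (λ b → A? (if b then π else ρ)) 1≤F

  evaluate-fromList : ∀ (w : Vec Bool n) P → Vec.foldr′ _∙_ ε (Vec.map (run w) (Vec.fromList P)) ≡ evaluate w P
  evaluate-fromList w []      = refl
  evaluate-fromList w (x ∷ P) = cong (run w x ∙_) (evaluate-fromList w P)

  open _Realizes_

  module _ (𝒱 : Vocabulary) (𝔸 : ∀ p → FloatArithmetic p) where

    open Vocabulary 𝒱

    tokenize : ∀ {n m} (Q : Vec (Instruction n) m) → Vec Bool n → Vec (Fin (suc v)) m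
    tokenize Q w = Vec.map (Injection.to token) (Vec.map (run w) Q)

    lookup-tokenize : ∀ {n m} (Q : Vec (Instruction n) m) w i → Injection.to token (run w (Vec.lookup Q i)) ≡ Vec.lookup (tokenize Q w) i
    lookup-tokenize Q w i = sym (trans (Vec.lookup-map i (Injection.to token) (Vec.map (run w) Q))
      (cong (Injection.to token) (Vec.lookup-map i (run w) Q)))

    module _ {n m d F : ℕ} {f : Vec Bool n → Bool} (Q : Vec (Instruction n) m)
             (Q-f : ∀ w → Vec.foldr′ _∙_ ε (Vec.map (run w) Q) ≈ (α ^ᵇ f w))
             (M : Vec (Fin (suc v)) m → Fin (suc v)) (solves : Solves 𝒱 M) where

      solves-accept : ∀ w → f w ≡ false → M (tokenize Q w) ≡ accept
      solves-accept w eq = proj₁ (solves (Vec.map (run w) Q)) λ i → trans (Q-f w i) (cong (λ b → α ^ᵇ b ⟨$⟩ʳ i) eq)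

      solves-reject : ∀ w → f w ≡ true → M (tokenize Q w) ≡ reject
      solves-reject w eq = proj₂ (solves (Vec.map (run w) Q)) λ p≈ε →
        α≉ε λ i → trans (cong (λ b → α ^ᵇ b ⟨$⟩ʳ i) (sym eq)) (trans (sym (Q-f w i)) (p≈ε i))

      -- The product of the program is always `ε` or `α`, so the two clauses of `Solves` determine
      -- the output and testing for `accept` is enough.
      decides-realized : 1 ≤ F → Decides F d (λ w → M (tokenize Q w) ≡ accept) → Decides F (suc d) (λ w → f w ≡ true)
      decides-realized 1≤F D = decides-map to from (decides-¬ 1≤F D)
        where
        to : ∀ w → ¬ (M (tokenize Q w) ≡ accept) → f w ≡ true
        to w ¬acc with f w in eq
        ... | true  = refl
        ... | false = ⊥-elim (¬acc (solves-accept w eq))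

        from : ∀ w → f w ≡ true → ¬ (M (tokenize Q w) ≡ accept)
        from w eq acc = accept≢reject (trans (sym acc) (solves-reject w eq))

    totalSize : ℕ → ℕ → ℕ
    totalSize e l = e + (l + suc v)

    -- The sum of the four lower bounds on the fan-in. In the last of them `p` is enlarged to 2 ^ p,
    -- which makes the whole a polynomial in 2 ^ p and the two sizes.
    simulationWidth : (p e l : ℕ) → ℕ
    simulationWidth p e l = FloatCode.#floats p +
      (2 + ((3 + 4 * (suc (totalSize e l) * (2 + totalSize e l))) + (2 + (2 ^ p + (2 ^ p + 2 ^ p)))))

    poly-simulationWidth : ∀ {p e l : ℕ → ℕ} → PolynomiallyBounded (λ n → 2 ^ p n) → PolynomiallyBounded e → PolynomiallyBounded l →
                           PolynomiallyBounded (λ n → simulationWidth (p n) (e n) (l n))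
    poly-simulationWidth poly-E poly-e poly-l =
      poly-+ (poly-* (poly-* (poly-const 2) poly-E) (poly-* (poly-const 2) poly-E))
        (poly-+ (poly-const 2) (poly-+ (poly-+ (poly-const 3) (poly-* (poly-const 4) (poly-* (poly-+ (poly-const 1) poly-κ) (poly-+ (poly-const 2) poly-κ))))
          (poly-+ (poly-const 2) (poly-+ poly-E (poly-+ poly-E poly-E)))))
      where poly-κ = poly-+ poly-e (poly-+ poly-l (poly-const (suc v)))

    module _ (p e l : ℕ) where

      floats≤ : FloatCode.#floats p ≤ simulationWidth p e l
      floats≤ = m≤m+n _ _

      2≤ : 2 ≤ simulationWidth p e l
      2≤ = ≤-trans (m≤m+n 2 _) (m≤n+m _ (FloatCode.#floats p))

      sum≤ : 3 + 4 * (suc (totalSize e l) * (2 + totalSize e l)) ≤ simulationWidth p e l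
      sum≤ = ≤-trans (≤-trans (m≤m+n _ _) (m≤n+m _ 2)) (m≤n+m _ (FloatCode.#floats p))

      digits≤ : 2 + (p + (2 ^ p + 2 ^ p)) ≤ simulationWidth p e l
      digits≤ = ≤-trans (≤-trans (≤-trans (+-monoʳ-≤ 2 (+-monoˡ-≤ (2 ^ p + 2 ^ p) (n≤2^n p)))
        (m≤n+m _ (3 + 4 * (suc (totalSize e l) * (2 + totalSize e l))))) (m≤n+m _ 2)) (m≤n+m _ (FloatCode.#floats p))

    decides-solved : ∀ {n m} {f : Vec Bool n → Bool} (Q : Vec (Instruction n) (suc m)) →
      (∀ w → Vec.foldr′ _∙_ ε (Vec.map (run w) Q) ≈ (α ^ᵇ f w)) →
      ∀ {p e L n-max} (θ : Parameters p e L n-max v) (b : suc m ≤ n-max) → Solves 𝒱 (Model.MHM (𝔸 p) θ b) →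
      Decides (simulationWidth p e (suc m)) (suc (modelDepth L v)) (λ w → f w ≡ true)
    decides-solved {n} {m} Q Q-f {p} {e} θ b solved =
      decides-realized Q Q-f (Model.MHM (𝔸 p) θ b) solved (≤-trans (n≤1+n 1) (2≤ p e (suc m)))
        (decides-MHM θ b (m≤m+n e _) (≤-trans (m≤m+n (suc m) (suc v)) (m≤n+m _ e)) (≤-trans (m≤n+m _ (suc m)) (m≤n+m _ e)) (tokenize Q)
          (λ i A A? → decides-map (λ w → subst A (lookup-tokenize Q w i)) (λ w → subst A (sym (lookup-tokenize Q w i)))
            (decides-run (Vec.lookup Q i) {A = A ∘ Injection.to token} (A? ∘ Injection.to token) (≤-trans (n≤1+n 1) (2≤ p e (suc m)))))
          accept)
      where open Tracking (𝔸 p) {n} {simulationWidth p e (suc m)} {totalSize e (suc m)}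
                   (floats≤ p e (suc m)) (2≤ p e (suc m)) (sum≤ p e (suc m)) (digits≤ p e (suc m))

    module _ {L : ℕ} {e p : ℕ → ℕ} (poly-e : Polynomial e) (log-p : Logarithmic p)
             (solves : ∀ m → SolvesWithoutCoT 𝒱 𝔸 (p (suc m)) (e (suc m)) L m)
             {ℒ : Language} {C : CircuitFamily} {b : ℕ} (computes : Computes C ℒ)
             (log-depth : Logarithmic (λ n → depth (C n)))
             (bounded : ∀ n → AllGates (BoundedGate b) (Circuit.nodes (C n))) where

      private
        program : ∀ n → Program n
        program n = nodeProgram (Circuit.nodes (C n)) (bounded n) (Circuit.output (C n))

        l width : ℕ → ℕ
        l n     = suc (List.length (program n))
        width n = simulationWidth (p (l n)) (e (l n)) (l n)

        D : ℕ
        D = suc (modelDepth L v)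

        poly-l : PolynomiallyBounded l
        poly-l = poly-+ (poly-const 1)
          (poly-mono (λ n → length-nodeProgram (Circuit.nodes (C n)) (bounded n) (Circuit.output (C n))) (poly-exp (programBase b) log-depth))

        poly-width : PolynomiallyBounded width
        poly-width = poly-simulationWidth {p ∘ l} {e ∘ l} {l} (poly-∘ {g = l} (poly-2^ log-p) poly-l) (poly-∘ {g = l} (Polynomial⇒bounded poly-e) poly-l) poly-l

        decides-ℒ : ∀ n → Decides (width n) D (λ w → Vec.toList w ∈ ℒ)
        decides-ℒ n = decides-map (λ w → Equivalence.from (computes n w)) (λ w → Equivalence.to (computes n w))
          (let _ , θ , b , solved = solves (List.length (program n)) in
           -- The leading `always ε` leaves the product unchanged and makes the word nonempty, as
           -- the input of the model has to be.
           decides-solved {m = List.length (program n)} (Vec.fromList (always ε ∷ program n))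
             (λ w i → trans (cong (λ π → π ⟨$⟩ʳ i) (evaluate-fromList w (program n)))
               (evaluates (nodeProgram-realizes (Circuit.nodes (C n)) (bounded n) (Circuit.output (C n))) w i)) θ b solved)

        circuit : ∀ n → Σ[ C′ ∈ Circuit n ] (∀ w → eval C′ w ≡ Decides.function (decides-ℒ n) w) × size C′ ≤ formulaSize (width n) D × depth C′ ≤ D
        circuit n = formulaCircuit (Decides.formula (decides-ℒ n))

      solvesWithoutCoT⇒TC⁰ : TC⁰ ℒ
      solvesWithoutCoT⇒TC⁰ = (λ n → proj₁ (circuit n))
        , (λ n w → let _ , eq , _ = circuit n in
            mk⇔ (λ w∈ℒ → trans (eq w) (Decides.complete (decides-ℒ n) w w∈ℒ)) (λ h → Decides.sound (decides-ℒ n) w (trans (sym (eq w)) h)))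
        , bounded⇒Polynomial (poly-mono (λ n → let _ , _ , s , _ = circuit n in ≤-trans s (≤-trans (n≤1+n _) (formulaSize-bound (width n) D)))
            (poly-^ D (poly-+ (poly-const 2) poly-width)))
        , D , 0 , λ n _ → let _ , _ , _ , dp = circuit n in ≤-trans dp (≤-reflexive (sym (*-identityʳ _)))

    no-solution-without-CoT : TC⁰ ⊂ NC¹ →
      ¬ (∃[ L ] ∃[ d ] ∃[ p ] Polynomial d × Logarithmic p × (∀ m → SolvesWithoutCoT 𝒱 𝔸 (p (suc m)) (d (suc m)) L m))
    no-solution-without-CoT (_ , NC¹⊈TC⁰) (L , d , p , poly-d , log-p , solves) =
      NC¹⊈TC⁰ λ {ℒ} (C , b , computes , _ , log-depth , bounded) → solvesWithoutCoT⇒TC⁰ poly-d log-p solves {ℒ} computes log-depth bounded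

-- Exact arithmetic and the exponential at precision two

module ExactFloats where

  open import Data.Fin.Base using (zero; suc)
  open import Data.Integer.Base as ℤ using (ℤ; +_; -[1+_])
  import Data.Integer.Properties as ℤ
  open import Data.Nat.Base using (ℕ; zero; suc; _+_; _*_; _≤_; z≤n; s≤s; s≤s⁻¹)
  import Data.Nat.Properties as ℕ
  open import Data.Rational.Base as ℚ using (ℚ; 0ℚ; 1ℚ)
  import Data.Rational.Properties as ℚ
  import Data.Rational.Solver as ℚ
  open import Data.Unit.Base using (tt)
  open import Relation.Nullary.Decidable using (True; toWitness)
  open FloatValues

  2ℚ 3ℚ 6ℚ 24ℚ ¼ : ℚ
  2ℚ = + 2 ℚ./ 1
  3ℚ = + 3 ℚ./ 1
  6ℚ = + 6 ℚ./ 1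
  24ℚ = + 24 ℚ./ 1
  ¼ = + 1 ℚ./ 4

  expTerm₆ expSum₆ : ℕ → ℚ
  expTerm₆ = expTerm (ℚ.- 6ℚ)
  expSum₆  = expPartialSum (ℚ.- 6ℚ)

  -- From k = 11 on, every term is at most half of the previous one, so that this
  -- bound on all later partial sums decreases.
  tailBound : ℕ → ℚ
  tailBound k = ℚ.∣ expSum₆ k ∣ ℚ.+ (ℚ.∣ expTerm₆ k ∣ ℚ.+ ℚ.∣ expTerm₆ k ∣)

  -- exp(-6) is about 0.0025 and the term of index 20 about 0.0015 in magnitude, which leaves ample
  -- room below 1/64.
  tailBound-20 : tailBound 20 ℚ.≤ + 1 ℚ./ 64
  tailBound-20 = toWitness {a? = tailBound 20 ℚ.≤? + 1 ℚ./ 64} tt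

  12/k≤1 : ∀ k → 12 ≤ suc k → fromℕ′ 12 ℚ.* (+ 1 ℚ./ suc k) ℚ.≤ 1ℚ
  12/k≤1 k 12≤k = begin
    fromℕ′ 12 ℚ.* (+ 1 ℚ./ suc k)            ≤⟨ ℚ.*-monoʳ-≤-nonNeg (+ 1 ℚ./ suc k) {{ℚ.normalize-nonNeg 1 (suc k)}} (fromℤ-mono-≤ (ℤ.+≤+ 12≤k)) ⟩
    fromℕ′ (suc k) ℚ.* (+ 1 ℚ./ suc k)       ≡⟨ ℚ.*-comm (fromℕ′ (suc k)) (+ 1 ℚ./ suc k) ⟩
    (+ 1 ℚ./ suc k) ℚ.* fromℕ′ (suc k)       ≡⟨ cong (λ m → (+ 1 ℚ./ suc k) ℚ.* fromℕ′ m) (sym (ℕ.*-identityʳ (suc k))) ⟩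
    (+ 1 ℚ./ suc k) ℚ.* fromℕ′ (suc k * 1)   ≡⟨ fromℤ-*-/ (+ 1) 1 k ⟩
    1ℚ                                       ∎
    where open ℚ.≤-Reasoning

  expTerm-halves : ∀ k → 12 ≤ suc k → ℚ.∣ expTerm₆ (suc k) ∣ ℚ.+ ℚ.∣ expTerm₆ (suc k) ∣ ℚ.≤ ℚ.∣ expTerm₆ k ∣
  expTerm-halves k 12≤k = begin
    ℚ.∣ t ℚ.* ℚ.- 6ℚ ℚ.* c ∣ ℚ.+ ℚ.∣ t ℚ.* ℚ.- 6ℚ ℚ.* c ∣      ≡⟨ cong (λ x → x ℚ.+ x) abs ⟩
    ℚ.∣ t ∣ ℚ.* 6ℚ ℚ.* c ℚ.+ ℚ.∣ t ∣ ℚ.* 6ℚ ℚ.* c              ≡⟨ solve 3 (λ t s c → t :* s :* c :+ t :* s :* c := t :* ((s :+ s) :* c)) refl ℚ.∣ t ∣ 6ℚ c ⟩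
    ℚ.∣ t ∣ ℚ.* (fromℕ′ 12 ℚ.* c)                              ≤⟨ ℚ.*-monoˡ-≤-nonNeg ℚ.∣ t ∣ {{ℚ.∣-∣-nonNeg t}} (12/k≤1 k 12≤k) ⟩
    ℚ.∣ t ∣ ℚ.* 1ℚ                                            ≡⟨ ℚ.*-identityʳ ℚ.∣ t ∣ ⟩
    ℚ.∣ t ∣                                                   ∎
    where
    open ℚ.≤-Reasoning
    open ℚ.+-*-Solver using (solve; _:+_; _:*_; _:-_; :-_; _:=_)
    t = expTerm₆ k
    c = + 1 ℚ./ suc k
    abs : ℚ.∣ t ℚ.* ℚ.- 6ℚ ℚ.* c ∣ ≡ ℚ.∣ t ∣ ℚ.* 6ℚ ℚ.* c
    abs = trans (ℚ.∣p*q∣≡∣p∣*∣q∣ (t ℚ.* ℚ.- 6ℚ) c) (cong₂ ℚ._*_ (ℚ.∣p*q∣≡∣p∣*∣q∣ t (ℚ.- 6ℚ))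
      (ℚ.0≤p⇒∣p∣≡p (ℚ.nonNegative⁻¹ c {{ℚ.normalize-nonNeg 1 (suc k)}})))

  tailBound-suc : ∀ k → 12 ≤ suc k → tailBound (suc k) ℚ.≤ tailBound k
  tailBound-suc k 12≤k = begin
    ℚ.∣ expSum₆ k ℚ.+ t ∣ ℚ.+ (ℚ.∣ expTerm₆ (suc k) ∣ ℚ.+ ℚ.∣ expTerm₆ (suc k) ∣)  ≤⟨ ℚ.+-mono-≤ (ℚ.∣p+q∣≤∣p∣+∣q∣ (expSum₆ k) t) (expTerm-halves k 12≤k) ⟩
    (ℚ.∣ expSum₆ k ∣ ℚ.+ ℚ.∣ t ∣) ℚ.+ ℚ.∣ t ∣                                       ≡⟨ ℚ.+-assoc ℚ.∣ expSum₆ k ∣ ℚ.∣ t ∣ ℚ.∣ t ∣ ⟩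
    tailBound k                                                                   ∎
    where
    open ℚ.≤-Reasoning
    t = expTerm₆ k

  ∣expSum₆∣≤ : ∀ j → ℚ.∣ expSum₆ (j + 20) ∣ ℚ.≤ + 1 ℚ./ 64
  ∣expSum₆∣≤ j = ℚ.≤-trans (ℚ.≤-trans (ℚ.≤-reflexive (sym (ℚ.+-identityʳ _)))
      (ℚ.+-monoʳ-≤ ℚ.∣ expSum₆ (j + 20) ∣ (ℚ.+-mono-≤ (ℚ.0≤∣p∣ (expTerm₆ (j + 20))) (ℚ.0≤∣p∣ (expTerm₆ (j + 20)))))) (tail≤ j)
    where
    tail≤ : ∀ j → tailBound (j + 20) ℚ.≤ + 1 ℚ./ 64
    tail≤ zero    = tailBound-20
    tail≤ (suc j) = ℚ.≤-trans (tailBound-suc (j + 20) (ℕ.≤-trans (ℕ.m≤m+n 12 8) (ℕ.≤-trans (ℕ.m≤n+m 20 j) (ℕ.n≤1+n _)))) (tail≤ j)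

  open FloatCode 2 using (scaled; unit; value-scaled′; shift; shift<; exponentRange; significandRange; ∣significand∣<; significandRange?; exponentRange?)

  -- Significands below 4 and shifted exponents below 8 give at most 3 * 2 ^ 7, which is 24 in units
  -- of 1/16.
  ∣scaled∣≤384 : ∀ (a : Float 2) → ℤ.∣ scaled a ∣ ≤ 384
  ∣scaled∣≤384 a = ℕ.≤-trans (ℕ.≤-reflexive (ℤ.abs-* (Float.significand a) _))
    (ℕ.*-mono-≤ {ℤ.∣ Float.significand a ∣} {3} (s≤s⁻¹ (∣significand∣< (significandRange a)))
      (ℕ.^-monoʳ-≤ 2 {shift (Float.exponent a)} {7} (s≤s⁻¹ (shift< (exponentRange a)))))

  -∣i∣≤i : ∀ i → ℤ.- (+ ℤ.∣ i ∣) ℤ.≤ i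
  -∣i∣≤i (+ n)    = ℤ.neg-≤-pos
  -∣i∣≤i -[1+ n ] = ℤ.≤-refl

  min-value : ∀ (a : Float 2) → ℚ.- 24ℚ ℚ.≤ ⟦ a ⟧
  min-value a = begin
    ℚ.- 24ℚ                     ≡⟨⟩
    fromℤ (ℤ.- (+ 384)) ℚ.* unit ≤⟨ ℚ.*-monoʳ-≤-nonNeg unit (fromℤ-mono-≤ (ℤ.≤-trans (ℤ.neg-mono-≤ (ℤ.+≤+ (∣scaled∣≤384 a))) (-∣i∣≤i (scaled a)))) ⟩
    fromℤ (scaled a) ℚ.* unit   ≡⟨ sym (value-scaled′ a) ⟩
    ⟦ a ⟧                       ∎
    where open ℚ.≤-Reasoning

  1≤∣fromℤ∣ : ∀ i → i ≡ + 0 ⊎ 1ℚ ℚ.≤ ℚ.∣ fromℤ i ∣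
  1≤∣fromℤ∣ (+ zero)  = inj₁ refl
  1≤∣fromℤ∣ (+ suc n) = inj₂ (ℚ.≤-trans (fromℤ-mono-≤ {+ 1} {+ suc n} (ℤ.+≤+ (s≤s z≤n))) (p≤∣p∣ (fromℤ (+ suc n))))
  1≤∣fromℤ∣ -[1+ n ]  = inj₂ (ℚ.≤-trans (fromℤ-mono-≤ {+ 1} {+ suc n} (ℤ.+≤+ (s≤s z≤n))) (ℚ.≤-trans (p≤∣p∣ (fromℤ (+ suc n)))
    (ℚ.≤-reflexive (sym (ℚ.∣-p∣≡∣p∣ (fromℤ (+ suc n)))))))

  min-positive : ∀ (a : Float 2) → ⟦ a ⟧ ≡ 0ℚ ⊎ + 1 ℚ./ 16 ℚ.≤ ℚ.∣ ⟦ a ⟧ ∣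
  min-positive a with 1≤∣fromℤ∣ (scaled a)
  ... | inj₁ eq = inj₁ (trans (value-scaled′ a) (trans (cong (λ i → fromℤ i ℚ.* unit) eq) (ℚ.*-zeroˡ unit)))
  ... | inj₂ h  = inj₂ (begin
      + 1 ℚ./ 16                          ≡⟨ refl ⟩
      1ℚ ℚ.* unit                         ≤⟨ ℚ.*-monoʳ-≤-nonNeg unit h ⟩
      ℚ.∣ fromℤ (scaled a) ∣ ℚ.* ℚ.∣ unit ∣ ≡⟨ sym (ℚ.∣p*q∣≡∣p∣*∣q∣ (fromℤ (scaled a)) unit) ⟩
      ℚ.∣ fromℤ (scaled a) ℚ.* unit ∣      ≡⟨ cong ℚ.∣_∣ (sym (value-scaled′ a)) ⟩
      ℚ.∣ ⟦ a ⟧ ∣                          ∎)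
    where open ℚ.≤-Reasoning

  mkFloat : (s e : ℤ) → {True (significandRange? s)} → {True (exponentRange? e)} → Float 2
  mkFloat s e {p} {q} = ⟨ s , e ⟩ {toWitness p} {toWitness q}

  zeroF oneF halfF quarterF twoF fourF -1F -3F -6F -24F : Float 2
  zeroF    = mkFloat (+ 0) (+ 0)
  oneF     = mkFloat (+ 2) (ℤ.- (+ 1))
  halfF    = mkFloat (+ 2) (ℤ.- (+ 2))
  quarterF = mkFloat (+ 2) (ℤ.- (+ 3))
  twoF     = mkFloat (+ 2) (+ 0)
  fourF    = mkFloat (+ 2) (+ 1)
  -1F      = mkFloat (ℤ.- (+ 2)) (ℤ.- (+ 1))
  -3F      = mkFloat (ℤ.- (+ 3)) (+ 0)
  -6F      = mkFloat (ℤ.- (+ 3)) (+ 1)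
  -24F     = mkFloat (ℤ.- (+ 3)) (+ 3)

  Representable : ℚ → Set
  Representable q = ∃[ r ] q ≡ ⟦_⟧ {2} r

  module Exact (𝔸 : FloatArithmetic 2) where

    open FloatArithmetic 𝔸

    round-representable : ∀ {q} → Representable q → ⟦ round q ⟧ ≡ q
    round-representable (r , eq) = round-exact 𝔸 r eq

    round-saturates : ∀ {q} → q ℚ.≤ ℚ.- 24ℚ → ⟦ round q ⟧ ≡ ℚ.- 24ℚ
    round-saturates {q} q≤ = ℚ.≤-antisym
      (ℚ.≤-trans (round-mono-≤ 𝔸 q≤) (ℚ.≤-reflexive (round-representable (-24F , refl)))) (min-value (round q))

    exp-at-0 : ∀ x → ⟦ x ⟧ ≡ 0ℚ → ⟦ exp x ⟧ ≡ 1ℚ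
    exp-at-0 = exp-zero 𝔸

    -- A nonzero result would have magnitude at least 1/16. Comparison with the candidate 0 at
    -- tolerance 1/64 keeps the result within 2/64 of a partial sum that is itself at most 1/64,
    -- hence below 1/16.
    exp-at-−6 : ∀ x → ⟦ x ⟧ ≡ ℚ.- 6ℚ → ⟦ exp x ⟧ ≡ 0ℚ
    exp-at-−6 x x≡-6 with min-positive (exp x)
    ... | inj₁ eq = eq
    ... | inj₂ h with K , close ← exp-nearest x zeroF (+ 1 ℚ./ 64) (ℚ.positive⁻¹ (+ 1 ℚ./ 64)) =
      ⊥-elim (ℚ<⇒≱ {+ 3 ℚ./ 64} {+ 1 ℚ./ 16} (toWitness {a? = + 3 ℚ./ 64 ℚ.<? + 1 ℚ./ 16} tt) (begin
        + 1 ℚ./ 16                              ≤⟨ h ⟩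
        ℚ.∣ r ∣                                 ≡⟨ cong ℚ.∣_∣ (solve 2 (λ a r → r := (r :- a) :+ a) refl a r) ⟩
        ℚ.∣ (r ℚ.- a) ℚ.+ a ∣                    ≤⟨ ℚ.∣p+q∣≤∣p∣+∣q∣ (r ℚ.- a) a ⟩
        ℚ.∣ r ℚ.- a ∣ ℚ.+ ℚ.∣ a ∣                ≡⟨ cong (ℚ._+ ℚ.∣ a ∣) (∣p-q∣≡∣q-p∣ r a) ⟩
        ℚ.∣ a ℚ.- r ∣ ℚ.+ ℚ.∣ a ∣                ≤⟨ ℚ.+-mono-≤ a-r≤ a≤ ⟩
        (+ 1 ℚ./ 64 ℚ.+ + 1 ℚ./ 64) ℚ.+ + 1 ℚ./ 64 ≡⟨⟩
        + 3 ℚ./ 64                              ∎))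
      where
      open ℚ.≤-Reasoning
      open ℚ.+-*-Solver using (solve; _:+_; _:*_; _:-_; :-_; _:=_)
      k = K + 20
      a r : ℚ
      a = expSum₆ k
      r = ⟦ exp x ⟧
      a≤ : ℚ.∣ a ∣ ℚ.≤ + 1 ℚ./ 64
      a≤ = ∣expSum₆∣≤ K
      a-r≤ : ℚ.∣ a ℚ.- r ∣ ℚ.≤ + 1 ℚ./ 64 ℚ.+ + 1 ℚ./ 64
      a-r≤ = ℚ.≤-trans (subst (λ q → ℚ.∣ expPartialSum q k ℚ.- r ∣ ℚ.≤ ℚ.∣ expPartialSum q k ℚ.- 0ℚ ∣ ℚ.+ + 1 ℚ./ 64) x≡-6 (close k (ℕ.m≤m+n K 20)))
        (ℚ.+-monoˡ-≤ (+ 1 ℚ./ 64) (ℚ.≤-trans (ℚ.≤-reflexive (cong ℚ.∣_∣ (ℚ.+-identityʳ a))) a≤))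

-- Hopfield layers acting exactly on bits

module BitNetworks where

  open import Data.Bool.Base using (Bool; true; false; if_then_else_; _∧_)
  open import Data.Fin.Base as Fin using (Fin; zero; suc)
  import Data.Fin.Properties as Fin
  open import Data.Integer.Base as ℤ using (ℤ; +_)
  open import Data.List.Base as List using (List; []; _∷_)
  open import Data.List.Relation.Unary.Any as Any using (Any)
  open import Data.Nat.Base as ℕ using (ℕ; zero; suc; _∸_)
  open import Data.Rational.Base as ℚ using (ℚ; 0ℚ; 1ℚ; ½)
  import Data.Rational.Properties as ℚ
  import Data.Rational.Solver as ℚ
  open import Data.Unit.Base using (tt)
  open import Relation.Nullary using (Dec; yes; no; does)
  open import Relation.Nullary.Decidable using (toWitness; map′; _×-dec_; dec-true; dec-false)
  import Algebra.Properties.CommutativeMonoid.Sum as CommutativeMonoidSum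
  open FloatValues
  open ExactFloats

  module ℚSum = CommutativeMonoidSum ℚ.+-0-commutativeMonoid

  ∀Bool? : {P : Bool → Set} → (∀ b → Dec (P b)) → Dec (∀ b → P b)
  ∀Bool? P? = map′ (λ { (p , q) true → p ; (p , q) false → q }) (λ h → h true , h false) (P? true ×-dec P? false)

  -- These floats cover the exact results that occur for Boolean inputs. Membership in a finite list
  -- is decidable, so that exactness of an operation can be checked by evaluating it on all
  -- Booleans.
  smallFloats : List (Float 2)
  smallFloats = zeroF ∷ halfF ∷ oneF ∷ twoF ∷ mkFloat (+ 3) (+ 0) ∷ fourF ∷ -1F ∷ mkFloat (ℤ.- (+ 2)) (+ 0) ∷ -3F ∷ -6F ∷ -24F ∷ []

  Small : ℚ → Set
  Small q = Any (λ r → q ≡ ⟦ r ⟧) smallFloats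

  small? : ∀ q → Dec (Small q)
  small? q = Any.any? (λ r → q ℚ.≟ ⟦ r ⟧) smallFloats

  small⇒representable : ∀ {q} → Small q → Representable q
  small⇒representable = Any.satisfied

  bit : Bool → ℚ
  bit true  = 1ℚ
  bit false = 0ℚ

  bitℕ : Bool → ℕ
  bitℕ true  = 1
  bitℕ false = 0

  δ : ∀ {n} → Fin n → Fin n → ℚ
  δ i j = bit (does (i Fin.≟ j))

  δ-refl : ∀ {n} (i : Fin n) → δ i i ≡ 1ℚ
  δ-refl i = cong bit (dec-true (i Fin.≟ i) refl)

  δ-≢ : ∀ {n} {i j : Fin n} → i ≢ j → δ i j ≡ 0ℚ
  δ-≢ {i = i} {j} i≢j = cong bit (dec-false (i Fin.≟ j) i≢j)

  δ-sym : ∀ {n} (i j : Fin n) → δ i j ≡ δ j i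
  δ-sym i j with i Fin.≟ j
  ... | yes refl = sym (δ-refl i)
  ... | no i≢j   = sym (δ-≢ (i≢j ∘ sym))

  sum-zero : ∀ {n} (f : Fin n → ℚ) → (∀ i → f i ≡ 0ℚ) → ℚSum.sum f ≡ 0ℚ
  sum-zero {zero}  f h = refl
  sum-zero {suc n} f h = cong₂ ℚ._+_ (h zero) (sum-zero (f ∘ suc) (h ∘ suc))

  sum-δ : ∀ {n} (f : Fin n → ℚ) i → ℚSum.sum (λ j → f j ℚ.* δ i j) ≡ f i
  sum-δ {suc n} f zero    = trans (cong₂ ℚ._+_ (ℚ.*-identityʳ (f zero)) (sum-zero (λ j → f (suc j) ℚ.* 0ℚ) (λ j → ℚ.*-zeroʳ (f (suc j))))) (ℚ.+-identityʳ (f zero))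
  sum-δ {suc n} f (suc i) = trans (cong₂ ℚ._+_ (ℚ.*-zeroʳ (f zero)) (sum-δ (f ∘ suc) i)) (ℚ.+-identityˡ (f (suc i)))

  sum-≤0 : ∀ {n} (f : Fin n → ℚ) → (∀ i → f i ℚ.≤ 0ℚ) → ℚSum.sum f ℚ.≤ 0ℚ
  sum-≤0 {zero}  f h = ℚ.≤-refl
  sum-≤0 {suc n} f h = ℚ.+-mono-≤ (h zero) (sum-≤0 (f ∘ suc) (h ∘ suc))

  sum-≤ : ∀ {n} (f : Fin n → ℚ) → (∀ i → f i ℚ.≤ 0ℚ) → ∀ i → ℚSum.sum f ℚ.≤ f i
  sum-≤ {suc n} f h zero    = ℚ.≤-trans (ℚ.+-monoʳ-≤ (f zero) (sum-≤0 (f ∘ suc) (h ∘ suc))) (ℚ.≤-reflexive (ℚ.+-identityʳ (f zero)))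
  sum-≤ {suc n} f h (suc i) = ℚ.≤-trans (ℚ.+-mono-≤ (h zero) (sum-≤ (f ∘ suc) (h ∘ suc) i)) (ℚ.≤-reflexive (ℚ.+-identityˡ (f (suc i))))

  bitF : Bool → Float 2
  bitF b = if b then oneF else zeroF

  bitF-value : ∀ b → ⟦ bitF b ⟧ ≡ bit b
  bitF-value true  = refl
  bitF-value false = refl

  identity : ∀ {e} → Matrix (Float 2) e e
  identity x y = bitF (does (x Fin.≟ y))

  identity-value : ∀ {e} (x y : Fin e) → ⟦ identity x y ⟧ ≡ δ x y
  identity-value x y = bitF-value (does (x Fin.≟ y))

  mean : Bool → Bool → ℚ
  mean p q = ½ ℚ.* (bit p ℚ.+ bit q)

  -- A query clashes with a key when some active coordinate is set in the key and
  -- its swap in the query.  Each clash contributes -24, the least float, so every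
  -- clashing score saturates to -24 and becomes -6 after scaling by β = 1/4, where
  -- exp rounds to 0; without a clash the score is 0.  Hidden unit u compares the
  -- number of set coordinates among left u and right u with a threshold.
  record Specification (e : ℕ) : Set where
    field
      swap       : Fin e → Fin e
      active     : Fin e → Bool
      left right : Fin e → Fin e
      high       : Fin e → Bool

    threshold : Fin e → ℕ
    threshold u = if high u then 3 else 1

  queryEntry : Bool → Bool → Float 2
  queryEntry a s = if a ∧ s then -24F else zeroF

  -- Weight 2 undoes the factor ½ of `mean`, so that the preactivation counts set bits; a coordinate
  -- that is both left and right source counts twice and gets weight 4.
  unitEntry : Bool → Bool → Float 2
  unitEntry true  true  = fourF
  unitEntry true  false = twoF
  unitEntry false true  = twoF
  unitEntry false false = zeroF

  specifiedLayer : ∀ {e} → Specification e → Layer 2 e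
  specifiedLayer S = record
    { β      = quarterF
    ; β>0    = ℚ.positive⁻¹ ⟦ quarterF ⟧
    ; W-Q    = λ x y → queryEntry (active y) (does (swap y Fin.≟ x))
    ; W-K    = identity
    ; values = standalone identity
    ; W₁     = λ u x → unitEntry (does (left u Fin.≟ x)) (does (right u Fin.≟ x))
    ; W₂     = identity
    ; b₁     = λ u → if high u then -3F else -1F
    ; b₂     = λ _ → zeroF
    }
    where open Specification S

  module Network (𝔸 : FloatArithmetic 2) where

    open FloatArithmetic 𝔸
    open Model 𝔸
    open Exact 𝔸

    private
      small : ∀ {q} → Small q → ⟦ round q ⟧ ≡ q
      small = round-representable ∘ small⇒representable

    -- Representable products survive their own rounding, which leaves only the rounding of the sum.
    dot-value : ∀ {n} {xs ys : Vector (Float 2) n} (c : Fin n → ℚ) → (∀ k → ⟦ xs k ⟧ ℚ.* ⟦ ys k ⟧ ≡ c k) →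
                (∀ k → Representable (c k)) → ⟦ Model.dot 𝔸 xs ys ⟧ ≡ ⟦ round (ℚSum.sum c) ⟧
    dot-value c eq rep = cong (⟦_⟧ ∘ round) (ℚSum.sum-cong-≗ (λ k → trans (cong (⟦_⟧ ∘ round) (eq k)) (round-representable (rep k))))

    dot-unit : ∀ {n} (xs ys : Vector (Float 2) n) j → (∀ k → ⟦ ys k ⟧ ≡ δ j k) → ⟦ dot xs ys ⟧ ≡ ⟦ xs j ⟧
    dot-unit xs ys j h = trans (dot-value {xs = xs} {ys} (λ k → ⟦ xs k ⟧ ℚ.* δ j k) (λ k → cong (⟦ xs k ⟧ ℚ.*_) (h k)) (λ k → rep ⟦ xs k ⟧ (xs k , refl) (does (j Fin.≟ k))))
        (trans (cong (⟦_⟧ ∘ round) (sum-δ (λ k → ⟦ xs k ⟧) j)) (round-representable (xs j , refl)))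
      where
      rep : ∀ q → Representable q → ∀ b → Representable (q ℚ.* bit b)
      rep q (r , eq) true  = r , trans (ℚ.*-identityʳ q) eq
      rep q (r , eq) false = zeroF , ℚ.*-zeroʳ q

    dot-comm : ∀ {n} (xs ys : Vector (Float 2) n) → ⟦ dot xs ys ⟧ ≡ ⟦ dot ys xs ⟧
    dot-comm xs ys = cong (⟦_⟧ ∘ round) (ℚSum.sum-cong-≗ (λ k → cong (⟦_⟧ ∘ round) (ℚ.*-comm ⟦ xs k ⟧ ⟦ ys k ⟧)))

    ⊘-value : ∀ x y {c} r → r ℚ.* c ≡ ⟦ x ⟧ → ⟦ y ⟧ ≡ c → c ≢ 0ℚ → Representable r → ⟦ x ⊘ y ⟧ ≡ r
    ⊘-value x y r eq refl c≢0 rep with ⟦ y ⟧ ℚ.≟ 0ℚ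
    ... | yes c≡0 = ⊥-elim (c≢0 c≡0)
    ... | no  y≢0 = trans (cong (⟦_⟧ ∘ round) quotient) (round-representable rep)
      where
      instance _ = ℚ.≢-nonZero y≢0
      quotient : (⟦ x ⟧ ℚ.÷ ⟦ y ⟧) ≡ r
      quotient = trans (cong (ℚ._* ℚ.1/ ⟦ y ⟧) (sym eq)) (trans (ℚ.*-assoc r ⟦ y ⟧ (ℚ.1/ ⟦ y ⟧))
        (trans (cong (r ℚ.*_) (ℚ.*-inverseʳ ⟦ y ⟧)) (ℚ.*-identityʳ r)))

    module _ {n} (s : Vector (Float 2) n) (a a′ : Fin n)
             (scores : ∀ j → ((j ≡ a ⊎ j ≡ a′) × ⟦ s j ⟧ ≡ 0ℚ) ⊎ ((j ≢ a × j ≢ a′) × ⟦ s j ⟧ ≡ ℚ.- 6ℚ)) where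

      private
        mean-small : ∀ p q → Small (mean p q)
        mean-small = toWitness {a? = ∀Bool? λ p → ∀Bool? λ q → small? (mean p q)} tt

        exp-equal : a ≡ a′ → ∀ j → ⟦ exp (s j) ⟧ ≡ δ a j
        exp-equal refl j with scores j
        ... | inj₁ (inj₁ refl , s≡) = trans (exp-at-0 (s j) s≡) (sym (δ-refl j))
        ... | inj₁ (inj₂ refl , s≡) = trans (exp-at-0 (s j) s≡) (sym (δ-refl j))
        ... | inj₂ ((j≢a , _) , s≡) = trans (exp-at-−6 (s j) s≡) (sym (δ-≢ (j≢a ∘ sym)))

        exp-distinct : a ≢ a′ → ∀ j → ⟦ exp (s j) ⟧ ≡ δ a j ℚ.+ δ a′ j
        exp-distinct a≢a′ j with scores j
        ... | inj₁ (inj₁ refl , s≡) = trans (exp-at-0 (s j) s≡) (sym (cong₂ ℚ._+_ (δ-refl j) (δ-≢ (a≢a′ ∘ sym))))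
        ... | inj₁ (inj₂ refl , s≡) = trans (exp-at-0 (s j) s≡) (sym (cong₂ ℚ._+_ (δ-≢ a≢a′) (δ-refl j)))
        ... | inj₂ ((j≢a , j≢a′) , s≡) = trans (exp-at-−6 (s j) s≡) (sym (cong₂ ℚ._+_ (δ-≢ (j≢a ∘ sym)) (δ-≢ (j≢a′ ∘ sym))))

        ∑δ : ∀ (i : Fin n) → ℚSum.sum (δ i) ≡ 1ℚ
        ∑δ i = trans (ℚSum.sum-cong-≗ (λ j → sym (ℚ.*-identityˡ (δ i j)))) (sum-δ (λ _ → 1ℚ) i)

        total : ∀ {f : Fin n → ℚ} {q} → (∀ j → ⟦ exp (s j) ⟧ ≡ f j) → ℚSum.sum f ≡ q → Small q → ⟦ sum (exp ∘ s) ⟧ ≡ q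
        total eq sum-f q-small = trans (cong (⟦_⟧ ∘ round) (trans (ℚSum.sum-cong-≗ eq) sum-f)) (small q-small)

        halve-equal : ∀ p → mean p p ℚ.* 1ℚ ≡ bit p
        halve-equal = toWitness {a? = ∀Bool? λ p → mean p p ℚ.* 1ℚ ℚ.≟ bit p} tt

        halve-distinct : ∀ p q → mean p q ℚ.* 2ℚ ≡ bit p ℚ.+ bit q
        halve-distinct = toWitness {a? = ∀Bool? λ p → ∀Bool? λ q → mean p q ℚ.* 2ℚ ℚ.≟ bit p ℚ.+ bit q} tt

      -- The exponentials are exactly 1 at the attended positions and 0 elsewhere. Their total is 1
      -- or 2, according to whether `a` and `a′` coincide, and `mean` describes both cases.
      softmax-value : ∀ j → ⟦ Model.softmax 𝔸 s j ⟧ ≡ mean (does (a Fin.≟ j)) (does (a′ Fin.≟ j))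
      softmax-value j with a Fin.≟ a′
      ... | yes refl = ⊘-value (exp (s j)) (sum (exp ∘ s)) (mean p p) (trans (halve-equal p) (sym (exp-equal refl j)))
                         (total (exp-equal refl) (∑δ a) (toWitness {a? = small? 1ℚ} tt)) (λ ()) (small⇒representable (mean-small p p))
        where p = does (a Fin.≟ j)
      ... | no a≢a′  = ⊘-value (exp (s j)) (sum (exp ∘ s)) (mean p p′) (trans (halve-distinct p p′) (sym (exp-distinct a≢a′ j)))
                         (total (exp-distinct a≢a′) (trans (ℚSum.∑-distrib-+ (δ a) (δ a′)) (cong₂ ℚ._+_ (∑δ a) (∑δ a′))) (toWitness {a? = small? 2ℚ} tt))
                         (λ ()) (small⇒representable (mean-small p p′))
        where
        p  = does (a Fin.≟ j)
        p′ = does (a′ Fin.≟ j)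

    module _ {n e} (S : Specification e) (h : Matrix (Float 2) n e) (H : Fin n → Fin e → Bool)
             (h≡H : ∀ i x → ⟦ h i x ⟧ ≡ bit (H i x)) where

      open Specification S
      open Layer (specifiedLayer S) using (W-Q; W-K)

      clash : Fin n → Fin n → Fin e → Bool
      clash i j y = (active y ∧ H i (swap y)) ∧ H j y

      record Attends (i a a′ : Fin n) : Set where
        field attends : ∀ j → ((j ≡ a ⊎ j ≡ a′) × (∀ y → clash i j y ≡ false))
                            ⊎ ((j ≢ a × j ≢ a′) × ∃[ y ] clash i j y ≡ true)

      open Attends

      private
        queryTerm : Bool → Bool → Bool → ℚ
        queryTerm a b s = (bit (a ∧ b) ℚ.* ℚ.- 24ℚ) ℚ.* bit s

        queryTerm-value : ∀ a b s → bit b ℚ.* ⟦ queryEntry a s ⟧ ≡ queryTerm a b s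
        queryTerm-value = toWitness {a? = ∀Bool? λ a → ∀Bool? λ b → ∀Bool? λ s → _ ℚ.≟ queryTerm a b s} tt

        queryTerm-small : ∀ a b s → Small (queryTerm a b s)
        queryTerm-small = toWitness {a? = ∀Bool? λ a → ∀Bool? λ b → ∀Bool? λ s → small? (queryTerm a b s)} tt

        query-small : ∀ b → Small (bit b ℚ.* ℚ.- 24ℚ)
        query-small = toWitness {a? = ∀Bool? λ b → small? (bit b ℚ.* ℚ.- 24ℚ)} tt

        query-value : ∀ i y → ⟦ (h · W-Q) i y ⟧ ≡ bit (active y ∧ H i (swap y)) ℚ.* ℚ.- 24ℚ
        query-value i y = trans
          (dot-value {xs = h i} {ys = λ x → W-Q x y} (λ x → queryTerm (active y) (H i x) (does (swap y Fin.≟ x)))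
            (λ x → trans (cong (ℚ._* ⟦ W-Q x y ⟧) (h≡H i x)) (queryTerm-value (active y) (H i x) (does (swap y Fin.≟ x))))
            (λ x → small⇒representable (queryTerm-small (active y) (H i x) (does (swap y Fin.≟ x)))))
          (trans (cong (⟦_⟧ ∘ round) (sum-δ (λ x → bit (active y ∧ H i x) ℚ.* ℚ.- 24ℚ) (swap y))) (small (query-small (active y ∧ H i (swap y)))))

        query′-value : ∀ i y → ⟦ (h · W-Q · W-K ᵀ) i y ⟧ ≡ bit (active y ∧ H i (swap y)) ℚ.* ℚ.- 24ℚ
        query′-value i y = trans (dot-unit ((h · W-Q) i) (λ x → W-K y x) y (identity-value y)) (query-value i y)

        scoreTerm-value : ∀ b b′ → (bit b ℚ.* ℚ.- 24ℚ) ℚ.* bit b′ ≡ bit (b ∧ b′) ℚ.* ℚ.- 24ℚ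
        scoreTerm-value = toWitness {a? = ∀Bool? λ b → ∀Bool? λ b′ → (bit b ℚ.* ℚ.- 24ℚ) ℚ.* bit b′ ℚ.≟ bit (b ∧ b′) ℚ.* ℚ.- 24ℚ} tt

        scores : Fin n → Fin n → Float 2
        scores = h · W-Q · W-K ᵀ · h ᵀ

        score-value : ∀ i j → ⟦ scores i j ⟧ ≡ ⟦ round (ℚSum.sum (λ y → bit (clash i j y) ℚ.* ℚ.- 24ℚ)) ⟧
        score-value i j = dot-value {xs = (h · W-Q · W-K ᵀ) i} {ys = h j} (λ y → bit (clash i j y) ℚ.* ℚ.- 24ℚ)
          (λ y → trans (cong₂ ℚ._*_ (query′-value i y) (h≡H j y)) (scoreTerm-value (active y ∧ H i (swap y)) (H j y)))
          (λ y → small⇒representable (query-small (clash i j y)))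

        score-match : ∀ i j → (∀ y → clash i j y ≡ false) → ⟦ scores i j ⟧ ≡ 0ℚ
        score-match i j match = trans (score-value i j) (trans (cong (⟦_⟧ ∘ round)
          (sum-zero (λ y → bit (clash i j y) ℚ.* ℚ.- 24ℚ) (λ y → cong (λ b → bit b ℚ.* ℚ.- 24ℚ) (match y)))) (small (toWitness {a? = small? 0ℚ} tt)))

        score-clash : ∀ i j y → clash i j y ≡ true → ⟦ scores i j ⟧ ≡ ℚ.- 24ℚ
        score-clash i j y eq = trans (score-value i j) (round-saturates (ℚ.≤-trans
          (sum-≤ (λ y → bit (clash i j y) ℚ.* ℚ.- 24ℚ) (λ y → nonPositive (clash i j y)) y)
          (ℚ.≤-reflexive (cong (λ b → bit b ℚ.* ℚ.- 24ℚ) eq))))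
          where
          nonPositive : ∀ b → bit b ℚ.* ℚ.- 24ℚ ℚ.≤ 0ℚ
          nonPositive = toWitness {a? = ∀Bool? λ b → bit b ℚ.* ℚ.- 24ℚ ℚ.≤? 0ℚ} tt

        β-scores : Fin n → Fin n → Float 2
        β-scores i j = quarterF ⊗ scores i j

        β-scores-value : ∀ {i a a′} → Attends i a a′ → ∀ j →
          ((j ≡ a ⊎ j ≡ a′) × ⟦ β-scores i j ⟧ ≡ 0ℚ) ⊎ ((j ≢ a × j ≢ a′) × ⟦ β-scores i j ⟧ ≡ ℚ.- 6ℚ)
        β-scores-value {i} A j with attends A j
        ... | inj₁ (hit , match)    = inj₁ (hit , trans (cong (λ q → ⟦ round (⟦ quarterF ⟧ ℚ.* q) ⟧) (score-match i j match)) (small (toWitness {a? = small? 0ℚ} tt)))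
        ... | inj₂ (miss , y , eq) = inj₂ (miss , trans (cong (λ q → ⟦ round (⟦ quarterF ⟧ ℚ.* q) ⟧) (score-clash i j y eq)) (small (toWitness {a? = small? (ℚ.- 6ℚ)} tt)))

        -- The product is written as two summands, so that the sum over all positions splits into
        -- two sums against `δ`, each of which collapses to one term.
        averageTerm : Bool → Bool → Bool → ℚ
        averageTerm b s t = (½ ℚ.* bit b) ℚ.* bit s ℚ.+ (½ ℚ.* bit b) ℚ.* bit t

        averageTerm-value : ∀ b s t → mean s t ℚ.* bit b ≡ averageTerm b s t
        averageTerm-value = toWitness {a? = ∀Bool? λ b → ∀Bool? λ s → ∀Bool? λ t → mean s t ℚ.* bit b ℚ.≟ averageTerm b s t} tt

        averageTerm-small : ∀ b s t → Small (averageTerm b s t)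
        averageTerm-small = toWitness {a? = ∀Bool? λ b → ∀Bool? λ s → ∀Bool? λ t → small? (averageTerm b s t)} tt

        mean-small′ : ∀ b b′ → Small (½ ℚ.* bit b ℚ.+ ½ ℚ.* bit b′)
        mean-small′ = toWitness {a? = ∀Bool? λ b → ∀Bool? λ b′ → small? (½ ℚ.* bit b ℚ.+ ½ ℚ.* bit b′)} tt

      hopfield-value : ∀ {i a a′} → Attends i a a′ → ∀ x → ⟦ hopfield (specifiedLayer S) h h i x ⟧ ≡ mean (H a x) (H a′ x)
      hopfield-value {i} {a} {a′} A x = trans
        (dot-unit (((λ i → softmax (β-scores i)) · h) i) (λ k → identity k x) x (λ k → trans (identity-value k x) (δ-sym k x)))
        (trans (dot-value {xs = softmax (β-scores i)} {ys = λ j → h j x} (λ j → averageTerm (H j x) (does (a Fin.≟ j)) (does (a′ Fin.≟ j)))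
            (λ j → trans (cong₂ ℚ._*_ (softmax-value (β-scores i) a a′ (β-scores-value A) j) (h≡H j x)) (averageTerm-value (H j x) (does (a Fin.≟ j)) (does (a′ Fin.≟ j))))
            (λ j → small⇒representable (averageTerm-small (H j x) (does (a Fin.≟ j)) (does (a′ Fin.≟ j)))))
          (trans (cong (⟦_⟧ ∘ round) (trans (ℚSum.∑-distrib-+ (λ j → (½ ℚ.* bit (H j x)) ℚ.* δ a j) (λ j → (½ ℚ.* bit (H j x)) ℚ.* δ a′ j))
                   (cong₂ ℚ._+_ (sum-δ (λ j → ½ ℚ.* bit (H j x)) a) (sum-δ (λ j → ½ ℚ.* bit (H j x)) a′))))
            (trans (small (mean-small′ (H a x) (H a′ x))) (sym (ℚ.*-distribˡ-+ ½ (bit (H a x)) (bit (H a′ x)))))))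

      private
        unitTerm : Bool → Bool → Bool → Bool → ℚ
        unitTerm p p′ s t = (2ℚ ℚ.* mean p p′) ℚ.* bit s ℚ.+ (2ℚ ℚ.* mean p p′) ℚ.* bit t

        unitTerm-value : ∀ p p′ s t → ⟦ unitEntry s t ⟧ ℚ.* mean p p′ ≡ unitTerm p p′ s t
        unitTerm-value = toWitness {a? = ∀Bool? λ p → ∀Bool? λ p′ → ∀Bool? λ s → ∀Bool? λ t → ⟦ unitEntry s t ⟧ ℚ.* mean p p′ ℚ.≟ unitTerm p p′ s t} tt

        unitTerm-small : ∀ p p′ s t → Small (unitTerm p p′ s t)
        unitTerm-small = toWitness {a? = ∀Bool? λ p → ∀Bool? λ p′ → ∀Bool? λ s → ∀Bool? λ t → small? (unitTerm p p′ s t)} tt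

        unitSum : Bool → Bool → Bool → Bool → ℚ
        unitSum p p′ q q′ = 2ℚ ℚ.* mean p p′ ℚ.+ 2ℚ ℚ.* mean q q′

        unitSum-small : ∀ p p′ q q′ → Small (unitSum p p′ q q′)
        unitSum-small = toWitness {a? = ∀Bool? λ p → ∀Bool? λ p′ → ∀Bool? λ q → ∀Bool? λ q′ → small? (unitSum p p′ q q′)} tt

        bias : Bool → Float 2
        bias b = if b then -3F else -1F

        biased-small : ∀ b p p′ q q′ → Small (unitSum p p′ q q′ ℚ.+ ⟦ bias b ⟧)
        biased-small = toWitness {a? = ∀Bool? λ b → ∀Bool? λ p → ∀Bool? λ p′ → ∀Bool? λ q → ∀Bool? λ q′ → small? (unitSum p p′ q q′ ℚ.+ ⟦ bias b ⟧)} tt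

        rectified : Bool → Bool → Bool → Bool → Bool → ℚ
        rectified b p p′ q q′ = 0ℚ ℚ.⊔ (unitSum p p′ q q′ ℚ.+ ⟦ bias b ⟧)

        rectified-small : ∀ b p p′ q q′ → Small (rectified b p p′ q q′)
        rectified-small = toWitness {a? = ∀Bool? λ b → ∀Bool? λ p → ∀Bool? λ p′ → ∀Bool? λ q → ∀Bool? λ q′ → small? (rectified b p p′ q q′)} tt

        excess : Bool → Bool → Bool → Bool → Bool → ℕ
        excess b p p′ q q′ = bitℕ p ℕ.+ bitℕ p′ ℕ.+ bitℕ q ℕ.+ bitℕ q′ ∸ (if b then 3 else 1)

        rectified-value : ∀ b p p′ q q′ → rectified b p p′ q q′ ≡ fromℕ′ (excess b p p′ q q′)
        rectified-value = toWitness {a? = ∀Bool? λ b → ∀Bool? λ p → ∀Bool? λ p′ → ∀Bool? λ q → ∀Bool? λ q′ → rectified b p p′ q q′ ℚ.≟ fromℕ′ (excess b p p′ q q′)} tt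

      -- On integers, ReLU after subtracting the threshold is truncated subtraction. The hypothesis
      -- that its result is a bit allows the next layer to be analysed in the same way.
      layer-value : ∀ {i a a′} → Attends i a a′ → ∀ u b →
        bitℕ (H a (left u)) ℕ.+ bitℕ (H a′ (left u)) ℕ.+ bitℕ (H a (right u)) ℕ.+ bitℕ (H a′ (right u)) ∸ threshold u ≡ bitℕ b →
        ⟦ Model.layer 𝔸 (specifiedLayer S) h i u ⟧ ≡ bit b
      layer-value {i} {a} {a′} A u b N≡b = trans (cong (λ q → ⟦ round (q ℚ.+ 0ℚ) ⟧) copied)
          (trans (cong (⟦_⟧ ∘ round) (ℚ.+-identityʳ ⟦ hidden u ⟧)) (trans (round-representable (hidden u , refl)) hidden-value))
        where
        open Layer (specifiedLayer S) using (W₁; b₁)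
        z : Vector (Float 2) e
        z = hopfield (specifiedLayer S) h h i
        hidden : Vector (Float 2) e
        hidden = relu ∘ affine W₁ b₁ z
        copied : ⟦ dot (identity u) hidden ⟧ ≡ ⟦ hidden u ⟧
        copied = trans (dot-comm (identity u) hidden) (dot-unit hidden (identity u) u (identity-value u))
        p = H a (left u)
        p′ = H a′ (left u)
        q = H a (right u)
        q′ = H a′ (right u)
        weighted : ⟦ dot (W₁ u) z ⟧ ≡ unitSum p p′ q q′
        weighted = trans
          (dot-value {xs = W₁ u} {ys = z} (λ x → unitTerm (H a x) (H a′ x) (does (left u Fin.≟ x)) (does (right u Fin.≟ x)))
            (λ x → trans (cong (⟦ W₁ u x ⟧ ℚ.*_) (hopfield-value A x)) (unitTerm-value (H a x) (H a′ x) (does (left u Fin.≟ x)) (does (right u Fin.≟ x))))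
            (λ x → small⇒representable (unitTerm-small (H a x) (H a′ x) (does (left u Fin.≟ x)) (does (right u Fin.≟ x)))))
          (trans (cong (⟦_⟧ ∘ round) (trans
              (ℚSum.∑-distrib-+ (λ x → (2ℚ ℚ.* mean (H a x) (H a′ x)) ℚ.* δ (left u) x) (λ x → (2ℚ ℚ.* mean (H a x) (H a′ x)) ℚ.* δ (right u) x))
              (cong₂ ℚ._+_ (sum-δ (λ x → 2ℚ ℚ.* mean (H a x) (H a′ x)) (left u)) (sum-δ (λ x → 2ℚ ℚ.* mean (H a x) (H a′ x)) (right u)))))
            (small (unitSum-small p p′ q q′)))
        hidden-value : ⟦ hidden u ⟧ ≡ bit b
        hidden-value = trans (cong (λ r → ⟦ round (0ℚ ℚ.⊔ r) ⟧)
            (trans (cong (λ r → ⟦ round (r ℚ.+ ⟦ bias (high u) ⟧) ⟧) weighted) (small (biased-small (high u) p p′ q q′))))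
          (trans (small (rectified-small (high u) p p′ q q′)) (trans (rectified-value (high u) p p′ q q′) (trans (cong fromℕ′ N≡b) (fromBit b))))
          where
          fromBit : ∀ b → fromℕ′ (bitℕ b) ≡ bit b
          fromBit true  = refl
          fromBit false = refl

-- Output layer, named coordinates and binary codes

module CoordinateNetworks where

  open import Data.Bool.Base using (Bool; true; false; if_then_else_; _∧_)
  open import Data.Fin.Base as Fin using (Fin; zero; suc; fromℕ; funToFin; finToFun; combine)
  import Data.Fin.Properties as Fin
  open import Data.Integer.Base using (+_)
  open import Data.List.Base as List using (List; []; _∷_)
  import Data.List.Extrema as Extrema
  import Data.List.Relation.Unary.All as All
  open import Data.List.Membership.Propositional.Properties using (∈-allFin)
  open import Data.Maybe.Base using (Maybe; just; nothing)
  open import Data.Nat.Base as ℕ using (ℕ; zero; suc; _∸_)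
  open import Data.Product.Function.NonDependent.Propositional using (_×-↔_)
  open import Data.Rational.Base as ℚ using (ℚ; 0ℚ; 1ℚ)
  import Data.Rational.Properties as ℚ
  open import Data.Sum.Function.Propositional using (_⊎-↔_)
  open import Data.Unit.Base using (tt)
  open import Function.Bundles using (_↔_; Inverse)
  open import Function.Construct.Composition using (_↔-∘_)
  open import Relation.Binary.Bundles using (DecTotalOrder)
  open import Relation.Nullary using (Dec; yes; no; does)
  open import Relation.Nullary.Decidable using (toWitness)
  open FloatValues
  open ExactFloats
  open BitNetworks

  unique-maximum : ∀ {v} (f : Fin v → ℚ) t → f t ≡ 1ℚ → (∀ y → y ≢ t → f y ≡ 0ℚ) → ∀ m → f t ℚ.≤ f m → m ≡ t
  unique-maximum f t ft≡1 others m ft≤fm with m Fin.≟ t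
  ... | yes eq = eq
  ... | no  ne = ⊥-elim (ℚ<⇒≱ {0ℚ} {1ℚ} (ℚ.positive⁻¹ 1ℚ) (subst₂ ℚ._≤_ ft≡1 (others m ne) ft≤fm))

  argmax-maximal : ∀ {v} (f : Fin (suc v) → ℚ) t → f t ℚ.≤ f (argmax f)
  argmax-maximal {v} f t = All.lookup (f[xs]≤f[argmax] {f = f} Fin.zero (List.allFin (suc v))) (∈-allFin t)
    where open Extrema (DecTotalOrder.totalOrder ℚ.≤-decTotalOrder) using (f[xs]≤f[argmax])

  argmax-unique : ∀ {v} (f : Fin (suc v) → ℚ) t → f t ≡ 1ℚ → (∀ y → y ≢ t → f y ≡ 0ℚ) → argmax f ≡ t
  argmax-unique f t ft≡1 others = unique-maximum f t ft≡1 others (argmax f) (argmax-maximal f t)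

  -- A label acts as a penalty: when the coordinate labelled `t` is the only labelled one that is
  -- set, every token other than `t` has logit -6, and the softmax is exactly one-hot.
  outputEntry : ∀ {v} → Maybe (Fin v) → Fin v → Float 2
  outputEntry nothing  y = zeroF
  outputEntry (just t) y = if does (t Fin.≟ y) then zeroF else -6F

  twoLayers : ∀ {p e N v} → (Fin (suc v) → Vector (Float p) e) → (Fin N → Vector (Float p) e) → (ℓ₁ ℓ₂ : Layer p e) →
              Matrix (Float p) (suc v) e → Parameters p e 2 N v
  twoLayers TE PE ℓ₁ ℓ₂ O = record { θ-TE = TE ; θ-PE = PE ; layers = ℓ₁ Vec.∷ ℓ₂ Vec.∷ Vec.[] ; θ-OUTPUT = O }

  module Output (𝔸 : FloatArithmetic 2) where

    open Exact 𝔸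
    open Network 𝔸

    module _ {e v} (label : Fin e → Maybe (Fin (suc v))) (O : Matrix (Float 2) (suc v) e)
             (O≡label : ∀ y u → ⟦ O y u ⟧ ≡ ⟦ outputEntry (label u) y ⟧)
             (z : Vector (Float 2) e) (Z : Fin e → Bool) (z≡Z : ∀ u → ⟦ z u ⟧ ≡ bit (Z u))
             (u₀ : Fin e) (t : Fin (suc v)) (active : Z u₀ ≡ true) (labelled : label u₀ ≡ just t)
             (others : ∀ u → u ≢ u₀ → Z u ≡ false ⊎ label u ≡ nothing) where

      private
        logits : Vector (Float 2) (suc v)
        logits y = Model.dot 𝔸 (O y) z

        cost : Bool → ℚ
        cost b = if b then 0ℚ else ℚ.- 6ℚ

        cost-small : ∀ b → Small (cost b)
        cost-small = toWitness {a? = ∀Bool? λ b → small? (cost b)} tt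

        cost-δ-small : ∀ b c → Small (cost b ℚ.* bit c)
        cost-δ-small = toWitness {a? = ∀Bool? λ b → ∀Bool? λ c → small? (cost b ℚ.* bit c)} tt

        entry-value : ∀ y → ⟦ outputEntry (just t) y ⟧ ≡ cost (does (t Fin.≟ y))
        entry-value y with does (t Fin.≟ y)
        ... | true  = refl
        ... | false = refl

        term-value : ∀ y u → ⟦ outputEntry (label u) y ⟧ ℚ.* ⟦ z u ⟧ ≡ cost (does (t Fin.≟ y)) ℚ.* δ u₀ u
        term-value y u with u₀ Fin.≟ u
        ... | yes refl rewrite labelled = cong₂ ℚ._*_ (entry-value y) (trans (z≡Z u₀) (cong bit active))
        ... | no  u₀≢u with others u (u₀≢u ∘ sym)
        ... | inj₁ Zu≡false = trans (cong (⟦ outputEntry (label u) y ⟧ ℚ.*_) (trans (z≡Z u) (cong bit Zu≡false)))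
                                (trans (ℚ.*-zeroʳ ⟦ outputEntry (label u) y ⟧) (sym (ℚ.*-zeroʳ (cost (does (t Fin.≟ y))))))
        ... | inj₂ unlabelled rewrite unlabelled = trans (ℚ.*-zeroˡ ⟦ z u ⟧) (sym (ℚ.*-zeroʳ (cost (does (t Fin.≟ y)))))

        logit-value : ∀ y → ⟦ logits y ⟧ ≡ cost (does (t Fin.≟ y))
        logit-value y = trans (dot-value {xs = O y} {ys = z} (λ u → cost (does (t Fin.≟ y)) ℚ.* δ u₀ u)
            (λ u → trans (cong (ℚ._* ⟦ z u ⟧) (O≡label y u)) (term-value y u))
            (λ u → small⇒representable (cost-δ-small (does (t Fin.≟ y)) (does (u₀ Fin.≟ u)))))
          (trans (cong (⟦_⟧ ∘ FloatArithmetic.round 𝔸) (sum-δ (λ _ → cost (does (t Fin.≟ y))) u₀))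
            (round-representable (small⇒representable (cost-small (does (t Fin.≟ y))))))

        logits-hot : ∀ y → ((y ≡ t ⊎ y ≡ t) × ⟦ logits y ⟧ ≡ 0ℚ) ⊎ ((y ≢ t × y ≢ t) × ⟦ logits y ⟧ ≡ ℚ.- 6ℚ)
        logits-hot y = classify (t Fin.≟ y) (logit-value y)
          where
          classify : (d : Dec (t ≡ y)) → ∀ {q} → q ≡ cost (does d) → ((y ≡ t ⊎ y ≡ t) × q ≡ 0ℚ) ⊎ ((y ≢ t × y ≢ t) × q ≡ ℚ.- 6ℚ)
          classify (yes t≡y) eq = inj₁ (inj₁ (sym t≡y) , eq)
          classify (no  t≢y) eq = inj₂ ((t≢y ∘ sym , t≢y ∘ sym) , eq)

      -- The logits have the shape of attention scores, 0 at `t` and -6 elsewhere, so the analysis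
      -- of attention applies with both attended positions equal to `t`.
      softmax-output : ∀ y → ⟦ Model.softmax 𝔸 (λ y → Model.dot 𝔸 (O y) z) y ⟧ ≡ δ t y
      softmax-output y = trans (softmax-value logits t t logits-hot y) (mean-equal (does (t Fin.≟ y)))
        where
        mean-equal : ∀ p → mean p p ≡ bit p
        mean-equal = toWitness {a? = ∀Bool? λ p → mean p p ℚ.≟ bit p} tt

    MHM-twoLayers : ∀ {e N v m} (θ : Parameters 2 e 2 N v) TE PE ℓ₁ ℓ₂ O → θ ≡ twoLayers TE PE ℓ₁ ℓ₂ O → ∀ .(l : suc m ℕ.≤ N) (xs : Vec (Fin (suc v)) (suc m)) t →
      (∀ y → ⟦ Model.softmax 𝔸 (λ y → Model.dot 𝔸 (O y) (Model.layer 𝔸 ℓ₂ (Model.layer 𝔸 ℓ₁ (Model.embed 𝔸 θ l xs)) (fromℕ m))) y ⟧ ≡ δ t y) →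
      Model.MHM 𝔸 θ l xs ≡ t
    MHM-twoLayers _ TE PE ℓ₁ ℓ₂ O refl l xs t h = argmax-unique (λ y → ⟦ Model.nextTokenProbabilities 𝔸 (twoLayers TE PE ℓ₁ ℓ₂ O) l xs y ⟧) t
      (trans (h t) (δ-refl t)) (λ y y≢t → trans (h y) (δ-≢ (y≢t ∘ sym)))

  infixr 4 _⊞_
  infixr 5 _⊠_

  _⊞_ : ∀ {m n} {A B : Set} → Fin m ↔ A → Fin n ↔ B → Fin (m ℕ.+ n) ↔ (A ⊎ B)
  f ⊞ g = (f ⊎-↔ g) ↔-∘ Fin.+↔⊎

  _⊠_ : ∀ {m n} {A B : Set} → Fin m ↔ A → Fin n ↔ B → Fin (m ℕ.* n) ↔ (A × B)
  f ⊠ g = (f ×-↔ g) ↔-∘ Fin.*↔×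

  record CoordinateSpecification (X : Set) : Set where
    field
      swap       : X → X
      active     : X → Bool
      left right : X → X
      high       : X → Bool

    threshold : X → ℕ
    threshold u = if high u then 3 else 1

  module _ {e} {X : Set} (iso : Fin e ↔ X) (S : CoordinateSpecification X) where

    open Inverse iso using (to; from)
    open CoordinateSpecification S

    specification : Specification e
    specification = record
      { swap = from ∘ swap ∘ to ; active = active ∘ to ; left = from ∘ left ∘ to ; right = from ∘ right ∘ to ; high = high ∘ to }

    clashes : ∀ {n} → (Fin n → X → Bool) → Fin n → Fin n → X → Bool
    clashes H i j y = (active y ∧ H i (swap y)) ∧ H j y

    module _ (𝔸 : FloatArithmetic 2) {n} (h : Matrix (Float 2) n e) (H : Fin n → X → Bool) (h≡H : ∀ i u → ⟦ h i u ⟧ ≡ bit (H i (to u))) where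

      open Network 𝔸

      to-from : ∀ x → to (from x) ≡ x
      to-from x = Inverse.inverseˡ iso refl

      coordinate-layer-value : ∀ {i a a′} →
        (∀ j → ((j ≡ a ⊎ j ≡ a′) × (∀ y → clashes H i j y ≡ false)) ⊎ ((j ≢ a × j ≢ a′) × ∃[ y ] clashes H i j y ≡ true)) →
        ∀ u b → bitℕ (H a (left (to u))) ℕ.+ bitℕ (H a′ (left (to u))) ℕ.+ bitℕ (H a (right (to u))) ℕ.+ bitℕ (H a′ (right (to u))) ∸ threshold (to u) ≡ bitℕ b →
        ⟦ Model.layer 𝔸 (specifiedLayer specification) h i u ⟧ ≡ bit b
      coordinate-layer-value {i} {a} {a′} attends u b eq =
        layer-value specification h (λ i → H i ∘ to) h≡H (record { attends = attends′ }) u b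
          (trans (cong₂ (λ x y → bitℕ (H a x) ℕ.+ bitℕ (H a′ x) ℕ.+ bitℕ (H a y) ℕ.+ bitℕ (H a′ y) ∸ threshold (to u))
            (to-from (left (to u))) (to-from (right (to u)))) eq)
        where
        attends′ : ∀ j → _
        attends′ j with attends j
        ... | inj₁ (hit , match) = inj₁ (hit , λ y → trans (cong (λ x → (active (to y) ∧ H i x) ∧ H j (to y)) (to-from (swap (to y)))) (match (to y)))
        ... | inj₂ (miss , y , eq) = inj₂ (miss , from y ,
                trans (cong (λ x → (active (to (from y)) ∧ H i x) ∧ H j (to (from y))) (to-from (swap (to (from y)))))
                  (trans (cong (clashes H i j) (to-from y)) eq))

  bits : ∀ {b} → Fin (2 ℕ.^ b) → Fin b → Fin 2
  bits {b} = finToFun {2} {b}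

  funToFin-cong : ∀ {m n} {f g : Fin m → Fin n} → (∀ i → f i ≡ g i) → funToFin f ≡ funToFin g
  funToFin-cong {zero}  f≗g = refl
  funToFin-cong {suc m} f≗g = cong₂ combine (f≗g zero) (funToFin-cong (f≗g ∘ suc))

  bits-injective : ∀ {b} (x y : Fin (2 ℕ.^ b)) → (∀ β → bits {b} x β ≡ bits {b} y β) → x ≡ y
  bits-injective {b} x y eq = trans (sym (Fin.funToFin-finToFin {b} {2} x))
    (trans (funToFin-cong {b} {2} {bits {b} x} {bits {b} y} eq) (Fin.funToFin-finToFin {b} {2} y))

  differing-bit : ∀ {b} (x y : Fin (2 ℕ.^ b)) → x ≢ y → ∃[ β ] bits {b} x β ≢ bits {b} y β
  differing-bit {b} x y x≢y = Fin.¬∀⟶∃¬ b (λ β → bits {b} x β ≡ bits {b} y β) (λ β → bits {b} x β Fin.≟ bits {b} y β) (x≢y ∘ bits-injective {b} x y)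

-- The two-layer model and its next token

module TwoLayerModel where

  open import Data.Bool.Base using (Bool; true; false; _∨_; _∧_)
  open import Data.Bool.Properties using (∧-zeroʳ)
  open import Data.Fin.Base as Fin using (Fin; zero; suc; opposite; fromℕ; inject≤)
  import Data.Fin.Properties as Fin
  open import Data.Maybe.Base using (Maybe; just; nothing)
  open import Data.Nat.Base as ℕ using (ℕ; zero; suc; _∸_)
  open import Data.Product.Properties using (≡-dec)
  open import Function.Bundles using (_↔_; Inverse)
  open import Function.Construct.Identity using (↔-id)
  open import Relation.Binary.Definitions using (DecidableEquality)
  open import Relation.Nullary using (¬_; Dec; yes; no; does)
  open import Relation.Nullary.Decidable using (dec-true; dec-false)
  open FloatValues
  open ExactFloats
  open BitNetworks
  open CoordinateNetworks

  -- The flag is also needed for `first`: with a single input token the first step is the last one.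
  Role : Set
  Role = Fin 3 × Fin 2

  pattern input         = (zero , zero)
  pattern first f       = (suc zero , f)
  pattern generated f   = (suc (suc zero) , f)

  _≟ᴿ_ : DecidableEquality Role
  _≟ᴿ_ = ≡-dec Fin._≟_ Fin._≟_

  -- Each bit of a code has one coordinate for either value, so that a mismatch shows as a set
  -- coordinate meeting its opposite. `both`, `pair` and `single` are reserved for conjunctions that
  -- the layers compute. Only the two blocks of code bits grow with the input.
  Coordinate : (T b : ℕ) → Set
  Coordinate T b = Fin T ⊎ Role ⊎ (Fin T × Role) ⊎ (Fin b × Fin 2) ⊎ (Fin b × Fin 2) ⊎ (Fin T × Fin T × Fin 2) ⊎ (Fin T × Fin 2)

  pattern symbol t        = inj₁ t
  pattern role r         = inj₂ (inj₁ r)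
  pattern both t r       = inj₂ (inj₂ (inj₁ (t , r)))
  pattern positionBit β c = inj₂ (inj₂ (inj₂ (inj₁ (β , c))))
  pattern keyBit β c     = inj₂ (inj₂ (inj₂ (inj₂ (inj₁ (β , c)))))
  pattern pair t t′ f    = inj₂ (inj₂ (inj₂ (inj₂ (inj₂ (inj₁ (t , t′ , f))))))
  pattern single t f     = inj₂ (inj₂ (inj₂ (inj₂ (inj₂ (inj₂ (t , f))))))

  embeddingSize : (T b : ℕ) → ℕ
  embeddingSize T b = T ℕ.+ (3 ℕ.* 2 ℕ.+ (T ℕ.* (3 ℕ.* 2) ℕ.+ (b ℕ.* 2 ℕ.+ (b ℕ.* 2 ℕ.+ (T ℕ.* (T ℕ.* 2) ℕ.+ T ℕ.* 2)))))

  coordinates : ∀ T b → Fin (embeddingSize T b) ↔ Coordinate T b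
  coordinates T b = I T ⊞ (I 3 ⊠ I 2) ⊞ (I T ⊠ I 3 ⊠ I 2) ⊞ (I b ⊠ I 2) ⊞ (I b ⊠ I 2) ⊞ (I T ⊠ I T ⊠ I 2) ⊞ (I T ⊠ I 2)
    where I = λ n → ↔-id (Fin n)

  module _ {T b : ℕ} where

    open CoordinateSpecification

    -- Position codes are distinct, so a position attends to itself alone and each source is counted
    -- twice. Threshold 3 in this count of four yields the conjunction of the two sources, and a
    -- copy where they are equal.
    selfLayer : CoordinateSpecification (Coordinate T b)
    swap selfLayer (positionBit β c) = positionBit β (opposite c)
    swap selfLayer x                 = x
    active selfLayer (positionBit β c) = true
    active selfLayer _                 = false
    left selfLayer (both t r) = symbol t
    left selfLayer x          = x
    right selfLayer (both t r) = role r
    right selfLayer x          = x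
    high selfLayer _ = true

    -- For `pair`, each source can be set at only one of the two attended positions, namely the
    -- input and the generated token. At most two of four bits are set, and threshold 1 yields their
    -- conjunction. The remaining coordinates compute conjunctions, and except for `single` the
    -- output layer ignores them.
    keyLayer : CoordinateSpecification (Coordinate T b)
    swap keyLayer (keyBit β c) = keyBit β (opposite c)
    swap keyLayer x            = x
    active keyLayer (keyBit β c) = true
    active keyLayer _            = false
    left keyLayer (pair t t′ f) = both t input
    left keyLayer (single t f)  = both t (first f)
    left keyLayer x             = x
    right keyLayer (pair t t′ f) = both t′ (generated f)
    right keyLayer (single t f)  = both t (first f)
    right keyLayer x             = x
    high keyLayer (pair t t′ f) = false
    high keyLayer _             = true

  excess-high : ∀ p q → bitℕ p ℕ.+ bitℕ p ℕ.+ bitℕ q ℕ.+ bitℕ q ∸ 3 ≡ bitℕ (p ∧ q)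
  excess-high true  true  = refl
  excess-high true  false = refl
  excess-high false true  = refl
  excess-high false false = refl

  excess-high′ : ∀ p q → bitℕ p ℕ.+ bitℕ q ℕ.+ bitℕ p ℕ.+ bitℕ q ∸ 3 ≡ bitℕ (p ∧ q)
  excess-high′ true  true  = refl
  excess-high′ true  false = refl
  excess-high′ false true  = refl
  excess-high′ false false = refl

  excess-low : ∀ {p q′} p′ q → p ≡ false → q′ ≡ false → bitℕ p ℕ.+ bitℕ p′ ℕ.+ bitℕ q ℕ.+ bitℕ q′ ∸ 1 ≡ bitℕ (p′ ∧ q)
  excess-low true  true  refl refl = refl
  excess-low true  false refl refl = refl
  excess-low false true  refl refl = refl
  excess-low false false refl refl = refl

  ∧-idem′ : ∀ p → p ∧ p ≡ p
  ∧-idem′ true  = refl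
  ∧-idem′ false = refl

  equal-bits : ∀ (x c : Fin 2) → does (x Fin.≟ opposite c) ∧ does (x Fin.≟ c) ≡ false
  equal-bits zero       zero       = refl
  equal-bits zero       (suc zero) = refl
  equal-bits (suc zero) zero       = refl
  equal-bits (suc zero) (suc zero) = refl

  unequal-bits : ∀ (x y : Fin 2) → x ≢ y → does (x Fin.≟ opposite y) ∧ does (y Fin.≟ y) ≡ true
  unequal-bits zero       zero       x≢y = ⊥-elim (x≢y refl)
  unequal-bits zero       (suc zero) x≢y = refl
  unequal-bits (suc zero) zero       x≢y = refl
  unequal-bits (suc zero) (suc zero) x≢y = ⊥-elim (x≢y refl)

  module _ {v b N e} (𝔸 : FloatArithmetic 2) (key : Fin N → Fin (2 ℕ.^ b)) (roleOf : Fin N → Role)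
           (answer : Fin 2 → Fin (suc v) → Fin (suc v)) (θ : Parameters 2 e 2 N v) where

    -- Together with `LaterStep`, this is all that the induction over generated tokens has to know
    -- about the parameters.
    FirstStep : Set
    FirstStep = ∀ {m} .(l : suc m ℕ.≤ N) (xs : Vec (Fin (suc v)) (suc m)) →
      (∀ j → j ≢ fromℕ m → key (inject≤ j l) ≢ key (inject≤ (fromℕ m) l)) →
      ∀ f → roleOf (inject≤ (fromℕ m) l) ≡ first f → Model.MHM 𝔸 θ l xs ≡ answer f (Vec.lookup xs (fromℕ m))

    LaterStep : (multiply : Fin (suc v) → Fin (suc v) → Fin (suc v)) → Set
    LaterStep multiply = ∀ {m} .(l : suc m ℕ.≤ N) (xs : Vec (Fin (suc v)) (suc m)) a →
      key (inject≤ a l) ≡ key (inject≤ (fromℕ m) l) →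
      (∀ j → j ≢ fromℕ m → j ≢ a → key (inject≤ j l) ≢ key (inject≤ (fromℕ m) l)) →
      ∀ f → roleOf (inject≤ a l) ≡ input → roleOf (inject≤ (fromℕ m) l) ≡ generated f →
      Model.MHM 𝔸 θ l xs ≡ answer f (multiply (Vec.lookup xs a) (Vec.lookup xs (fromℕ m)))

  -- multiply t t′ is the token generated from an input token t and a generated
  -- token t′; the flag of a role marks the last step, where answer is applied.
  module Construction {v b N : ℕ} (position key : Fin N → Fin (2 ℕ.^ b))
                      (position-injective : ∀ i j → position i ≡ position j → i ≡ j)
                      (roleOf : Fin N → Role) (multiply : Fin (suc v) → Fin (suc v) → Fin (suc v))
                      (answer : Fin 2 → Fin (suc v) → Fin (suc v)) where

    private
      e : ℕ
      e = embeddingSize (suc v) b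
      X : Set
      X = Coordinate (suc v) b
      iso : Fin e ↔ X
      iso = coordinates (suc v) b

    open Inverse iso using (to; from)

    tokenBit : Fin (suc v) → X → Bool
    tokenBit t (symbol t′) = does (t Fin.≟ t′)
    tokenBit t _          = false

    positionBits : Fin N → X → Bool
    positionBits i (role r)          = does (roleOf i ≟ᴿ r)
    positionBits i (positionBit β c) = does (bits {b} (position i) β Fin.≟ c)
    positionBits i (keyBit β c)      = does (bits {b} (key i) β Fin.≟ c)
    positionBits i _                 = false

    embedded : Fin (suc v) → Fin N → X → Bool
    embedded t i x = tokenBit t x ∨ positionBits i x

    marked : Fin (suc v) → Fin N → X → Bool
    marked t i (both t′ r) = does (t Fin.≟ t′) ∧ does (roleOf i ≟ᴿ r)
    marked t i x           = embedded t i x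

    label : X → Maybe (Fin (suc v))
    label (pair t t′ f) = just (answer f (multiply t t′))
    label (single t f)  = just (answer f t)
    label _             = nothing

    private
      TE : Fin (suc v) → Vector (Float 2) e
      TE t u = bitF (tokenBit t (to u))

      PE : Fin N → Vector (Float 2) e
      PE i u = bitF (positionBits i (to u))

      O : Matrix (Float 2) (suc v) e
      O y u = outputEntry (label (to u)) y

    parameters : Parameters 2 e 2 N v
    parameters = twoLayers TE PE (specifiedLayer (specification iso selfLayer)) (specifiedLayer (specification iso keyLayer)) O

    module _ (𝔸 : FloatArithmetic 2) {m : ℕ} .(l : suc m ℕ.≤ N) (xs : Vec (Fin (suc v)) (suc m)) where

      open Exact 𝔸

      private
        n : ℕ
        n = suc m

        ι : Fin n → Fin N
        ι i = inject≤ i l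
        tok : Fin n → Fin (suc v)
        tok = Vec.lookup xs

        H₀ H₁ : Fin n → X → Bool
        H₀ i = embedded (tok i) (ι i)
        H₁ i = marked (tok i) (ι i)

        ⊕-bits : ∀ p q → p ∧ q ≡ false → ⟦ Model._⊕_ 𝔸 (bitF p) (bitF q) ⟧ ≡ bit (p ∨ q)
        ⊕-bits true  false _ = round-representable (oneF , refl)
        ⊕-bits false true  _ = round-representable (oneF , refl)
        ⊕-bits false false _ = round-representable (zeroF , refl)

        disjoint : ∀ t i x → tokenBit t x ∧ positionBits i x ≡ false
        disjoint t i (symbol _) = ∧-zeroʳ _
        disjoint t i (inj₂ _)  = refl

        h₀≡H₀ : ∀ i u → ⟦ Model.embed 𝔸 parameters l xs i u ⟧ ≡ bit (H₀ i (to u))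
        h₀≡H₀ i u = ⊕-bits (tokenBit (tok i) (to u)) (positionBits (ι i) (to u)) (disjoint (tok i) (ι i) (to u))

        self-attends : ∀ i j → ((j ≡ i ⊎ j ≡ i) × (∀ y → clashes iso selfLayer H₀ i j y ≡ false))
                             ⊎ ((j ≢ i × j ≢ i) × ∃[ y ] clashes iso selfLayer H₀ i j y ≡ true)
        self-attends i j with j Fin.≟ i
        ... | yes refl = inj₁ (inj₁ refl , match)
          where
          match : ∀ y → clashes iso selfLayer H₀ i i y ≡ false
          match (symbol _)         = refl
          match (role _)          = refl
          match (both _ _)        = refl
          match (positionBit β c) = equal-bits (bits {b} (position (ι i)) β) c
          match (keyBit _ _)      = refl
          match (pair _ _ _)      = refl
          match (single _ _)      = refl
        ... | no j≢i with β , differ ← differing-bit {b} (position (ι i)) (position (ι j))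
                         (λ eq → j≢i (sym (Fin.inject≤-injective l l i j (position-injective (ι i) (ι j) eq)))) =
          inj₂ ((j≢i , j≢i) , positionBit β (bits {b} (position (ι j)) β) , unequal-bits (bits {b} (position (ι i)) β) (bits {b} (position (ι j)) β) differ)

        -- The hidden states stay spelled out: comparing an abbreviation with its
        -- definition would make Agda unfold the whole network.
        h₁≡H₁ : ∀ i u → ⟦ Model.layer 𝔸 (specifiedLayer (specification iso selfLayer)) (Model.embed 𝔸 parameters l xs) i u ⟧ ≡ bit (H₁ i (to u))
        h₁≡H₁ i u = coordinate-layer-value iso selfLayer 𝔸 (Model.embed 𝔸 parameters l xs) H₀ h₀≡H₀ {i} (self-attends i) u
                      (H₁ i (to u)) (excess (to u))
          where
          pass : ∀ x → bitℕ (H₀ i x) ℕ.+ bitℕ (H₀ i x) ℕ.+ bitℕ (H₀ i x) ℕ.+ bitℕ (H₀ i x) ∸ 3 ≡ bitℕ (H₀ i x)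
          pass x = trans (excess-high (H₀ i x) (H₀ i x)) (cong bitℕ (∧-idem′ (H₀ i x)))
          open CoordinateSpecification (selfLayer {suc v} {b})
          excess : ∀ x → bitℕ (H₀ i (left x)) ℕ.+ bitℕ (H₀ i (left x)) ℕ.+ bitℕ (H₀ i (right x)) ℕ.+ bitℕ (H₀ i (right x)) ∸ threshold x ≡ bitℕ (H₁ i x)
          excess (both t r) = trans (excess-high (H₀ i (symbol t)) (H₀ i (role r))) (cong (λ p → bitℕ (p ∧ does (roleOf (ι i) ≟ᴿ r))) (∨-false (does (tok i Fin.≟ t))))
            where
            ∨-false : ∀ p → p ∨ false ≡ p
            ∨-false true  = refl
            ∨-false false = refl
          excess x@(symbol _)         = pass x
          excess x@(role _)          = pass x
          excess x@(positionBit _ _) = pass x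
          excess x@(keyBit _ _)      = pass x
          excess x@(pair _ _ _)      = pass x
          excess x@(single _ _)      = pass x

      module _ (a : Fin n)
               (key-hit : key (ι a) ≡ key (ι (fromℕ m)))
               (key-miss : ∀ j → j ≢ fromℕ m → j ≢ a → key (ι j) ≢ key (ι (fromℕ m)))
               (last-role : roleOf (ι (fromℕ m)) ≢ input)
               (a-role : ∀ f → roleOf (ι a) ≢ generated f) where

        private

          i : Fin n
          i = fromℕ m

          H₂ : X → Bool
          H₂ (pair t t′ f) = H₁ a (both t input) ∧ H₁ i (both t′ (generated f))
          H₂ (single t f)  = H₁ i (both t (first f)) ∧ H₁ a (both t (first f))
          H₂ x             = H₁ i x ∧ H₁ a x

          same-key : ∀ j → key (ι j) ≡ key (ι i) → ∀ y → clashes iso keyLayer H₁ i j y ≡ false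
          same-key j eq (symbol _)         = refl
          same-key j eq (role _)          = refl
          same-key j eq (both _ _)        = refl
          same-key j eq (positionBit _ _) = refl
          same-key j eq (keyBit β c) rewrite eq = equal-bits (bits {b} (key (ι i)) β) c
          same-key j eq (pair _ _ _)      = refl
          same-key j eq (single _ _)      = refl

          key-attends : ∀ j → ((j ≡ i ⊎ j ≡ a) × (∀ y → clashes iso keyLayer H₁ i j y ≡ false))
                            ⊎ ((j ≢ i × j ≢ a) × ∃[ y ] clashes iso keyLayer H₁ i j y ≡ true)
          key-attends j with j Fin.≟ i | j Fin.≟ a
          ... | yes refl | _        = inj₁ (inj₁ refl , same-key i refl)
          ... | no _     | yes refl = inj₁ (inj₂ refl , same-key a key-hit)
          ... | no j≢i   | no j≢a with β , differ ← differing-bit {b} (key (ι i)) (key (ι j)) (key-miss j j≢i j≢a ∘ sym) =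
            inj₂ ((j≢i , j≢a) , keyBit β (bits {b} (key (ι j)) β) , unequal-bits (bits {b} (key (ι i)) β) (bits {b} (key (ι j)) β) differ)

          not-role : ∀ j t r → roleOf (ι j) ≢ r → H₁ j (both t r) ≡ false
          not-role j t r ne = trans (cong (does (tok j Fin.≟ t) ∧_) (dec-false (roleOf (ι j) ≟ᴿ r) ne)) (∧-zeroʳ _)

          h₂≡H₂ : ∀ u → ⟦ Model.layer 𝔸 (specifiedLayer (specification iso keyLayer))
                          (Model.layer 𝔸 (specifiedLayer (specification iso selfLayer)) (Model.embed 𝔸 parameters l xs)) (fromℕ m) u ⟧ ≡ bit (H₂ (to u))
          h₂≡H₂ u = coordinate-layer-value iso keyLayer 𝔸 (Model.layer 𝔸 (specifiedLayer (specification iso selfLayer)) (Model.embed 𝔸 parameters l xs))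
                      H₁ h₁≡H₁ {fromℕ m} key-attends u (H₂ (to u)) (excess (to u))
            where
            open CoordinateSpecification (keyLayer {suc v} {b})
            excess : ∀ x → bitℕ (H₁ i (left x)) ℕ.+ bitℕ (H₁ a (left x)) ℕ.+ bitℕ (H₁ i (right x)) ℕ.+ bitℕ (H₁ a (right x)) ∸ threshold x ≡ bitℕ (H₂ x)
            excess (pair t t′ f)       = excess-low (H₁ a (both t input)) (H₁ i (both t′ (generated f)))
                                           (not-role i t input last-role) (not-role a t′ (generated f) (a-role f))
            excess x@(symbol _)         = excess-high′ (H₁ i x) (H₁ a x)
            excess x@(role _)          = excess-high′ (H₁ i x) (H₁ a x)
            excess x@(both _ _)        = excess-high′ (H₁ i x) (H₁ a x)
            excess x@(positionBit _ _) = excess-high′ (H₁ i x) (H₁ a x)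
            excess x@(keyBit _ _)      = excess-high′ (H₁ i x) (H₁ a x)
            excess (single t f)        = excess-high′ (H₁ i (both t (first f))) (H₁ a (both t (first f)))

          from-injective′ : ∀ {u x} → u ≢ from x → to u ≢ x
          from-injective′ {u} u≢ refl = u≢ (sym (Inverse.inverseʳ iso {u} refl))

          to∘from : ∀ x → to (from x) ≡ x
          to∘from x = Inverse.inverseˡ iso refl

          probabilities : ∀ x t → H₂ x ≡ true → label x ≡ just t → (∀ y → y ≢ x → H₂ y ≡ false ⊎ label y ≡ nothing) →
                          ∀ y → ⟦ Model.softmax 𝔸 (λ y → Model.dot 𝔸 (O y) (Model.layer 𝔸 (specifiedLayer (specification iso keyLayer))
                            (Model.layer 𝔸 (specifiedLayer (specification iso selfLayer)) (Model.embed 𝔸 parameters l xs)) (fromℕ m))) y ⟧ ≡ δ t y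
          probabilities x t on labelled others = Output.softmax-output 𝔸 (label ∘ to) O (λ _ _ → refl)
              (Model.layer 𝔸 (specifiedLayer (specification iso keyLayer)) (Model.layer 𝔸 (specifiedLayer (specification iso selfLayer)) (Model.embed 𝔸 parameters l xs)) (fromℕ m))
              (H₂ ∘ to) h₂≡H₂ (from x) t
              (trans (cong H₂ (to∘from x)) on) (trans (cong label (to∘from x)) labelled)
              (λ u u≢ → others (to u) (from-injective′ u≢))

          output : ∀ x t → H₂ x ≡ true → label x ≡ just t → (∀ y → y ≢ x → H₂ y ≡ false ⊎ label y ≡ nothing) →
                   Model.MHM 𝔸 parameters l xs ≡ t
          output x t on labelled others = Output.MHM-twoLayers 𝔸 {e} {N} {v} {m} parameters TE PE
            (specifiedLayer (specification iso selfLayer)) (specifiedLayer (specification iso keyLayer)) O refl l xs t (probabilities x t on labelled others)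

          on : ∀ j t r → tok j ≡ t → roleOf (ι j) ≡ r → H₁ j (both t r) ≡ true
          on j t r eq eq′ = cong₂ _∧_ (dec-true (tok j Fin.≟ t) eq) (dec-true (roleOf (ι j) ≟ᴿ r) eq′)

          off : ∀ j t r → ¬ (tok j ≡ t × roleOf (ι j) ≡ r) → H₁ j (both t r) ≡ false
          off j t r ne with tok j Fin.≟ t | roleOf (ι j) ≟ᴿ r
          ... | yes eq | yes eq′ = ⊥-elim (ne (eq , eq′))
          ... | yes _  | no _    = refl
          ... | no _   | _       = refl

        -- The only attended position is no input, which switches off every `pair`; its token and
        -- role single out one `single`. For a generated last position the two kinds of coordinates
        -- exchange their parts.
        first-answer : ∀ f → a ≡ fromℕ m → roleOf (ι (fromℕ m)) ≡ first f → Model.MHM 𝔸 parameters l xs ≡ answer f (tok (fromℕ m))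
        first-answer f refl is-first = output (single (tok i) f) (answer f (tok i)) (cong₂ _∧_ set set) refl others
          where
          set = on i (tok i) (first f) refl is-first
          others : ∀ y → y ≢ single (tok i) f → H₂ y ≡ false ⊎ label y ≡ nothing
          others (symbol _)         _  = inj₂ refl
          others (role _)          _  = inj₂ refl
          others (both _ _)        _  = inj₂ refl
          others (positionBit _ _) _  = inj₂ refl
          others (keyBit _ _)      _  = inj₂ refl
          others (pair t t′ g)     _  = inj₁ (cong (_∧ H₁ i (both t′ (generated g))) (not-role i t input last-role))
          others (single t g)      ne = inj₁ (cong (_∧ H₁ i (both t (first g))) (off i t (first g) (excluded t g ne)))
            where
            excluded : ∀ t g → single t g ≢ single (tok i) f → ¬ (tok i ≡ t × roleOf (ι i) ≡ first g)
            excluded t g ne (refl , eq) with refl ← trans (sym is-first) eq = ne refl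

        generated-answer : ∀ f → roleOf (ι a) ≡ input → roleOf (ι (fromℕ m)) ≡ generated f →
                        Model.MHM 𝔸 parameters l xs ≡ answer f (multiply (tok a) (tok (fromℕ m)))
        generated-answer f is-input is-generated = output (pair (tok a) (tok i) f) (answer f (multiply (tok a) (tok i)))
            (cong₂ _∧_ (on a (tok a) input refl is-input) (on i (tok i) (generated f) refl is-generated)) refl others
          where
          others : ∀ y → y ≢ pair (tok a) (tok i) f → H₂ y ≡ false ⊎ label y ≡ nothing
          others (symbol _)         _  = inj₂ refl
          others (role _)          _  = inj₂ refl
          others (both _ _)        _  = inj₂ refl
          others (positionBit _ _) _  = inj₂ refl
          others (keyBit _ _)      _  = inj₂ refl
          others (single t g)      _  = inj₁ (cong (_∧ H₁ a (both t (first g))) (not-role i t (first g) λ eq → contradiction (trans (sym is-generated) eq)))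
            where
            contradiction : generated f ≢ first g
            contradiction ()
          others (pair t t′ g)     ne = inj₁ (distinct (tok a Fin.≟ t))
            where
            distinct : Dec (tok a ≡ t) → H₂ (pair t t′ g) ≡ false
            distinct (no a≢t)   = cong (_∧ H₁ i (both t′ (generated g))) (off a t input (a≢t ∘ proj₁))
            distinct (yes refl) = trans (cong (H₁ a (both t input) ∧_) (off i t′ (generated g) excluded)) (∧-zeroʳ _)
              where
              excluded : ¬ (tok i ≡ t′ × roleOf (ι i) ≡ generated g)
              excluded (refl , eq) with refl ← trans (sym is-generated) eq = ne refl

    private
      first≢input : ∀ {f} → _≢_ {A = Role} (first f) input
      first≢input ()
      first≢generated : ∀ {f g} → _≢_ {A = Role} (first f) (generated g)
      first≢generated ()
      generated≢input : ∀ {f} → _≢_ {A = Role} (generated f) input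
      generated≢input ()

    firstStep : ∀ 𝔸 → FirstStep {b = b} 𝔸 key roleOf answer parameters
    firstStep 𝔸 {m} l xs miss f is-first = first-answer 𝔸 l xs (fromℕ m) refl (λ j j≢i _ → miss j j≢i)
      (λ eq → first≢input (trans (sym is-first) eq)) (λ g eq → first≢generated (trans (sym is-first) eq)) f refl is-first

    laterStep : ∀ 𝔸 → LaterStep {b = b} 𝔸 key roleOf answer parameters multiply
    laterStep 𝔸 l xs a hit miss f is-input is-generated = generated-answer 𝔸 l xs a hit miss
      (λ eq → generated≢input (trans (sym is-generated) eq)) (λ g eq → generated≢input (trans (sym eq) is-input)) f is-input is-generated

-- Generated tokens as products of suffixes

module GenerationOfProducts where

  open import Algebra.Bundles using (Group)
  open import Data.Bool.Base using (if_then_else_)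
  open import Data.Fin.Base as Fin using (Fin; zero; suc; toℕ; fromℕ; fromℕ<; inject≤; finToFun; funToFin)
  import Data.Fin.Properties as Fin
  open import Data.Fin.Permutation as Perm using (Permutation′; _⟨$⟩ʳ_; _⟨$⟩ˡ_; permutation)
  open import Data.Nat.Base
  open import Data.Nat.Logarithm using (⌊log₂_⌋; ⌊log₂⌋-mono-≤; ⌊log₂[2^n]⌋≡n)
  open import Data.Nat.Properties
  open import Data.Vec.Base using (_∷ʳ_)
  import Data.Vec.Properties as Vec
  open import Function.Bundles using (Injection)
  open import Relation.Binary.Definitions using (tri<; tri≈; tri>)
  open import Relation.Nullary using (Dec; yes; no; does)
  open import Relation.Nullary.Decidable using (dec-true; dec-false; _×-dec_)
  open import Relation.Unary using (_∈_)
  open CoordinateNetworks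
  open TwoLayerModel

  open Group S₅ using (_∙_; ε; _≈_)

  -- Decoding searches all pairs of functions on Fin 5 for mutually inverse ones.
  module Decode {v} (encode : Injection (Group.setoid S₅) (setoid (Fin v))) where

    open Injection encode using (injective) renaming (to to code)

    table : Fin (5 ^ 5) → Fin 5 → Fin 5
    table = finToFun {5} {5}

    Mutual : (f g : Fin 5 → Fin 5) → Set
    Mutual f g = (∀ i → f (g i) ≡ i) × (∀ i → g (f i) ≡ i)

    mutual? : ∀ f g → Dec (Mutual f g)
    mutual? f g = Fin.all? (λ i → f (g i) Fin.≟ i) ×-dec Fin.all? (λ i → g (f i) Fin.≟ i)

    -- The decision is an argument, so that properties are proved for an arbitrary decision and the
    -- search itself never has to be evaluated.
    fromDec : ∀ {f g} → Dec (Mutual f g) → Permutation′ 5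
    fromDec {f} {g} (yes (p , q)) = permutation f g p q
    fromDec         (no _)        = ε

    fromIndices : Fin (5 ^ 5) → Fin (5 ^ 5) → Permutation′ 5
    fromIndices a c = fromDec {table a} {table c} (mutual? (table a) (table c))

    fromDec-≈ : ∀ {f g} (d : Dec (Mutual f g)) → Mutual f g → ∀ i → fromDec {f} {g} d ⟨$⟩ʳ i ≡ f i
    fromDec-≈ (yes _)      _ i = refl
    fromDec-≈ (no ¬mutual) m i = ⊥-elim (¬mutual m)

    fromIndices-complete : ∀ π → ∃₂ λ a c → fromIndices a c ≈ π
    fromIndices-complete π = a , c , λ i → trans (fromDec-≈ {table a} {table c} (mutual? (table a) (table c)) inverses i) (f≗ i)
      where
      a c : Fin (5 ^ 5)
      a = funToFin {5} {5} (π ⟨$⟩ʳ_)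
      c = funToFin {5} {5} (π ⟨$⟩ˡ_)
      f≗ : ∀ i → table a i ≡ π ⟨$⟩ʳ i
      f≗ = Fin.finToFun-funToFin {5} {5} (π ⟨$⟩ʳ_)
      g≗ : ∀ i → table c i ≡ π ⟨$⟩ˡ i
      g≗ = Fin.finToFun-funToFin {5} {5} (π ⟨$⟩ˡ_)
      inverses : Mutual (table a) (table c)
      inverses = (λ i → trans (f≗ (table c i)) (trans (cong (π ⟨$⟩ʳ_) (g≗ i)) (Perm.inverseʳ π)))
               , (λ i → trans (g≗ (table a i)) (trans (cong (π ⟨$⟩ˡ_) (f≗ i)) (Perm.inverseˡ π)))

    Decodes : Fin v → Set
    Decodes t = ∃₂ λ a c → code (fromIndices a c) ≡ t

    decodes? : ∀ t → Dec (Decodes t)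
    decodes? t = Fin.any? λ a → Fin.any? λ c → code (fromIndices a c) Fin.≟ t

    -- Tokens that encode no permutation, such as possibly `accept`, receive the default `ε`; no
    -- step multiplies with them.
    decodeDec : ∀ {t} → Dec (Decodes t) → Permutation′ 5
    decodeDec (yes (a , c , _)) = fromIndices a c
    decodeDec (no _)            = ε

    decodeDec-code : ∀ π (d : Dec (Decodes (code π))) → decodeDec d ≈ π
    decodeDec-code π (yes (a , c , eq)) = injective {fromIndices a c} {π} eq
    decodeDec-code π (no ¬d)            = ⊥-elim (¬d (let a , c , eq = fromIndices-complete π in a , c , Injection.cong encode {fromIndices a c} {π} eq))

    decoder : Σ[ decode ∈ (Fin v → Permutation′ 5) ] (∀ π → decode (code π) ≈ π)
    decoder = (λ t → decodeDec (decodes? t)) , (λ π → decodeDec-code π (decodes? (code π)))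

  productFrom : (ℕ → Permutation′ 5) → ℕ → ℕ → Permutation′ 5
  productFrom f j zero    = ε
  productFrom f j (suc k) = f j ∙ productFrom f (suc j) k

  productFrom-shift : ∀ (f : ℕ → Permutation′ 5) j k → productFrom f (suc j) k ≡ productFrom (f ∘ suc) j k
  productFrom-shift f j zero    = refl
  productFrom-shift f j (suc k) = cong (f (suc j) ∙_) (productFrom-shift f (suc j) k)

  -- The default `ε` beyond the end allows products to be indexed by plain arithmetic on natural
  -- numbers.
  at : ∀ {n} → Vec (Permutation′ 5) n → ℕ → Permutation′ 5
  at Vec.[]       _       = ε
  at (π Vec.∷ πs) zero    = π
  at (π Vec.∷ πs) (suc j) = at πs j

  foldr-productFrom : ∀ {n} (πs : Vec (Permutation′ 5) n) → Vec.foldr′ _∙_ ε πs ≡ productFrom (at πs) 0 n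
  foldr-productFrom Vec.[]       = refl
  foldr-productFrom {suc n} (π Vec.∷ πs) = cong (π ∙_) (trans (foldr-productFrom πs) (sym (productFrom-shift (at (π Vec.∷ πs)) 0 n)))

  lookup-at : ∀ {n} (πs : Vec (Permutation′ 5) n) i → Vec.lookup πs i ≡ at πs (toℕ i)
  lookup-at (π Vec.∷ πs) zero    = refl
  lookup-at (π Vec.∷ πs) (suc i) = lookup-at πs i

  lookup-∷ʳ-last : ∀ {A : Set} {n} (xs : Vec A n) x → Vec.lookup (xs ∷ʳ x) (fromℕ n) ≡ x
  lookup-∷ʳ-last Vec.[]       x = refl
  lookup-∷ʳ-last (_ Vec.∷ xs) x = lookup-∷ʳ-last xs x

  lookup-∷ʳ : ∀ {A : Set} {n} (xs : Vec A n) x (i : Fin (suc n)) (j : Fin n) → toℕ i ≡ toℕ j → Vec.lookup (xs ∷ʳ x) i ≡ Vec.lookup xs j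
  lookup-∷ʳ (_ Vec.∷ xs) x zero    zero    eq = refl
  lookup-∷ʳ (_ Vec.∷ xs) x (suc i) (suc j) eq = lookup-∷ʳ xs x i j (suc-injective eq)

  ∣m-m+k∣ : ∀ m k → ∣ m + k - m ∣ ≡ k
  ∣m-m+k∣ m k = trans (∣-∣-comm (m + k) m) (∣m-m+n∣≡n m k)

  ∣m∸k-m∣ : ∀ m k → k ≤ m → ∣ m ∸ k - m ∣ ≡ k
  ∣m∸k-m∣ m k k≤m = trans (m≤n⇒∣m-n∣≡n∸m (m∸n≤m m k)) (m∸[m∸n]≡n k≤m)

  distance-cases : ∀ m k j → ∣ j - m ∣ ≡ k → j ≡ m + k ⊎ j ≡ m ∸ k
  distance-cases m k j eq with ≤-total m j
  ... | inj₁ m≤j = inj₁ (trans (sym (m+[n∸m]≡n m≤j)) (cong (m +_) (trans (sym (m≤n⇒∣m-n∣≡n∸m m≤j)) (trans (∣-∣-comm m j) eq))))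
  ... | inj₂ j≤m = inj₂ (trans (sym (m∸[m∸n]≡n j≤m)) (cong (m ∸_) (trans (sym (m≤n⇒∣m-n∣≡n∸m j≤m)) eq)))

  n<2^[1+⌊log₂n⌋] : ∀ n → n < 2 ^ suc ⌊log₂ n ⌋
  n<2^[1+⌊log₂n⌋] n with 2 ^ suc ⌊log₂ n ⌋ ≤? n
  ... | no  h = ≰⇒> h
  ... | yes h = ⊥-elim (<⇒≱ ≤-refl (≤-trans (≤-reflexive (sym (⌊log₂[2^n]⌋≡n (suc ⌊log₂ n ⌋)))) (⌊log₂⌋-mono-≤ h)))

  -- n < 2 ^ (1 + log₂ n), with the logarithm rounded down; doubling accommodates the 2n + 1
  -- positions of input and chain of thought.
  codeLength : ℕ → ℕ
  codeLength n = 2 + ⌊log₂ n ⌋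

  -- The least maximum length that the bound on `suc m` steps after `suc m` inputs permits.
  maximumLength : ℕ → ℕ
  maximumLength m = suc (suc m + suc m)

  maximumLength≤ : ∀ m → maximumLength m ≤ 2 ^ codeLength (suc m)
  maximumLength≤ m = begin
    suc (suc m + suc m)             ≤⟨ n≤1+n _ ⟩
    2 + (suc m + suc m)             ≡⟨ cong suc (sym (+-suc (suc m) (suc m))) ⟩
    (2 + m) + (2 + m)               ≤⟨ +-mono-≤ (n<2^[1+⌊log₂n⌋] (suc m)) (n<2^[1+⌊log₂n⌋] (suc m)) ⟩
    2 ^ suc ⌊log₂ suc m ⌋ + 2 ^ suc ⌊log₂ suc m ⌋ ≡⟨ cong (2 ^ suc ⌊log₂ suc m ⌋ +_) (sym (+-identityʳ _)) ⟩
    2 ^ codeLength (suc m)          ∎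
    where open ≤-Reasoning

  module Roles (m : ℕ) where

    m<N : m < maximumLength m
    m<N = s≤s (≤-trans (n≤1+n m) (m≤m+n (suc m) (suc m)))

    distance< : ∀ (i : Fin (maximumLength m)) → ∣ toℕ i - m ∣ < 2 ^ codeLength (suc m)
    distance< i = <-≤-trans (≤-<-trans (∣m-n∣≤m⊔n (toℕ i) m) (⊔-pres-<m (Fin.toℕ<n i) m<N)) (maximumLength≤ m)

    position key : Fin (maximumLength m) → Fin (2 ^ codeLength (suc m))
    position i = inject≤ i (maximumLength≤ m)
    key i      = fromℕ< (distance< i)

    position-injective : ∀ i j → position i ≡ position j → i ≡ j
    position-injective = Fin.inject≤-injective (maximumLength≤ m) (maximumLength≤ m)

    key-≡ : ∀ i j → ∣ toℕ i - m ∣ ≡ ∣ toℕ j - m ∣ → key i ≡ key j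
    key-≡ i j eq = Fin.toℕ-injective (trans (Fin.toℕ-fromℕ< (distance< i)) (trans eq (sym (Fin.toℕ-fromℕ< (distance< j)))))

    ≡-key : ∀ i j → key i ≡ key j → ∣ toℕ i - m ∣ ≡ ∣ toℕ j - m ∣
    ≡-key i j eq = trans (sym (Fin.toℕ-fromℕ< (distance< i))) (trans (cong toℕ eq) (Fin.toℕ-fromℕ< (distance< j)))

    kind : ℕ → Fin 3
    kind j with <-cmp j m
    ... | tri< _ _ _ = zero
    ... | tri≈ _ _ _ = suc zero
    ... | tri> _ _ _ = suc (suc zero)

    -- Generation starts from position `m`, so the last of the `suc m` steps starts from position
    -- `m + m`.
    flag : ℕ → Fin 2
    flag j = if does (j ≟ m + m) then suc zero else zero

    roleOf : Fin (maximumLength m) → Role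
    roleOf i = kind (toℕ i) , flag (toℕ i)

    kind-< : ∀ {j} → j < m → kind j ≡ zero
    kind-< {j} j<m with <-cmp j m
    ... | tri< _ _ _ = refl
    ... | tri≈ j≮m _ _ = ⊥-elim (j≮m j<m)
    ... | tri> j≮m _ _ = ⊥-elim (j≮m j<m)

    kind-≡ : kind m ≡ suc zero
    kind-≡ with <-cmp m m
    ... | tri< m<m _ _ = ⊥-elim (<-irrefl refl m<m)
    ... | tri≈ _ _ _   = refl
    ... | tri> _ _ m<m = ⊥-elim (<-irrefl refl m<m)

    kind-> : ∀ {j} → m < j → kind j ≡ suc (suc zero)
    kind-> {j} m<j with <-cmp j m
    ... | tri< _ _ m≮j = ⊥-elim (m≮j m<j)
    ... | tri≈ _ _ m≮j = ⊥-elim (m≮j m<j)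
    ... | tri> _ _ _ = refl

    flag-≢ : ∀ {j} → j ≢ m + m → flag j ≡ zero
    flag-≢ {j} ne = cong (λ d → if d then suc zero else zero) (dec-false (j ≟ m + m) ne)

    flag-≡ : flag (m + m) ≡ suc zero
    flag-≡ = cong (λ d → if d then suc zero else zero) (dec-true (m + m ≟ m + m) refl)

  module Sequence (𝒱 : Vocabulary) (decode : Fin (suc (Vocabulary.v 𝒱)) → Permutation′ 5)
                  (decode-token : ∀ π → decode (Injection.to (Vocabulary.token 𝒱) π) ≈ π)
                  (𝔸 : FloatArithmetic 2) (m : ℕ) where

    open Vocabulary 𝒱
    open Roles m

    tokenOf : Permutation′ 5 → Fin (suc v)
    tokenOf = Injection.to (Vocabulary.token 𝒱)

    tokenOf-cong : ∀ {π ρ} → π ≈ ρ → tokenOf π ≡ tokenOf ρ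
    tokenOf-cong {π} {ρ} = Injection.cong (Vocabulary.token 𝒱) {π} {ρ}

    multiply : Fin (suc v) → Fin (suc v) → Fin (suc v)
    multiply t t′ = tokenOf (decode t ∙ decode t′)

    multiply-token : ∀ π ρ → multiply (tokenOf π) (tokenOf ρ) ≡ tokenOf (π ∙ ρ)
    multiply-token π ρ = tokenOf-cong {decode (tokenOf π) ∙ decode (tokenOf ρ)} {π ∙ ρ} λ i →
      trans (decode-token π (decode (tokenOf ρ) ⟨$⟩ʳ i)) (cong (π ⟨$⟩ʳ_) (decode-token ρ i))

    answer : Fin 2 → Fin (suc v) → Fin (suc v)
    answer zero    t = t
    answer (suc _) t = if does (t Fin.≟ tokenOf ε) then accept else reject

    module _ {e} (θ : Parameters 2 e 2 (maximumLength m) v) (first-step : FirstStep {b = codeLength (suc m)} 𝔸 key roleOf answer θ)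
             (later-step : LaterStep {b = codeLength (suc m)} 𝔸 key roleOf answer θ multiply) where

      module _ (πs : Vec (Permutation′ 5) (suc m)) where

        private
          f : ℕ → Permutation′ 5
          f = at πs

        suffix : ℕ → Permutation′ 5
        suffix k = productFrom f (m ∸ k) (suc k)

        suffix-suc : ∀ k → k < m → suffix (suc k) ≡ f (m ∸ suc k) ∙ suffix k
        suffix-suc k k<m = cong (λ j → f (m ∸ suc k) ∙ productFrom f j (suc k)) (sym (+-∸-assoc 1 k<m))

        -- Nothing is required of the older generated tokens, because no later step attends to them.
        record Generated (k : ℕ) {m′} (xs : Vec (Fin (suc v)) (suc m′)) : Set where
          field
            given : ∀ i → toℕ i ≤ m → Vec.lookup xs i ≡ tokenOf (f (toℕ i))
            latest : ∀ {k′} → k ≡ suc k′ → Vec.lookup xs (fromℕ m′) ≡ tokenOf (suffix k′)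

        open Generated

        module _ {k m′ : ℕ} (m′≡m+k : m′ ≡ m + k) (k≤m : k ≤ m) .(l : suc m′ ≤ maximumLength m)
                 (xs : Vec (Fin (suc v)) (suc m′)) (gen : Generated k xs) where

          private
            ι : Fin (suc m′) → Fin (maximumLength m)
            ι i = inject≤ i l

            toℕ-ι : ∀ i → toℕ (ι i) ≡ toℕ i
            toℕ-ι i = Fin.toℕ-inject≤ i l

            toℕ-last : toℕ (ι (fromℕ m′)) ≡ m + k
            toℕ-last = trans (toℕ-ι (fromℕ m′)) (trans (Fin.toℕ-fromℕ m′) m′≡m+k)

            a< : m ∸ k < suc m′
            a< = s≤s (≤-trans (m∸n≤m m k) (≤-trans (m≤m+n m k) (≤-reflexive (sym m′≡m+k))))

            a : Fin (suc m′)
            a = fromℕ< a<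

            toℕ-a : toℕ (ι a) ≡ m ∸ k
            toℕ-a = trans (toℕ-ι a) (Fin.toℕ-fromℕ< a<)

            distance-last : ∣ toℕ (ι (fromℕ m′)) - m ∣ ≡ k
            distance-last = trans (cong (λ j → ∣ j - m ∣) toℕ-last) (∣m-m+k∣ m k)

            distance-a : ∣ toℕ (ι a) - m ∣ ≡ k
            distance-a = trans (cong (λ j → ∣ j - m ∣) toℕ-a) (∣m∸k-m∣ m k k≤m)

            key-hit : key (ι a) ≡ key (ι (fromℕ m′))
            key-hit = key-≡ (ι a) (ι (fromℕ m′)) (trans distance-a (sym distance-last))

            key-miss : ∀ j → j ≢ fromℕ m′ → j ≢ a → key (ι j) ≢ key (ι (fromℕ m′))
            key-miss j j≢last j≢a eq with distance-cases m k (toℕ (ι j)) (trans (≡-key (ι j) (ι (fromℕ m′)) eq) distance-last)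
            ... | inj₁ j≡m+k = j≢last (Fin.toℕ-injective (trans (sym (toℕ-ι j)) (trans j≡m+k (trans (sym toℕ-last) (toℕ-ι (fromℕ m′))))))
            ... | inj₂ j≡m∸k = j≢a (Fin.toℕ-injective (trans (sym (toℕ-ι j)) (trans j≡m∸k (trans (sym toℕ-a) (toℕ-ι a)))))

          MHM-suffix : Model.MHM 𝔸 θ l xs ≡ answer (flag (m + k)) (tokenOf (suffix k))
          MHM-suffix = helper k refl
            where
            open ≡-Reasoning
            helper : ∀ k₀ → k ≡ k₀ → Model.MHM 𝔸 θ l xs ≡ answer (flag (m + k)) (tokenOf (suffix k))
            -- At distance 0 the two attended positions coincide, and the step reproduces the last
            -- input, the suffix product of length one.
            helper zero k≡0 = begin
              Model.MHM 𝔸 θ l xs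
                ≡⟨ first-step l xs (λ j j≢last → key-miss j j≢last (j≢last ∘ λ j≡a → trans j≡a a≡last)) (flag (m + k))
                     (cong₂ _,_ (trans (cong kind (trans toℕ-last m+k≡m)) kind-≡) (cong flag toℕ-last)) ⟩
              answer (flag (m + k)) (Vec.lookup xs (fromℕ m′))
                ≡⟨ cong (answer (flag (m + k))) (trans (given gen (fromℕ m′) (≤-reflexive last≡m)) (cong (tokenOf ∘ f) last≡m)) ⟩
              answer (flag (m + k)) (tokenOf (f m))
                ≡⟨ cong (answer (flag (m + k))) (tokenOf-cong {f m} {f m ∙ ε} (λ _ → refl)) ⟩
              answer (flag (m + k)) (tokenOf (suffix 0))
                ≡⟨ cong (λ j → answer (flag (m + k)) (tokenOf (suffix j))) (sym k≡0) ⟩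
              answer (flag (m + k)) (tokenOf (suffix k)) ∎
              where
              m+k≡m : m + k ≡ m
              m+k≡m = trans (cong (m +_) k≡0) (+-identityʳ m)
              last≡m : toℕ (fromℕ m′) ≡ m
              last≡m = trans (Fin.toℕ-fromℕ m′) (trans m′≡m+k m+k≡m)
              a≡last : a ≡ fromℕ m′
              a≡last = Fin.toℕ-injective (trans (Fin.toℕ-fromℕ< a<) (trans (cong (m ∸_) k≡0) (sym last≡m)))
            helper (suc k′) k≡1+k′ = begin
              Model.MHM 𝔸 θ l xs
                ≡⟨ later-step l xs a key-hit key-miss (flag (m + k))
                     (cong₂ _,_ (trans (cong kind toℕ-a) (kind-< a<m)) (trans (cong flag toℕ-a) (flag-≢ (<⇒≢ (<-≤-trans a<m (m≤m+n m m))))))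
                     (cong₂ _,_ (trans (cong kind toℕ-last) (kind-> (subst (λ k → m < m + k) (sym k≡1+k′) (m<m+n m (s≤s z≤n))))) (cong flag toℕ-last)) ⟩
              answer (flag (m + k)) (multiply (Vec.lookup xs a) (Vec.lookup xs (fromℕ m′)))
                ≡⟨ cong (answer (flag (m + k))) (cong₂ multiply (trans (given gen a a≤m) (cong (tokenOf ∘ f) (Fin.toℕ-fromℕ< a<))) (latest gen k≡1+k′)) ⟩
              answer (flag (m + k)) (multiply (tokenOf (f (m ∸ k))) (tokenOf (suffix k′)))
                ≡⟨ cong (answer (flag (m + k))) (multiply-token (f (m ∸ k)) (suffix k′)) ⟩
              answer (flag (m + k)) (tokenOf (f (m ∸ k) ∙ suffix k′))
                ≡⟨ cong (answer (flag (m + k)) ∘ tokenOf) (trans (cong (λ k → f (m ∸ k) ∙ suffix k′) k≡1+k′)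
                     (trans (sym (suffix-suc k′ (≤-trans (≤-reflexive (sym k≡1+k′)) k≤m))) (cong suffix (sym k≡1+k′)))) ⟩
              answer (flag (m + k)) (tokenOf (suffix k)) ∎
              where
              a<m : m ∸ k < m
              a<m = ≤-trans (s≤s (≤-reflexive (cong (m ∸_) k≡1+k′)))
                (≤-trans (≤-reflexive (sym (+-∸-assoc 1 {m} {suc k′} (subst (_≤ m) k≡1+k′ k≤m)))) (m∸n≤m m k′))
              a≤m : toℕ a ≤ m
              a≤m = ≤-trans (≤-reflexive (Fin.toℕ-fromℕ< a<)) (m∸n≤m m k)

          generate : ∀ {t} → t ≡ tokenOf (suffix k) → Generated (suc k) (xs ∷ʳ t)
          generate {t} t≡ = record
            { given = λ i i≤m → let i< = s≤s (≤-trans i≤m (≤-trans (m≤m+n m k) (≤-reflexive (sym m′≡m+k)))) in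
                trans (lookup-∷ʳ xs t i (fromℕ< i<) (sym (Fin.toℕ-fromℕ< i<)))
                  (trans (given gen (fromℕ< i<) (subst (_≤ m) (sym (Fin.toℕ-fromℕ< i<)) i≤m)) (cong (tokenOf ∘ f) (Fin.toℕ-fromℕ< i<)))
            ; latest = λ { refl → trans (lookup-∷ʳ-last xs t) t≡ }
            }

        -- `k` steps have been taken and `i` remain after the current one. As i + k = m, the flag is
        -- off until i = 0, so that all intermediate tokens are plain suffix products.
        generation : ∀ i {k m′} → i + k ≡ m → m′ ≡ m + k → .(l : suc i + suc m′ < maximumLength m) (xs : Vec (Fin (suc v)) (suc m′)) → Generated k xs →
                     Model.MHM^[1+_] 𝔸 θ i l xs ≡ answer (suc zero) (tokenOf (suffix m))
        generation zero    refl m′≡ l xs gen = trans (MHM-suffix m′≡ ≤-refl (≤-trans (m≤n+m _ 1) (<⇒≤ l)) xs gen)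
          (cong (λ g → answer g (tokenOf (suffix m))) flag-≡)
        generation (suc i) {k} {m′} i+k≡m m′≡ l xs gen = generation i (trans (+-suc i k) i+k≡m) (trans (cong suc m′≡) (sym (+-suc m k))) _ _
          (generate m′≡ k≤m (≤-trans (m≤n+m _ (suc (suc i))) (<⇒≤ l)) xs gen
            (trans (MHM-suffix m′≡ k≤m (≤-trans (m≤n+m _ (suc (suc i))) (<⇒≤ l)) xs gen)
              (cong (λ g → answer g (tokenOf (suffix k))) (flag-≢ (<⇒≢ (+-monoʳ-< m k<m))))))
          where
          k<m : k < m
          k<m = ≤-trans (s≤s (m≤n+m k i)) (≤-reflexive i+k≡m)
          k≤m = <⇒≤ k<m

        chainOfThought : .(l : suc m + suc m < maximumLength m) → Model.MHM^[1+_] 𝔸 θ m l (Vec.map tokenOf πs) ≡ answer (suc zero) (tokenOf (Vec.foldr′ _∙_ ε πs))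
        chainOfThought l = trans (generation m (+-identityʳ m) (sym (+-identityʳ m)) l (Vec.map tokenOf πs)
            (record { given = λ i _ → trans (Vec.lookup-map i tokenOf πs) (cong tokenOf (lookup-at πs i)) ; latest = λ () }))
          (cong (answer (suc zero) ∘ tokenOf) (trans (cong (λ j → productFrom f j (suc m)) (n∸n≡0 m)) (sym (foldr-productFrom πs))))

      solves : .(l : suc m + suc m < maximumLength m) → Solves 𝒱 {suc m} (Model.MHM^[1+_] 𝔸 θ m l)
      solves l πs = (λ ∈WP → trans (chainOfThought πs l) (cong (λ d → if d then accept else reject)
                      (dec-true (tokenOf (Vec.foldr′ _∙_ ε πs) Fin.≟ tokenOf ε) (tokenOf-cong {Vec.foldr′ _∙_ ε πs} {ε} ∈WP))))
                  , (λ ∉WP → trans (chainOfThought πs l) (cong (λ d → if d then accept else reject)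
                      (dec-false (tokenOf (Vec.foldr′ _∙_ ε πs) Fin.≟ tokenOf ε) (∉WP ∘ Injection.injective (Vocabulary.token 𝒱) {Vec.foldr′ _∙_ ε πs} {ε}))))

-- Logarithmic embedding size and conclusion

open import Data.Nat.Base
open import Data.Nat.Logarithm using (⌊log₂_⌋; ⌊log₂⌋-mono-≤)
open import Data.Nat.Properties
open import Data.Nat.Solver using (module +-*-Solver)
open import Relation.Nullary using (¬_)
open import Relation.Unary using (_⊂_)
open WithoutChainOfThought
open TwoLayerModel
open GenerationOfProducts

-- Blocks of constant size are at most `l` times themselves, and the two blocks of code bits are
-- linear in `b`.
embeddingSize-scale : ∀ T b l → 1 ≤ l → b ≤ 3 * l → embeddingSize T b ≤ embeddingSize T 3 * l
embeddingSize-scale T b l 1≤l b≤3l = begin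
  embeddingSize T b
    ≤⟨ +-mono-≤ (scale T) (+-mono-≤ (scale 6) (+-mono-≤ (scale (T * 6)) (+-mono-≤ bits≤ (+-mono-≤ bits≤ (+-mono-≤ (scale (T * (T * 2))) (scale (T * 2))))))) ⟩
  T * l + (6 * l + (T * 6 * l + (6 * l + (6 * l + (T * (T * 2) * l + T * 2 * l)))))
    ≡⟨ solve 2 (λ T l → T :* l :+ (con 6 :* l :+ (T :* con 6 :* l :+ (con 6 :* l :+ (con 6 :* l :+ (T :* (T :* con 2) :* l :+ T :* con 2 :* l)))))
         := (T :+ (con 6 :+ (T :* con 6 :+ (con 6 :+ (con 6 :+ (T :* (T :* con 2) :+ T :* con 2)))))) :* l) refl T l ⟩
  embeddingSize T 3 * l ∎
  where
  open ≤-Reasoning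
  open +-*-Solver
  scale : ∀ x → x ≤ x * l
  scale x = m≤m*n x l {{>-nonZero 1≤l}}
  bits≤ : b * 2 ≤ 6 * l
  bits≤ = ≤-trans (*-monoˡ-≤ 2 b≤3l) (≤-reflexive (solve 1 (λ l → con 3 :* l :* con 2 := con 6 :* l) refl l))

logarithmic-embeddingSize : ∀ T → Logarithmic (λ n → embeddingSize T (codeLength n))
-- From n = 2 on the logarithm is at least 1, so the code length 2 + log₂ n is at most three times
-- the logarithm.
logarithmic-embeddingSize T = embeddingSize T 3 , 2 , λ n 2≤n → let 1≤l = ⌊log₂⌋-mono-≤ 2≤n in
  embeddingSize-scale T (codeLength n) ⌊log₂ n ⌋ 1≤l
    (≤-trans (+-monoˡ-≤ ⌊log₂ n ⌋ (*-monoʳ-≤ 2 1≤l)) (≤-reflexive (+-comm (2 * ⌊log₂ n ⌋) ⌊log₂ n ⌋)))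

module _ (𝒱 : Vocabulary) (𝔸 : ∀ p → FloatArithmetic p) where

  solution-with-CoT : ∀ m → SolvesWithCoT 𝒱 𝔸 2 (embeddingSize (suc (Vocabulary.v 𝒱)) (codeLength (suc m))) 2 m
  solution-with-CoT m = maximumLength m , parameters , ≤-refl , solves parameters (firstStep (𝔸 2)) (laterStep (𝔸 2)) ≤-refl
    where
    open Roles m using (position; key; position-injective; roleOf)
    decoder = Decode.decoder (Vocabulary.token 𝒱)
    open Sequence 𝒱 (proj₁ decoder) (proj₂ decoder) (𝔸 2) m using (multiply; answer; solves)
    open Construction {b = codeLength (suc m)} position key position-injective roleOf multiply answer using (parameters; firstStep; laterStep)

theorem7p4 : (𝒱 : Vocabulary) (𝔸 : ∀ p → FloatArithmetic p) →
    TC⁰ ⊂ NC¹ →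
    (∃[ L ] ∃[ p ] ∃[ d ] Logarithmic d ×
    (∀ m → SolvesWithCoT 𝒱 𝔸 p (d (suc m)) L m))
    × ¬ (∃[ L ] ∃[ d ] ∃[ p ] Polynomial d × Logarithmic p ×
    (∀ m → SolvesWithoutCoT 𝒱 𝔸 (p (suc m)) (d (suc m)) L m))
theorem7p4 𝒱 𝔸 TC⁰⊂NC¹ =
    (2 , 2 , (λ n → embeddingSize (suc (Vocabulary.v 𝒱)) (codeLength n))
      , logarithmic-embeddingSize (suc (Vocabulary.v 𝒱)) , solution-with-CoT 𝒱 𝔸)
  , no-solution-without-CoT 𝒱 𝔸 TC⁰⊂NC¹
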